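{- Let $n\ge 1$ and let $w$ be a fully commutative element of $W(A_n)$, written in its canonical form $$w=[i_1,j_1][i_2,j_2]\cdots[i_p,j_p],\qquad 0\le p\le n,\quad n\ge j_1>\cdots>j_p\ge 1,\quad n\ge i_1>\cdots>i_p\ge 1,\quad j_t\ge i_t\ (1\le t\le p).$$ Then: (1) $\mathcal D(w)$ is the unique non-crossing diagram $D$ on $n+1$ strings with $\mathcal I(D)=\{i_1,\dots,i_p\}$ and $\mathcal J(D)=\{j_1,\dots,j_p\}$. (2) The map $w\mapsto \mathcal D(w)$ is a bijection from the set of fully commutative elements of $W(A_n)$ onto the set of non-crossing diagrams on $n+1$ strings (i.e. with $2(n+1)$ dots), and it is the unique bijection compatible with the multiplication of monomials in the Temperley–Lieb algebra and the multiplication of diagrams; i.e. it is the bijection induced on bases by the unique algebra isomorphism $TL_{R,\delta}(A_n)\to\mathcal D_{R,\delta}(n+1)$ sending $e_i$ to $E_i$ for $1\le i\le n$, so that $e_w\mapsto \mathcal D(w)$.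
   Context: $W(A_n)$ is the Coxeter group with generators $\sigma_1,\dots,\sigma_n$, relations $\sigma_i^2=1$, $\sigma_i\sigma_{i+1}\sigma_i=\sigma_{i+1}\sigma_i\sigma_{i+1}$, and $\sigma_i\sigma_j=\sigma_j\sigma_i$ for $|i-j|>1$. An element is fully commutative (FC) if any two of its reduced expressions are related by commutation relations only. For $1\le i\le j\le n$ put $[i,j]=\sigma_i\sigma_{i+1}\cdots\sigma_j$. Every FC element has a unique expression (canonical form) $[i_1,j_1]\cdots[i_p,j_p]$ with the displayed inequalities, and each such expression is a reduced expression of an FC element; $p$ is its size (the identity has size $0$). Temperley–Lieb algebra: for a commutative ring $R$ with $1$ and $\delta\in R$, $TL_{R,\delta}(A_n)$ is the $R$-algebra with generators $e_1,\dots,e_n$ and relations $e_i^2=\delta e_i$, $e_ie_{i\pm1}e_i=e_i$, $e_ie_j=e_je_i$ for $|i-j|>1$; for $w$ FC in canonical form, $e_w=e_{i_1}e_{i_1+1}\cdots e_{j_1}\cdots e_{i_p}\cdots e_{j_p}$, and these form an $R$-basis. Non-crossing diagrams: a non-crossing diagram on $n+1$ strings has a top row of dots $A=\{1,\dots,n+1\}$ and a bottom row $B=\{1',\dots,(n+1)'\}$ (numbered left to right), each dot joined to exactly one other dot, with no two joins crossing when drawn inside the rectangle. Order $A\cup B$ by $1<\cdots<n+1<1'<\cdots<(n+1)'$; a join is written as an arrow $(x,y)$ with $x<y$, $x$ the tail and $y$ the head. The concatenation $D_1\ast D_2$ is obtained by placing $D_2$ below $D_1$, identifying the bottom row of $D_1$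 with the top row of $D_2$, following the paths, and deleting the closed circles formed; the product is $D_1D_2=\delta^{m}D_1\ast D_2$ where $m$ is the number of deleted circles. $\mathcal D_{R,\delta}(n+1)$ is the free $R$-module on the non-crossing diagrams with this product. $E_i$ is the diagram with arrows $(i,i+1)$, $(i',(i+1)')$ and $(j,j')$ for $j\notin\{i,i+1\}$. For $w$ FC in canonical form, $\mathcal D(w)=E_{i_1}\ast E_{i_1+1}\ast\cdots\ast E_{j_1}\ast E_{i_2}\ast\cdots\ast E_{j_p}$ (identity diagram $\{(x,x')\}$ if $p=0$). For a diagram $D$: $AD$ = arrows with both endpoints in $A$; $BD$ = arrows with both endpoints in $B$; $D^+$ = arrows $(x,y')$ with $x,y\in A$, $x<y$. $\mathcal I(D)$ is the set of tails of arrows in $AD\cup D^+$; $\mathcal J(D)=\{j\in A: (j+1)'\text{ is the head of an arrow in }BD\cup D^+\}$. -}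

module Defs where

open import Level using (Level; _⊔_)
open import Data.Bool using (Bool; true; false; if_then_else_)
open import Data.Nat as ℕ using (ℕ; zero; suc; _≤_; _<_; _<?_; _∸_; _≤ᵇ_)
open import Data.Fin as Fin using (Fin; toℕ; fromℕ<; fromℕ)
import Data.Fin.Properties as FinP
open import Data.Sum using (_⊎_; inj₁; inj₂)
import Data.Sum.Properties as SumP
open import Data.Product using (Σ; ∃; _×_; _,_; proj₁; proj₂)
import Data.Product.Properties as ProdP
open import Data.Vec as Vec using (Vec; lookup; tabulate)
import Data.Vec.Properties as VecP
open import Data.List as List using (List; []; _∷_; _++_; map; concatMap; mapMaybe; upTo; allFin; foldl)
open import Data.Nat.ListAction using (sum)
import Data.List.Properties as ListP
open import Data.List.Relation.Unary.All using (All)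
open import Data.List.Relation.Unary.Linked using (Linked)
open import Data.Maybe using (Maybe; just; nothing)
import Data.Maybe as Maybe
open import Relation.Binary.PropositionalEquality using (_≡_; _≢_)
open import Relation.Binary.Definitions using (DecidableEquality)
open import Relation.Nullary using (¬_; yes; no; does)
open import Algebra.Bundles using (CommutativeRing)

-- Conventions.  n is the number of Coxeter generators (W(A_n)), so the
-- diagrams have  suc n  strings.  Dots are 0-based internally: the Fin
-- index k stands for the paper's dot k+1 (top row, set A) or (k+1)'
-- (bottom row, set B).  Generator indices (sigma_i, e_i, E_i) are 1-based
-- natural numbers as in the paper.

-- clamp a natural number into Fin (suc n) (only ever applied in range)
clampFin : ∀ {n} → ℕ → Fin (suc n)
clampFin {n} m with m <? suc n
... | yes p = fromℕ< p
... | no _  = fromℕ n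

-- a dot: inj₁ k = top dot (in A), inj₂ k = bottom dot (in B)
Pt : ℕ → Set
Pt n = Fin (suc n) ⊎ Fin (suc n)

-- a (raw) diagram: the partner of every top dot and of every bottom dot
Diag : ℕ → Set
Diag n = Vec (Pt n) (suc n) × Vec (Pt n) (suc n)

match : ∀ {n} → Diag n → Pt n → Pt n
match D (inj₁ k) = lookup (proj₁ D) k
match D (inj₂ k) = lookup (proj₂ D) k

mkDiag : ∀ {n} → (Pt n → Pt n) → Diag n
mkDiag f = tabulate (λ k → f (inj₁ k)) , tabulate (λ k → f (inj₂ k))

_≟D_ : ∀ {n} → DecidableEquality (Diag n)
_≟D_ = ProdP.≡-dec (VecP.≡-dec (SumP.≡-dec FinP._≟_ FinP._≟_))
                   (VecP.≡-dec (SumP.≡-dec FinP._≟_ FinP._≟_))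

IsPairing : ∀ {n} → Diag n → Set
IsPairing D = ∀ x → (match D x ≢ x) × (match D (match D x) ≡ x)

-- position of a dot when going around the boundary of the rectangle:
-- top row left to right (0..n), then bottom row right to left (n+1..2n+1)
bpos : ∀ {n} → Pt n → ℕ
bpos (inj₁ k) = toℕ k
bpos {n} (inj₂ k) = (n ℕ.+ suc n) ∸ toℕ k

Between : ℕ → ℕ → ℕ → Set
Between a b c = (a < b × b < c) ⊎ (c < b × b < a)

-- no two joins cross (chords of the boundary circle do not interleave)
NonCrossing : ∀ {n} → Diag n → Set
NonCrossing D = ∀ x y → Between (bpos x) (bpos y) (bpos (match D x))
                      → Between (bpos x) (bpos (match D y)) (bpos (match D x))

NCDiagram : ∀ {n} → Diag n → Set
NCDiagram D = IsPairing D × NonCrossing D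

idDiag : ∀ {n} → Diag n
idDiag = mkDiag f
  where
  f : _ → _
  f (inj₁ k) = inj₂ k
  f (inj₂ k) = inj₁ k

-- E_i (1 ≤ i ≤ n): arrows (i,i+1), (i',(i+1)'), (j,j') otherwise
private
  pickE : ∀ {n} → (Fin (suc n) → Pt n) → (Fin (suc n) → Pt n) → ℕ → Fin (suc n) → Pt n
  pickE same other i k with toℕ k ℕ.≟ (i ∸ 1) | toℕ k ℕ.≟ i
  ... | yes _ | _     = same (clampFin i)
  ... | no _  | yes _ = same (clampFin (i ∸ 1))
  ... | no _  | no _  = other k

E : ∀ {n} → ℕ → Diag n
E i = mkDiag f
  where
  f : _ → _
  f (inj₁ k) = pickE inj₁ inj₂ i k
  f (inj₂ k) = pickE inj₂ inj₁ i k

-- Concatenation D1 ∗ D2 (D2 placed below D1) and number of closed circles.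
-- The middle row (bottom of D1 = top of D2) is indexed by Fin (suc n).

private
  -- follow a path through the middle row; true = entering D2 from its top
  -- at middle dot k, false = entering D1 from its bottom at middle dot k.
  walk : ∀ {n} → Diag n → Diag n → ℕ → Bool → Fin (suc n) → Pt n
  walk D1 D2 zero _ k = inj₁ k
  walk D1 D2 (suc f) true k with match D2 (inj₁ k)
  ... | inj₂ j  = inj₂ j
  ... | inj₁ k' = walk D1 D2 f false k'
  walk D1 D2 (suc f) false k with match D1 (inj₂ k)
  ... | inj₁ j  = inj₁ j
  ... | inj₂ k' = walk D1 D2 f true k'

  concatFun : ∀ {n} → Diag n → Diag n → Pt n → Pt n
  concatFun {n} D1 D2 (inj₁ i) with match D1 (inj₁ i)
  ... | inj₁ j = inj₁ j
  ... | inj₂ k = walk D1 D2 (2 ℕ.* suc n) true k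
  concatFun {n} D1 D2 (inj₂ i) with match D2 (inj₂ i)
  ... | inj₂ j = inj₂ j
  ... | inj₁ k = walk D1 D2 (2 ℕ.* suc n) false k

  -- closed path through middle dot s: list of its middle dots, if closed
  circ : ∀ {n} → Diag n → Diag n → ℕ → Fin (suc n) → Fin (suc n) → Maybe (List (Fin (suc n)))
  circ D1 D2 zero s c = nothing
  circ D1 D2 (suc f) s c with match D2 (inj₁ c)
  ... | inj₂ _  = nothing
  ... | inj₁ c1 with match D1 (inj₂ c1)
  ...   | inj₁ _  = nothing
  ...   | inj₂ c2 with c2 FinP.≟ s
  ...     | yes _ = just (c ∷ c1 ∷ [])
  ...     | no _  = Maybe.map (λ l → c ∷ c1 ∷ l) (circ D1 D2 f s c2)

  allB : ∀ {A : Set} → (A → Bool) → List A → Bool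
  allB p [] = true
  allB p (x ∷ xs) = if p x then allB p xs else false

  circleMin : ∀ {n} → Diag n → Diag n → Fin (suc n) → Bool
  circleMin {n} D1 D2 k with circ D1 D2 (suc n) k k
  ... | nothing = false
  ... | just l  = allB (λ x → toℕ k ≤ᵇ toℕ x) l

_∗_ : ∀ {n} → Diag n → Diag n → Diag n
D1 ∗ D2 = mkDiag (concatFun D1 D2)

circles : ∀ {n} → Diag n → Diag n → ℕ
circles {n} D1 D2 =
  sum (map (λ k → if circleMin D1 D2 k then 1 else 0) (allFin (suc n)))

-- The sets I(D), J(D)  (as predicates on the 1-based labels 1..n+1)

-- k ∈ I(D): the top dot k is the tail of an arrow in AD ∪ D⁺
InI : ∀ {n} → Diag n → ℕ → Set
InI {n} D k = Σ (Fin (suc n)) λ i → suc (toℕ i) ≡ k ×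
  Σ (Fin (suc n)) λ j → (match D (inj₁ i) ≡ inj₁ j ⊎ match D (inj₁ i) ≡ inj₂ j)
                        × toℕ i < toℕ j

-- k ∈ J(D): k ∈ A and the bottom dot (k+1)' is the head of an arrow in BD ∪ D⁺
InJ : ∀ {n} → Diag n → ℕ → Set
InJ {n} D k = Σ (Fin (suc n)) λ b → toℕ b ≡ k ×
  Σ (Fin (suc n)) λ c → (match D (inj₂ b) ≡ inj₂ c ⊎ match D (inj₂ b) ≡ inj₁ c)
                        × toℕ c < toℕ b

-- Canonical forms of fully commutative elements of W(A_n):
-- a list ((i_1,j_1) ∷ … ∷ (i_p,j_p)) with  n ≥ j_1 > … > j_p ≥ 1,
-- n ≥ i_1 > … > i_p ≥ 1,  j_t ≥ i_t.

Canonical : ℕ → List (ℕ × ℕ) → Set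
Canonical n ws =
  All (λ p → 1 ≤ proj₁ p × proj₁ p ≤ proj₂ p × proj₂ p ≤ n) ws
  × Linked (λ p q → proj₁ q < proj₁ p × proj₂ q < proj₂ p) ws

-- [i,j] = σ_i σ_{i+1} … σ_j  as a list of generator indices
range : ℕ → ℕ → List ℕ
range i j = map (i ℕ.+_) (upTo (suc j ∸ i))

cword : List (ℕ × ℕ) → List ℕ
cword ws = concatMap (λ p → range (proj₁ p) (proj₂ p)) ws

prodE : ∀ {n} → List ℕ → Diag n
prodE [] = idDiag
prodE (a ∷ as) = foldl (λ D b → D ∗ E b) (E a) as

𝒟 : (n : ℕ) → List (ℕ × ℕ) → Diag n
𝒟 n ws = prodE (cword ws)

-- generator e_i (1 ≤ i ≤ n) is the letter  i-1 : Fin n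
toLetter : (n : ℕ) → ℕ → Maybe (Fin n)
toLetter n zero = nothing
toLetter n (suc i) with i <? n
... | yes p = just (fromℕ< p)
... | no _  = nothing

module Alg {c ℓ : Level} (R : CommutativeRing c ℓ)
           (δ : CommutativeRing.Carrier R) (n : ℕ) where
  open CommutativeRing R

  FreeMod : Set → Set c
  FreeMod X = List (Carrier × X)

  coeff : ∀ {X : Set} → DecidableEquality X → X → FreeMod X → Carrier
  coeff eq x [] = 0#
  coeff eq x (p ∷ l) = (if does (eq x (proj₂ p)) then proj₁ p else 0#) + coeff eq x l

  scale : ∀ {X : Set} → Carrier → FreeMod X → FreeMod X
  scale r = map (λ p → r * proj₁ p , proj₂ p)

  mulF : ∀ {X : Set} → (X → X → Carrier × X) → FreeMod X → FreeMod X → FreeMod X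
  mulF m xs ys = concatMap (λ p → map (λ q →
      (proj₁ p * proj₁ q) * proj₁ (m (proj₂ p) (proj₂ q)) , proj₂ (m (proj₂ p) (proj₂ q))) ys) xs

  pow : ℕ → Carrier
  pow zero = 1#
  pow (suc k) = δ * pow k

  Word : Set
  Word = List (Fin n)

  TLE : Set c
  TLE = FreeMod Word

  _*T_ : TLE → TLE → TLE
  _*T_ = mulF (λ u v → 1# , u ++ v)

  mono : Word → TLE
  mono u = (1# , u) ∷ []

  -- the congruence defining TL_{R,δ}(A_n) as the quotient of the free
  -- algebra by the two-sided ideal generated by the defining relations
  data _≈T_ : TLE → TLE → Set (c ⊔ ℓ) where
    coeff-eq : ∀ {x y} → (∀ u → coeff (ListP.≡-dec FinP._≟_) u x ≈ coeff (ListP.≡-dec FinP._≟_) u y) → x ≈T y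
    sym-T    : ∀ {x y} → x ≈T y → y ≈T x
    trans-T  : ∀ {x y z} → x ≈T y → y ≈T z → x ≈T z
    +-cong-T : ∀ {x x' y y'} → x ≈T x' → y ≈T y' → (x ++ y) ≈T (x' ++ y')
    *-cong-T : ∀ {x x' y y'} → x ≈T x' → y ≈T y' → (x *T y) ≈T (x' *T y')
    rel-sq   : ∀ i → mono (i ∷ i ∷ []) ≈T ((δ , i ∷ []) ∷ [])
    rel-br₁  : ∀ i j → toℕ j ≡ suc (toℕ i) → mono (i ∷ j ∷ i ∷ []) ≈T mono (i ∷ [])
    rel-br₂  : ∀ i j → toℕ j ≡ suc (toℕ i) → mono (j ∷ i ∷ j ∷ []) ≈T mono (j ∷ [])
    rel-comm : ∀ i j → suc (suc (toℕ i)) ≤ toℕ j → mono (i ∷ j ∷ []) ≈T mono (j ∷ i ∷ [])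

  gen : Fin n → TLE
  gen i = mono (i ∷ [])

  eMon : List (ℕ × ℕ) → TLE
  eMon ws = mono (mapMaybe (toLetter n) (cword ws))

  -- the diagram algebra 𝒟_{R,δ}(n+1): elements are formal combinations
  -- of non-crossing diagrams (see AllNC), D1 D2 = δ^m (D1 ∗ D2)
  DE : Set c
  DE = FreeMod (Diag n)

  AllNC : DE → Set c
  AllNC = All (λ p → NCDiagram (proj₂ p))

  _*D_ : DE → DE → DE
  _*D_ = mulF (λ D1 D2 → pow (circles D1 D2) , D1 ∗ D2)

  _≈D_ : DE → DE → Set ℓ
  x ≈D y = ∀ d → coeff _≟D_ d x ≈ coeff _≟D_ d y

  single : Diag n → DE
  single D = (1# , D) ∷ []

  Egen : Fin n → DE
  Egen i = single (E (suc (toℕ i)))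

  record IsAlgHom (φ : TLE → DE) : Set (c ⊔ ℓ) where
    field
      well-def : ∀ {x y} → x ≈T y → φ x ≈D φ y
      into-NC  : ∀ x → AllNC (φ x)
      hom-+    : ∀ x y → φ (x ++ y) ≈D (φ x ++ φ y)
      hom-·    : ∀ r x → φ (scale r x) ≈D scale r (φ x)
      hom-*    : ∀ x y → φ (x *T y) ≈D (φ x *D φ y)
      hom-1    : φ (mono []) ≈D single idDiag

  record IsAlgIso (φ : TLE → DE) : Set (c ⊔ ℓ) where
    field
      isHom      : IsAlgHom φ
      injective  : ∀ x y → φ x ≈D φ y → x ≈T y
      surjective : ∀ y → AllNC y → Σ TLE λ x → φ x ≈D y

-- Left multiplication of a diagram by E_i is a surgery: the top dots i and
-- i + 1 are joined to each other, and so are their former partners; a circle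
-- appears if and only if the two dots were joined already.  Following the
-- strands of a concatenation through a surgery gives (E_i D) D' = E_i (D D'),
-- including the powers of δ, and so reduces products of generators to
-- iterated surgeries.
--
-- The surgeries of an interval [i, j], performed from j down to i, add the
-- element i to I and j to J, which computes I and J of 𝒟(w).  Conversely,
-- sweep the dots of a diagram in the order 1', 1, 2', 2, …  The sets I and J
-- tell which dots open an arrow and which close one, and planarity leaves a
-- closing dot no choice of partner; so I and J determine the diagram.
-- Counting the open arrows during the sweep shows that J has at most as many
-- elements up to k as I, and as many up to n; hence I and J pair up to a
-- canonical form.
--
-- In the Temperley–Lieb algebra every monomial is a multiple of a canonical
-- one: the largest letter need occur only once (Jones), and is then moved to
-- the front.  Since canonical monomials go to distinct diagrams, the induced
-- homomorphism is bijective.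

module Submission where

open import Defs
open import Level using (Level; _⊔_)
open import Data.Bool using (Bool; true; false; T; if_then_else_; _xor_; _∧_; not)
open import Data.Bool.Properties using (¬-not; xor-comm; xor-same; ∧-zeroʳ)
open import Data.Empty using (⊥; ⊥-elim)
open import Data.Unit using (⊤; tt)
open import Data.Nat as ℕ using (ℕ; zero; suc; _+_; _∸_; _≤_; _<_; z≤n; s≤s)
import Data.Nat.Properties as ℕₚ
open ℕₚ using (≤-refl; ≤-trans; ≤-reflexive; ≤-antisym; ≤-pred; ≤-<-trans; <-≤-trans; <-trans; <-irrefl; <⇒≤; <⇒≱; ≮⇒≥; ≰⇒>;
  ≤∧≢⇒<; n<1+n; n≤1+n; 1+n≢n; m≤n⇒m≤1+n; +-mono-≤)
open import Data.Nat.Induction using (<-wellFounded; Acc; acc)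
open import Data.Nat.ListAction using (sum)
open import Data.Fin as Fin using (Fin; zero; suc; toℕ; fromℕ<; inject₁)
import Data.Fin.Properties as Finₚ
open Finₚ using (toℕ-injective; toℕ-inject₁)
open import Data.Sum using (_⊎_; inj₁; inj₂)
import Data.Sum.Properties as Sumₚ
open Sumₚ using (inj₁-injective; inj₂-injective)
open import Data.Product using (Σ; ∃; _×_; _,_; proj₁; proj₂)
open import Data.Maybe as Maybe using (Maybe; just; nothing; maybe)
open import Data.Vec as Vec using (tabulate)
import Data.Vec.Properties as Vecₚ
open import Data.List as List using (List; []; _∷_; _++_; map; mapMaybe; foldr; foldl; length; allFin)
import Data.List.Properties as Listₚ
open import Data.List.Membership.Propositional using (_∈_)
open import Data.List.Relation.Unary.All as All using (All; []; _∷_)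
open import Data.List.Relation.Unary.All.Properties using (++⁺)
open import Data.List.Relation.Unary.Any using (here; there)
open import Data.List.Relation.Unary.Linked using (Linked; []; [-]; _∷_)
open import Data.List.Relation.Unary.Linked.Properties using (Linked⇒AllPairs; AllPairs⇒Linked)
open import Data.List.Relation.Unary.AllPairs as AllPairs using (AllPairs; []; _∷_)
import Data.List.Membership.Propositional.Properties as ∈ₚ
open import Function using (_∘_; id; case_of_)
open import Function.Bundles using (_⇔_; mk⇔; Equivalence)
open Equivalence using () renaming (to to to⇔; from to from⇔)
open import Relation.Binary.PropositionalEquality hiding (setoid)
open import Relation.Binary.Definitions using (DecidableEquality; tri<; tri≈; tri>)
open import Relation.Nullary using (¬_; yes; no; does)
open import Algebra.Bundles using (CommutativeRing)
open import Tactic.Cong using (cong!)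

-- The evaluation of ∗ and of circles

-- The surgery identity is one-sided: the left factor is built from generators, the right factor is
-- an arbitrary pairing. Induction on the left word therefore covers all products, and the defining
-- relations need checking on the identity diagram alone. Concatenation is computed by a walk with
-- limited fuel, so strands are first described by a relation without fuel; a strand never repeats a
-- state, and this shows that the fuel suffices. In the sweep a vertical arrow counts neither for
-- `I` nor for `J`. With the bottom dot first in each column, a vertical arrow opens below and
-- closes above; so the opening top dots are exactly those of `I`, and the closing bottom dots those
-- of `J`. The element δ is arbitrary, possibly zero or a zero divisor, so it is not enough for
-- injectivity that canonical words have distinct diagrams. Their products of generators also close
-- no circle, so that their images have coefficient 1.

_≟ᵇ_ : ∀ {n} → Fin n → Fin n → Bool
a ≟ᵇ b = does (a Finₚ.≟ b)

-- The functions behind _∗_ and circles are private.  They are recovered here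
-- as solutions of unification problems: each `_` below is the unique term
-- that makes the accompanying equation hold by refl.

mutual
  concatTop₀ concatBot₀ : ∀ {n} → Diag n → Diag n → Pt n
  concatTop₀ = _
  concatBot₀ = _

  concatTop₊ concatBot₊ : ∀ {n} → Diag n → Diag n → Fin n → Pt n
  concatTop₊ = _
  concatBot₊ = _

  ∗-unfold : ∀ {n} (D D' : Diag n) →
    D ∗ D' ≡ (concatTop₀ D D' Vec.∷ tabulate (concatTop₊ D D') , concatBot₀ D D' Vec.∷ tabulate (concatBot₊ D D'))
  ∗-unfold D D' = refl

-- Generalising the fuel n + suc (n + 0) to a variable makes the problem linear.
mutual
  walkDown walkUp : ∀ {n} → Diag n → Diag n → ℕ → Fin (suc n) → Pt n
  walkDown = _
  walkUp = _

  walkUp-solve : ∀ {n} (D D' : Diag n) {k l} → match D (inj₁ zero) ≡ inj₂ k → match D' (inj₁ k) ≡ inj₁ l →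
    concatTop₀ D D' ≡ walkUp D D' (n + suc (n + 0)) l
  walkUp-solve {n} D D' e e' rewrite e | e' with n + suc (n + 0)
  ... | m = refl

  walkDown-solve : ∀ {n} (D D' : Diag n) {k l} → match D' (inj₂ zero) ≡ inj₁ k → match D (inj₂ k) ≡ inj₂ l →
    concatBot₀ D D' ≡ walkDown D D' (n + suc (n + 0)) l
  walkDown-solve {n} D D' e e' rewrite e | e' with n + suc (n + 0)
  ... | m = refl

mutual
  circleMinAt : ∀ {n} → Diag n → Diag n → Fin (suc n) → Bool
  circleMinAt = _

  circles-unfold : ∀ {n} (D D' : Diag n) →
    circles D D' ≡ sum (map (λ k → if circleMinAt D D' k then 1 else 0) (allFin (suc n)))
  circles-unfold D D' = refl

Trace : ℕ → Set
Trace n = Maybe (List (Fin (suc n)))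

-- This is the `Maybe.map` step of the tracing function, spelt as the `maybe` to which it unfolds,
-- so that `with` finds it in the normalised goal.
cons² : ∀ {n} → Fin (suc n) → Fin (suc n) → Trace n → Trace n
cons² {n} c d = maybe {A = List (Fin (suc n))} {B = λ _ → Trace n} (λ l → just (c ∷ d ∷ l)) nothing

-- Abstracting cons² k c leaves a neutral h, under which unification can descend.
mutual
  testAfter : ∀ {n} → Diag n → Diag n → Fin (suc n) → (Trace n → Trace n) → Fin (suc n) → Bool
  testAfter = _

  testAfter-solve : ∀ {n} (D D' : Diag n) k {c d} → match D' (inj₁ k) ≡ inj₁ c → match D (inj₂ c) ≡ inj₂ d →
    (d ≟ᵇ k) ≡ false → circleMinAt D D' k ≡ testAfter D D' k (cons² k c) d
  testAfter-solve D D' k {c} {d} e e' d≢k rewrite e | e' with d Finₚ.≟ k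
  ... | no _ with cons² k c
  ... | h = refl

-- With a constant prefix, testAfter is the final test on an arbitrary trace.
minTest : ∀ {n} → Diag n → Diag n → Fin (suc n) → Trace n → Bool
minTest D D' k x = testAfter D D' k (λ _ → x) k

-- In the trace the fuel is tied to the size n, so that it is no separate
-- variable in any unification problem; anti-unifying the traces with fuel
-- suc m and m, both of size suc m, separates the two.
trace-antiunify :
  let trace₀ : ∀ {n} → Diag n → Diag n → (k c : Fin (suc n)) → Trace n
      trace₀ = _
      trace₁ : ∀ {m} → Diag (suc m) → Diag (suc m) → (k c : Fin (suc (suc m))) → Trace (suc m)
      trace₁ = _
  in (∀ {n} (D D' : Diag n) k h c → testAfter D D' k h c ≡ minTest D D' k (h (trace₀ D D' k c)))
   × (∀ {m} (D D' : Diag (suc m)) k c d e (h : Trace (suc m) → Trace (suc m)) →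
        match D' (inj₁ c) ≡ inj₁ d → match D (inj₂ d) ≡ inj₂ e → (e ≟ᵇ k) ≡ false →
        h (trace₀ D D' k c) ≡ h (cons² c d (trace₁ D D' k e)))
   × (∀ {m} (D D' : Diag (suc m)) k c → suc m ≡ m → trace₀ D D' k c ≡ trace₁ D D' k c)
trace-antiunify .proj₁ D D' k h c = refl
trace-antiunify .proj₂ .proj₁ D D' k c d e h p q e≢k rewrite p | q with e Finₚ.≟ k
... | no _ with cons² c d
... | g = refl
trace-antiunify .proj₂ .proj₂ D D' k c p = cong! p

-- Heterogeneous, so that it can compare two equality proofs whose end points still involve the
-- unknown `trace`.
data _≅_ {A : Set} (a : A) : {B : Set} → B → Set where
  refl : a ≅ a

mutual
  trace : ∀ {m} → Diag (suc m) → Diag (suc m) → (k c : Fin (suc (suc m))) → ℕ → Trace (suc m)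
  trace = _

  -- `cong!` abstracts the fuel from the two traces, and its proof unfolds to `cong` of that
  -- abstraction. Equating it by `refl` with `cong (trace D D' k c) p` makes unification read off
  -- `trace`; `p` marks the place where the two fuels differ.
  trace-solve : ∀ {m} (D D' : Diag (suc m)) k c (p : suc m ≡ m) → ⊤
  trace-solve D D' k c p = const-tt {x = trace-antiunify .proj₂ .proj₂ D D' k c p} {cong (trace D D' k c) p} refl
    where
    const-tt : ∀ {A B : Set} {x : A} {y : B} → x ≅ y → ⊤
    const-tt _ = tt

circleMinAt-trace : ∀ {m} (D D' : Diag (suc m)) k → circleMinAt D D' k ≡ minTest D D' k (trace D D' k k (suc (suc m)))
circleMinAt-trace D D' k = refl

column : ∀ {n} → Pt n → Fin (suc n)
column (inj₁ k) = k
column (inj₂ k) = k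

-- Strands of a concatenation and a bound on their length

module _ {n : ℕ} (f g : Pt n → Pt n) where

  -- Path b u q: entering f (b = false) or g (b = true) at its dot u, the
  -- concatenated strand ends at the outer dot q.
  data Path : Bool → Pt n → Pt n → Set where
    exitTop : ∀ {u j} → f u ≡ inj₁ j → Path false u (inj₁ j)
    passDown : ∀ {u k q} → f u ≡ inj₂ k → Path true (inj₁ k) q → Path false u q
    exitBot : ∀ {u j} → g u ≡ inj₂ j → Path true u (inj₂ j)
    passUp : ∀ {u k q} → g u ≡ inj₁ k → Path false (inj₂ k) q → Path true u q

  len : ∀ {b u q} → Path b u q → ℕ
  len (exitTop _) = 1
  len (passDown _ π) = suc (len π)
  len (exitBot _) = 1
  len (passUp _ π) = suc (len π)

  inj₁≢inj₂ : ∀ {p : Pt n} {j k} → p ≡ inj₁ j → p ≡ inj₂ k → ⊥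
  inj₁≢inj₂ refl ()

  -- Each step is forced: the value of `f` or `g` at the current dot decides between leaving and
  -- continuing.
  len-unique : ∀ {b u q q'} (π : Path b u q) (ρ : Path b u q') → len π ≡ len ρ
  len-unique (exitTop _) (exitTop _) = refl
  len-unique (exitTop e) (passDown e' _) = ⊥-elim (inj₁≢inj₂ e e')
  len-unique (passDown e _) (exitTop e') = ⊥-elim (inj₁≢inj₂ e' e)
  len-unique (passDown e π) (passDown e' ρ) with trans (sym e) e'
  ... | refl = cong suc (len-unique π ρ)
  len-unique (exitBot _) (exitBot _) = refl
  len-unique (exitBot e) (passUp e' _) = ⊥-elim (inj₁≢inj₂ e' e)
  len-unique (passUp e _) (exitBot e') = ⊥-elim (inj₁≢inj₂ e e')
  len-unique (passUp e π) (passUp e' ρ) with trans (sym e) e'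
  ... | refl = cong suc (len-unique π ρ)

  middle : Bool × Fin (suc n) → Pt n
  middle (true , k) = inj₁ k
  middle (false , k) = inj₂ k

  state : ∀ {b u q} (π : Path b u q) → Fin (len π) → Bool × Fin (suc n)
  state {b} {u} (exitTop _) _ = b , column u
  state {b} {u} (exitBot _) _ = b , column u
  state {b} {u} (passDown _ _) zero = b , column u
  state (passDown _ π) (suc i) = state π i
  state {b} {u} (passUp _ _) zero = b , column u
  state (passUp _ π) (suc i) = state π i

  restart : ∀ {b u v q} (π : Path b u q) → u ≡ v → Σ (Path b v q) λ ρ → len ρ + 0 ≡ len π
  restart π refl = π , ℕₚ.+-identityʳ (len π)

  -- Cutting off the first `i` steps leaves a path from the `i`-th state, and the length of that
  -- path records `i`.
  remainder : ∀ {b u q} (π : Path b u q) → u ≡ middle (b , column u) → (i : Fin (len π)) →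
    Σ (Path (proj₁ (state π i)) (middle (state π i)) q) λ ρ → len ρ + toℕ i ≡ len π
  remainder π@(exitTop _) u-mid zero = restart π u-mid
  remainder π@(exitBot _) u-mid zero = restart π u-mid
  remainder π@(passDown _ _) u-mid zero = restart π u-mid
  remainder π@(passUp _ _) u-mid zero = restart π u-mid
  remainder (passDown _ π) _ (suc i) with remainder π refl i
  ... | ρ , e = ρ , trans (ℕₚ.+-suc (len ρ) (toℕ i)) (cong suc e)
  remainder (passUp _ π) _ (suc i) with remainder π refl i
  ... | ρ , e = ρ , trans (ℕₚ.+-suc (len ρ) (toℕ i)) (cong suc e)

  -- A repeated state would be the start of two paths of different lengths.
  state-injective : ∀ {b u q} (π : Path b u q) → u ≡ middle (b , column u) →
    ∀ {i j} → state π i ≡ state π j → i ≡ j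
  state-injective π u-mid {i} {j} e with state π i | remainder π u-mid i | state π j | remainder π u-mid j
  state-injective π u-mid {i} {j} refl | _ | ρ , eᵢ | _ | σ , eⱼ =
    toℕ-injective (ℕₚ.+-cancelˡ-≡ (len σ) _ _
      (trans (cong (_+ toℕ i) (len-unique σ ρ)) (trans eᵢ (sym eⱼ))))

  encode : Bool × Fin (suc n) → Fin (2 ℕ.* suc n)
  encode (false , k) = Fin.combine {2} zero k
  encode (true , k) = Fin.combine {2} (suc zero) k

  encode-injective : ∀ {x y} → encode x ≡ encode y → x ≡ y
  encode-injective {false , k} {false , l} e = cong (false ,_) (proj₂ (Finₚ.combine-injective {2} zero k zero l e))
  encode-injective {false , k} {true , l} e with proj₁ (Finₚ.combine-injective {2} zero k (suc zero) l e)
  ... | ()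
  encode-injective {true , k} {false , l} e with proj₁ (Finₚ.combine-injective {2} (suc zero) k zero l e)
  ... | ()
  encode-injective {true , k} {true , l} e = cong (true ,_) (proj₂ (Finₚ.combine-injective {2} (suc zero) k (suc zero) l e))

  -- The states are distinct and there are `2 * suc n` of them, which is exactly the fuel of the
  -- walk in `_∗_`.
  len-bound : ∀ {b u q} (π : Path b u q) → u ≡ middle (b , column u) → len π ≤ 2 ℕ.* suc n
  len-bound π u-mid = Finₚ.injective⇒≤ {f = encode ∘ state π} (state-injective π u-mid ∘ encode-injective)

isBottom : ∀ {n} → Pt n → Bool
isBottom (inj₁ _) = false
isBottom (inj₂ _) = true

-- Concatenation as a relation, free of fuel. A top dot starts its strand in the upper diagram and a
-- bottom dot in the lower one, whence `isBottom p`.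
Joins : ∀ {n} → Diag n → Diag n → (Pt n → Pt n) → Set
Joins D D' h = ∀ p → Path (match D) (match D') (isBottom p) p (h p)

module _ {n : ℕ} (D D' : Diag n) where

  private
    walkDown-path : ∀ {fuel k q} (π : Path (match D) (match D') true (inj₁ k) q) → len _ _ π ≤ fuel → walkDown D D' fuel k ≡ q
    walkUp-path : ∀ {fuel k q} (π : Path (match D) (match D') false (inj₂ k) q) → len _ _ π ≤ fuel → walkUp D D' fuel k ≡ q

    walkDown-path (exitBot e) (s≤s _) rewrite e = refl
    walkDown-path (passUp e π) (s≤s le) rewrite e = walkUp-path π le
    walkUp-path (exitTop e) (s≤s _) rewrite e = refl
    walkUp-path (passDown e π) (s≤s le) rewrite e = walkDown-path π le

    concatTop concatBot : Fin (suc n) → Pt n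
    concatTop zero = concatTop₀ D D'
    concatTop (suc i) = concatTop₊ D D' i
    concatBot zero = concatBot₀ D D'
    concatBot (suc i) = concatBot₊ D D' i

    match-top : ∀ i → match (D ∗ D') (inj₁ i) ≡ concatTop i
    match-top zero = refl
    match-top (suc i) = Vecₚ.lookup∘tabulate (concatTop₊ D D') i

    match-bot : ∀ i → match (D ∗ D') (inj₂ i) ≡ concatBot i
    match-bot zero = refl
    match-bot (suc i) = Vecₚ.lookup∘tabulate (concatBot₊ D D') i

    top-exit : ∀ i {j} → match D (inj₁ i) ≡ inj₁ j → concatTop i ≡ inj₁ j
    top-exit zero e rewrite e = refl
    top-exit (suc i) e rewrite e = refl

    top-pass : ∀ i {k} → match D (inj₁ i) ≡ inj₂ k → concatTop i ≡ walkDown D D' (2 ℕ.* suc n) k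
    top-pass zero e rewrite e = refl
    top-pass (suc i) e rewrite e = refl

    bot-exit : ∀ i {j} → match D' (inj₂ i) ≡ inj₂ j → concatBot i ≡ inj₂ j
    bot-exit zero e rewrite e = refl
    bot-exit (suc i) e rewrite e = refl

    bot-pass : ∀ i {k} → match D' (inj₂ i) ≡ inj₁ k → concatBot i ≡ walkUp D D' (2 ℕ.* suc n) k
    bot-pass zero e rewrite e = refl
    bot-pass (suc i) e rewrite e = refl

  match-∗ : ∀ {h} → Joins D D' h → ∀ p → match (D ∗ D') p ≡ h p
  match-∗ {h} J (inj₁ i) with h (inj₁ i) | J (inj₁ i)
  ... | _ | exitTop e = trans (match-top i) (top-exit i e)
  ... | _ | passDown e π = trans (match-top i) (trans (top-pass i e) (walkDown-path π (len-bound _ _ π refl)))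
  match-∗ {h} J (inj₂ i) with h (inj₂ i) | J (inj₂ i)
  ... | _ | exitBot e = trans (match-bot i) (bot-exit i e)
  ... | _ | passUp e π = trans (match-bot i) (trans (bot-pass i e) (walkUp-path π (len-bound _ _ π refl)))

-- Surgery on pairings

module _ {n : ℕ} where

  _≟ᴾ_ : DecidableEquality (Pt n)
  _≟ᴾ_ = Sumₚ.≡-dec Finₚ._≟_ Finₚ._≟_

  Pairing : (Pt n → Pt n) → Set
  Pairing f = ∀ x → (f x ≢ x) × (f (f x) ≡ x)

  -- The effect of left multiplication by a generator E_i at the top dots i, i + 1.
  record Surgery (s t : Pt n) (f g : Pt n → Pt n) : Set where
    field
      s≢t : s ≢ t
      at-s : g s ≡ t
      at-t : g t ≡ s
      to-s : ∀ {p} → p ≢ t → f p ≡ s → g p ≡ f t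
      to-t : ∀ {p} → p ≢ s → f p ≡ t → g p ≡ f s
      off : ∀ {p} → p ≢ s → p ≢ t → f p ≢ s → f p ≢ t → g p ≡ f p

  Surgery-swap : ∀ {s t f g} → Surgery s t f g → Surgery t s f g
  Surgery-swap S = record
    { s≢t = s≢t ∘ sym ; at-s = at-t ; at-t = at-s ; to-s = to-t ; to-t = to-s
    ; off = λ p≢t p≢s fp≢t fp≢s → off p≢s p≢t fp≢s fp≢t }
    where open Surgery S

  data Place (s t : Pt n) (f : Pt n → Pt n) (p : Pt n) : Set where
    dot-s : p ≡ s → Place s t f p
    dot-t : p ≡ t → Place s t f p
    mate-s : p ≢ s → p ≢ t → f p ≡ s → Place s t f p
    mate-t : p ≢ s → p ≢ t → f p ≡ t → Place s t f p
    apart : p ≢ s → p ≢ t → f p ≢ s → f p ≢ t → Place s t f p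

  place : ∀ s t f p → Place s t f p
  place s t f p with p ≟ᴾ s | p ≟ᴾ t | f p ≟ᴾ s | f p ≟ᴾ t
  ... | yes e | _ | _ | _ = dot-s e
  ... | no _ | yes e | _ | _ = dot-t e
  ... | no a | no b | yes e | _ = mate-s a b e
  ... | no a | no b | no _ | yes e = mate-t a b e
  ... | no a | no b | no c | no d = apart a b c d

  surgery : Pt n → Pt n → (Pt n → Pt n) → Pt n → Pt n
  surgery s t f p with place s t f p
  ... | dot-s _ = t
  ... | dot-t _ = s
  ... | mate-s _ _ _ = f t
  ... | mate-t _ _ _ = f s
  ... | apart _ _ _ _ = f p

  module _ {s t : Pt n} {f : Pt n → Pt n} (f-pairing : Pairing f) where

    private
      inv : ∀ {x y} → f x ≡ y → f y ≡ x
      inv {x} refl = proj₂ (f-pairing x)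

    surgery-Surgery : s ≢ t → Surgery s t f (surgery s t f)
    surgery-Surgery s≢t = record { s≢t = s≢t ; at-s = at-s′ ; at-t = at-t′ ; to-s = to-s′ ; to-t = to-t′ ; off = off′ }
      where
      at-s′ : surgery s t f s ≡ t
      at-s′ with place s t f s
      ... | dot-s _ = refl
      ... | dot-t e = e
      ... | mate-s c _ _ = ⊥-elim (c refl)
      ... | mate-t c _ _ = ⊥-elim (c refl)
      ... | apart c _ _ _ = ⊥-elim (c refl)

      at-t′ : surgery s t f t ≡ s
      at-t′ with place s t f t
      ... | dot-s e = e
      ... | dot-t _ = refl
      ... | mate-s _ c _ = ⊥-elim (c refl)
      ... | mate-t _ c _ = ⊥-elim (c refl)
      ... | apart _ c _ _ = ⊥-elim (c refl)

      to-s′ : ∀ {p} → p ≢ t → f p ≡ s → surgery s t f p ≡ f t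
      to-s′ {p} p≢t e with place s t f p
      ... | dot-s refl = ⊥-elim (proj₁ (f-pairing p) e)
      ... | dot-t c = ⊥-elim (p≢t c)
      ... | mate-s _ _ _ = refl
      ... | mate-t _ _ e′ = ⊥-elim (s≢t (trans (sym e) e′))
      ... | apart _ _ c _ = ⊥-elim (c e)

      to-t′ : ∀ {p} → p ≢ s → f p ≡ t → surgery s t f p ≡ f s
      to-t′ {p} p≢s e with place s t f p
      ... | dot-s c = ⊥-elim (p≢s c)
      ... | dot-t refl = ⊥-elim (proj₁ (f-pairing p) e)
      ... | mate-s _ _ e′ = ⊥-elim (s≢t (trans (sym e′) e))
      ... | mate-t _ _ _ = refl
      ... | apart _ _ _ c = ⊥-elim (c e)

      off′ : ∀ {p} → p ≢ s → p ≢ t → f p ≢ s → f p ≢ t → surgery s t f p ≡ f p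
      off′ {p} a b c d with place s t f p
      ... | dot-s e = ⊥-elim (a e)
      ... | dot-t e = ⊥-elim (b e)
      ... | mate-s _ _ e = ⊥-elim (c e)
      ... | mate-t _ _ e = ⊥-elim (d e)
      ... | apart _ _ _ _ = refl

    module _ {g : Pt n → Pt n} (S : Surgery s t f g) where
      open Surgery S renaming (to-s to at-fs; to-t to at-ft; off to at-off)

      Surgery-pairing : Pairing g
      Surgery-pairing x with place s t f x
      ... | dot-s refl = (λ e → s≢t (trans (sym e) at-s)) , trans (cong g at-s) at-t
      ... | dot-t refl = (λ e → s≢t (trans (sym at-t) e)) , trans (cong g at-t) at-s
      ... | mate-s x≢s x≢t e =
            (λ gx≡x → s≢t (trans (sym e) (inv (trans (sym (at-fs x≢t e)) gx≡x)))) ,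
            trans (cong g (at-fs x≢t e)) (trans (at-ft (λ ft≡s → x≢t (trans (sym (inv e)) (inv ft≡s))) (proj₂ (f-pairing t))) (inv e))
      ... | mate-t x≢s x≢t e =
            (λ gx≡x → s≢t (trans (sym (inv (trans (sym (at-ft x≢s e)) gx≡x))) e)) ,
            trans (cong g (at-ft x≢s e)) (trans (at-fs (λ fs≡t → x≢s (trans (sym (inv e)) (inv fs≡t))) (proj₂ (f-pairing s))) (inv e))
      ... | apart x≢s x≢t c d =
            (λ gx≡x → proj₁ (f-pairing x) (trans (sym (at-off x≢s x≢t c d)) gx≡x)) ,
            trans (cong g (at-off x≢s x≢t c d))
              (trans (at-off c d (x≢s ∘ trans (sym (proj₂ (f-pairing x)))) (x≢t ∘ trans (sym (proj₂ (f-pairing x))))) (proj₂ (f-pairing x)))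

      Surgery-joined : f s ≡ t → ∀ p → g p ≡ f p
      Surgery-joined fs≡t p with place s t f p
      ... | dot-s refl = trans at-s (sym fs≡t)
      ... | dot-t refl = trans at-t (sym (inv fs≡t))
      ... | mate-s _ p≢t e = ⊥-elim (p≢t (trans (sym (inv e)) fs≡t))
      ... | mate-t p≢s _ e = ⊥-elim (p≢s (trans (sym (inv e)) (inv fs≡t)))
      ... | apart a b c d = at-off a b c d

    -- Equations between diagrams are proved through this: both sides are exhibited as results of
    -- the same surgery on the same pairing.
    Surgery-unique : ∀ {g h} → Surgery s t f g → Surgery s t f h → ∀ p → g p ≡ h p
    Surgery-unique S T p with place s t f p
    ... | dot-s refl = trans (Surgery.at-s S) (sym (Surgery.at-s T))
    ... | dot-t refl = trans (Surgery.at-t S) (sym (Surgery.at-t T))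
    ... | mate-s _ b e = trans (Surgery.to-s S b e) (sym (Surgery.to-s T b e))
    ... | mate-t a _ e = trans (Surgery.to-t S a e) (sym (Surgery.to-t T a e))
    ... | apart a b c d = trans (Surgery.off S a b c d) (sym (Surgery.off T a b c d))

  match-mkDiag : ∀ (f : Pt n → Pt n) p → match (mkDiag f) p ≡ f p
  match-mkDiag f (inj₁ k) = Vecₚ.lookup∘tabulate (f ∘ inj₁) k
  match-mkDiag f (inj₂ k) = Vecₚ.lookup∘tabulate (f ∘ inj₂) k

  mkDiag-match : (D : Diag n) → mkDiag (match D) ≡ D
  mkDiag-match (u , v) = cong₂ _,_ (Vecₚ.tabulate∘lookup u) (Vecₚ.tabulate∘lookup v)

  diag-ext : {D D' : Diag n} → (∀ p → match D p ≡ match D' p) → D ≡ D'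
  diag-ext {D} {D'} e = trans (sym (mkDiag-match D)) (trans
    (cong₂ _,_ (Vecₚ.tabulate-cong (e ∘ inj₁)) (Vecₚ.tabulate-cong (e ∘ inj₂))) (mkDiag-match D'))

  Surgery-cong : ∀ {s t f g g'} → (∀ p → g p ≡ g' p) → Surgery s t f g → Surgery s t f g'
  Surgery-cong e S = record
    { s≢t = s≢t ; at-s = trans (sym (e _)) at-s ; at-t = trans (sym (e _)) at-t
    ; to-s = λ a b → trans (sym (e _)) (to-s a b) ; to-t = λ a b → trans (sym (e _)) (to-t a b)
    ; off = λ a b c d → trans (sym (e _)) (off a b c d) }
    where open Surgery S

  -- Generators as surgeries on the top row

  cup cup⁺ : Fin n → Pt n
  cup i = inj₁ (inject₁ i)
  cup⁺ i = inj₁ (suc i)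

  cup≢cup⁺ : ∀ i → cup i ≢ cup⁺ i
  cup≢cup⁺ i e = 1+n≢n (sym (trans (sym (toℕ-inject₁ i)) (cong toℕ (inj₁-injective e))))

  act : Fin n → Diag n → Diag n
  act i D = mkDiag (surgery (cup i) (cup⁺ i) (match D))

  act-Surgery : ∀ i {D} → Pairing (match D) → Surgery (cup i) (cup⁺ i) (match D) (match (act i D))
  act-Surgery i D-pairing = Surgery-cong (sym ∘ match-mkDiag _) (surgery-Surgery D-pairing (cup≢cup⁺ i))

  act-unique : ∀ i {D D'} → Pairing (match D) → Surgery (cup i) (cup⁺ i) (match D) (match D') → D' ≡ act i D
  act-unique i p S = diag-ext (Surgery-unique p S (act-Surgery i p))

  act-pairing : ∀ i {D} → Pairing (match D) → Pairing (match (act i D))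
  act-pairing i p = Surgery-pairing p (act-Surgery i p)

  act-joined : ∀ i {D} → Pairing (match D) → match D (cup i) ≡ cup⁺ i → act i D ≡ D
  act-joined i p e = diag-ext (Surgery-joined p (act-Surgery i p) e)

  module _ {f f₁ g : Pt n → Pt n} {a b : Fin (suc n)} (S : Surgery (inj₁ a) (inj₁ b) f f₁) where
    private
      s t : Pt n
      s = inj₁ a
      t = inj₁ b

    -- The surgery changes only the arcs at `s` and `t`. These are outer dots, so a path can use
    -- such an arc only at its start or at its end.
    Path-off : ∀ {c u q} → Path f g c u q → q ≢ s → q ≢ t → (c ≡ false → u ≢ s × u ≢ t) → Path f₁ g c u q
    Path-off (exitTop e) q≢s q≢t h with h refl
    ... | u≢s , u≢t = exitTop (trans (Surgery.off S u≢s u≢t (q≢s ∘ trans (sym e)) (q≢t ∘ trans (sym e))) e)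
    Path-off (passDown e π) q≢s q≢t h with h refl
    ... | u≢s , u≢t = passDown (trans (Surgery.off S u≢s u≢t (λ c → inj₁≢inj₂ f g c e) (λ c → inj₁≢inj₂ f g c e)) e)
                        (Path-off π q≢s q≢t (λ ()))
    Path-off (exitBot e) _ _ _ = exitBot e
    Path-off (passUp e π) q≢s q≢t _ = passUp e (Path-off π q≢s q≢t (λ _ → (λ ()) , (λ ())))

    -- The last arc of the path to `s` is redirected by the surgery to the former partner of `t`,
    -- from where the strand of `t` is followed to its end.
    Path-detour : ∀ {c u r} → Path f g c u s → (c ≡ false → u ≢ s × u ≢ t) →
      Path f g false t r → r ≢ s → r ≢ t → Path f₁ g c u r
    Path-detour (exitTop e) h (exitTop e') _ _ = exitTop (trans (Surgery.to-s S (proj₂ (h refl)) e) e')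
    Path-detour (exitTop e) h (passDown e' ρ) r≢s r≢t =
      passDown (trans (Surgery.to-s S (proj₂ (h refl)) e) e') (Path-off ρ r≢s r≢t (λ ()))
    Path-detour (passDown e π) h ρ r≢s r≢t with h refl
    ... | u≢s , u≢t = passDown (trans (Surgery.off S u≢s u≢t (λ c → inj₁≢inj₂ f g c e) (λ c → inj₁≢inj₂ f g c e)) e)
                        (Path-detour π (λ ()) ρ r≢s r≢t)
    Path-detour (passUp e π) h ρ r≢s r≢t = passUp e (Path-detour π (λ _ → (λ ()) , (λ ())) ρ r≢s r≢t)

  -- The strand version of `(E_i D) D' = E_i (D D')`: strands away from the two dots survive by
  -- `Path-off`, and the two strands that ended there are spliced by `Path-detour`.
  Joins-Surgery : ∀ {D D₁ D' h h₁ a b} → Pairing h →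
    Surgery (inj₁ a) (inj₁ b) (match D) (match D₁) → Surgery (inj₁ a) (inj₁ b) h h₁ →
    Joins D D' h → Joins D₁ D' h₁
  Joins-Surgery {D} {D₁} {D'} {h} {h₁} {a} {b} h-pairing S T J p = go
    where
    s t : Pt n
    s = inj₁ a
    t = inj₁ b
    inv : ∀ {x y} → h x ≡ y → h y ≡ x
    inv {x} refl = proj₂ (h-pairing x)
    to : ∀ {c u q q'} → q ≡ q' → Path (match D₁) (match D') c u q' → Path (match D₁) (match D') c u q
    to refl π = π
    from : ∀ {c u q q'} → q ≡ q' → Path (match D) (match D') c u q → Path (match D) (match D') c u q'
    from refl π = π
    go : Path (match D₁) (match D') (isBottom p) p (h₁ p)
    go with place s t h p
    ... | dot-s refl = to (Surgery.at-s T) (exitTop (Surgery.at-s S))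
    ... | dot-t refl = to (Surgery.at-t T) (exitTop (Surgery.at-t S))
    ... | mate-s p≢s p≢t e = to (Surgery.to-s T p≢t e)
            (Path-detour S (from e (J p)) (λ _ → p≢s , p≢t) (J t)
              (λ ht≡s → p≢t (trans (sym (inv e)) (inv ht≡s))) (proj₁ (h-pairing t)))
    ... | mate-t p≢s p≢t e = to (Surgery.to-t T p≢s e)
            (Path-detour (Surgery-swap S) (from e (J p)) (λ _ → p≢t , p≢s) (J s)
              (λ hs≡t → p≢s (trans (sym (inv e)) (inv hs≡t))) (proj₁ (h-pairing s)))
    ... | apart p≢s p≢t c d = to (Surgery.off T p≢s p≢t c d) (Path-off S (J p) c d (λ _ → p≢s , p≢t))

  flip : Pt n → Pt n
  flip (inj₁ k) = inj₂ k
  flip (inj₂ k) = inj₁ k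

  match-id : ∀ p → match idDiag p ≡ flip p
  match-id (inj₁ k) = Vecₚ.lookup∘tabulate inj₂ k
  match-id (inj₂ k) = Vecₚ.lookup∘tabulate inj₁ k

  flip-pairing : Pairing flip
  flip-pairing (inj₁ k) = (λ ()) , refl
  flip-pairing (inj₂ k) = (λ ()) , refl

  Pairing-cong : ∀ {f g} → (∀ p → f p ≡ g p) → Pairing g → Pairing f
  Pairing-cong {f} {g} e p x = proj₁ (p x) ∘ trans (sym (e x)) , trans (e (f x)) (trans (cong g (e x)) (proj₂ (p x)))

  id-pairing : Pairing (match idDiag)
  id-pairing = Pairing-cong match-id flip-pairing

  Joins-id : ∀ D' → Joins idDiag D' (match D')
  Joins-id D' (inj₁ k) = passDown (match-id (inj₁ k)) rest
    where
    rest : Path (match idDiag) (match D') true (inj₁ k) (match D' (inj₁ k))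
    rest with match D' (inj₁ k) in e
    ... | inj₁ l = passUp e (exitTop (match-id (inj₂ l)))
    ... | inj₂ l = exitBot e
  Joins-id D' (inj₂ k) with match D' (inj₂ k) in e
  ... | inj₁ l = passUp e (exitTop (match-id (inj₂ l)))
  ... | inj₂ l = exitBot e

  acts : List (Fin n) → Diag n → Diag n
  acts u D = foldr act D u

  acts-pairing : ∀ u {D} → Pairing (match D) → Pairing (match (acts u D))
  acts-pairing [] p = p
  acts-pairing (i ∷ u) p = act-pairing i (acts-pairing u p)

  acts-Joins : ∀ u D' → Pairing (match D') → Joins (acts u idDiag) D' (match (acts u D'))
  acts-Joins [] D' _ = Joins-id D'
  acts-Joins (i ∷ u) D' p = Joins-Surgery (acts-pairing u p) (act-Surgery i (acts-pairing u id-pairing))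
    (act-Surgery i (acts-pairing u p)) (acts-Joins u D' p)

  acts-∗ : ∀ u D' → Pairing (match D') → acts u idDiag ∗ D' ≡ acts u D'
  acts-∗ u D' p = diag-ext (match-∗ (acts u idDiag) D' (acts-Joins u D' p))

  clampFin-toℕ : (k : Fin (suc n)) → clampFin (toℕ k) ≡ k
  clampFin-toℕ k with toℕ k ℕ.<? suc n
  ... | yes p = Finₚ.fromℕ<-toℕ k p
  ... | no ¬p = ⊥-elim (¬p (Finₚ.toℕ<n k))

  mutual
    -- As for `_∗_`, the private case distinction behind `E` is recovered by unification.
    eTop₀ eBot₀ : ℕ → Pt n
    eTop₀ = _
    eBot₀ = _

    eTop₊ eBot₊ : ℕ → Fin n → Pt n
    eTop₊ = _
    eBot₊ = _

    E-unfold : ∀ i → E i ≡ (eTop₀ i Vec.∷ tabulate (eTop₊ i) , eBot₀ i Vec.∷ tabulate (eBot₊ i))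
    E-unfold i = refl

  private
    eTop eBot : ℕ → Fin (suc n) → Pt n
    eTop j zero = eTop₀ j
    eTop j (suc k) = eTop₊ j k
    eBot j zero = eBot₀ j
    eBot j (suc k) = eBot₊ j k

    match-E-top : ∀ j k → match (E j) (inj₁ k) ≡ eTop j k
    match-E-top j zero = refl
    match-E-top j (suc k) = Vecₚ.lookup∘tabulate (eTop₊ j) k

    match-E-bot : ∀ j k → match (E j) (inj₂ k) ≡ eBot j k
    match-E-bot j zero = refl
    match-E-bot j (suc k) = Vecₚ.lookup∘tabulate (eBot₊ j) k

    eTop-left : ∀ j k → toℕ k ≡ j ∸ 1 → eTop j k ≡ inj₁ (clampFin j)
    eTop-left j zero e with 0 ℕ.≟ (j ∸ 1)
    ... | yes _ = refl
    ... | no c = ⊥-elim (c e)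
    eTop-left j (suc k) e with suc (toℕ k) ℕ.≟ (j ∸ 1)
    ... | yes _ = refl
    ... | no c = ⊥-elim (c e)

    eTop-right : ∀ j k → toℕ k ≢ j ∸ 1 → toℕ k ≡ j → eTop j k ≡ inj₁ (clampFin (j ∸ 1))
    eTop-right j zero c e with 0 ℕ.≟ (j ∸ 1) | 0 ℕ.≟ j
    ... | yes d | _ = ⊥-elim (c d)
    ... | no _ | yes _ = refl
    ... | no _ | no d = ⊥-elim (d e)
    eTop-right j (suc k) c e with suc (toℕ k) ℕ.≟ (j ∸ 1) | suc (toℕ k) ℕ.≟ j
    ... | yes d | _ = ⊥-elim (c d)
    ... | no _ | yes _ = refl
    ... | no _ | no d = ⊥-elim (d e)

    eTop-off : ∀ j k → toℕ k ≢ j ∸ 1 → toℕ k ≢ j → eTop j k ≡ inj₂ k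
    eTop-off j zero c e with 0 ℕ.≟ (j ∸ 1) | 0 ℕ.≟ j
    ... | yes d | _ = ⊥-elim (c d)
    ... | no _ | yes d = ⊥-elim (e d)
    ... | no _ | no _ = refl
    eTop-off j (suc k) c e with suc (toℕ k) ℕ.≟ (j ∸ 1) | suc (toℕ k) ℕ.≟ j
    ... | yes d | _ = ⊥-elim (c d)
    ... | no _ | yes d = ⊥-elim (e d)
    ... | no _ | no _ = refl

    eBot-flip : ∀ j k → eBot j k ≡ flip (eTop j k)
    eBot-flip j zero with 0 ℕ.≟ (j ∸ 1) | 0 ℕ.≟ j
    ... | yes _ | _ = refl
    ... | no _ | yes _ = refl
    ... | no _ | no _ = refl
    eBot-flip j (suc k) with suc (toℕ k) ℕ.≟ (j ∸ 1) | suc (toℕ k) ℕ.≟ j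
    ... | yes _ | _ = refl
    ... | no _ | yes _ = refl
    ... | no _ | no _ = refl

    -- The diagram is its own mirror image in the horizontal axis, so the bottom row follows from
    -- the top row.
    match-E-flip : ∀ j k → match (E j) (inj₂ k) ≡ flip (match (E j) (inj₁ k))
    match-E-flip j k = trans (match-E-bot j k) (trans (eBot-flip j k) (cong flip (sym (match-E-top j k))))

    clampFin-inject₁ : (i : Fin n) → clampFin (toℕ i) ≡ inject₁ i
    clampFin-inject₁ i = trans (cong clampFin (sym (toℕ-inject₁ i))) (clampFin-toℕ (inject₁ i))

  E-act : ∀ i → E (suc (toℕ i)) ≡ act i idDiag
  E-act i = act-unique i id-pairing (record
    { s≢t = cup≢cup⁺ i ; at-s = at-left ; at-t = at-right ; to-s = to-s′ ; to-t = to-t′ ; off = off′ })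
    where
    j : ℕ
    j = suc (toℕ i)
    l : toℕ (inject₁ i) ≡ toℕ i
    l = toℕ-inject₁ i
    at-left : match (E j) (cup i) ≡ cup⁺ i
    at-left = trans (match-E-top j (inject₁ i)) (trans (eTop-left j (inject₁ i) l) (cong inj₁ (clampFin-toℕ (suc i))))
    at-right : match (E j) (cup⁺ i) ≡ cup i
    at-right = trans (match-E-top j (suc i)) (trans (eTop-right j (suc i) 1+n≢n refl) (cong inj₁ (clampFin-inject₁ i)))
    at-off : ∀ k → k ≢ inject₁ i → k ≢ suc i → match (E j) (inj₁ k) ≡ inj₂ k
    at-off k a b = trans (match-E-top j k)
      (eTop-off j k (λ e → a (toℕ-injective (trans e (sym l)))) (b ∘ toℕ-injective))
    unflip : ∀ {p q} → match idDiag p ≡ q → p ≡ flip q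
    unflip {p} e = trans (sym (proj₂ (flip-pairing p))) (cong flip (trans (sym (match-id p)) e))
    to-s′ : ∀ {p} → p ≢ cup⁺ i → match idDiag p ≡ cup i → match (E j) p ≡ match idDiag (cup⁺ i)
    to-s′ {p} _ e with unflip {p} e
    ... | refl = trans (match-E-flip j (inject₁ i)) (trans (cong flip at-left) (sym (match-id (cup⁺ i))))
    to-t′ : ∀ {p} → p ≢ cup i → match idDiag p ≡ cup⁺ i → match (E j) p ≡ match idDiag (cup i)
    to-t′ {p} _ e with unflip {p} e
    ... | refl = trans (match-E-flip j (suc i)) (trans (cong flip at-right) (sym (match-id (cup i))))
    off′ : ∀ {p} → p ≢ cup i → p ≢ cup⁺ i → match idDiag p ≢ cup i → match idDiag p ≢ cup⁺ i → match (E j) p ≡ match idDiag p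
    off′ {inj₁ k} a b _ _ = trans (at-off k (a ∘ cong inj₁) (b ∘ cong inj₁)) (sym (match-id (inj₁ k)))
    off′ {inj₂ k} _ _ c d = trans (match-E-flip j k) (trans
      (cong flip (at-off k (c ∘ trans (match-id (inj₂ k)) ∘ cong inj₁) (d ∘ trans (match-id (inj₂ k)) ∘ cong inj₁)))
      (sym (match-id (inj₂ k))))

-- Counting closed circles

module _ {n : ℕ} (f g : Pt n → Pt n) where

  -- The middle row of a concatenation: its dots are the bottom dots of f and
  -- the top dots of g.
  data Conn (k : Fin (suc n)) : Fin (suc n) → Set where
    stay : Conn k k
    below : ∀ {x y} → Conn k x → g (inj₁ x) ≡ inj₁ y → Conn k y
    above : ∀ {x y} → Conn k x → f (inj₂ x) ≡ inj₂ y → Conn k y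

  Inner : Fin (suc n) → Set
  Inner x = (∃ λ y → g (inj₁ x) ≡ inj₁ y) × (∃ λ y → f (inj₂ x) ≡ inj₂ y)

  -- A component of the middle row is a closed circle when every dot of it has an arc on both sides.
  -- Each circle is counted at its least dot.
  LoopMin : Fin (suc n) → Set
  LoopMin k = ∀ {x} → Conn k x → Inner x × toℕ k ≤ toℕ x

  Conn-trans : ∀ {x y z} → Conn x y → Conn y z → Conn x z
  Conn-trans c stay = c
  Conn-trans c (below d e) = below (Conn-trans c d) e
  Conn-trans c (above d e) = above (Conn-trans c d) e

  vertices : ∀ {b u q} → Path f g b u q → List (Fin (suc n))
  vertices {u = u} (exitTop _) = column u ∷ []
  vertices {u = u} (passDown _ π) = column u ∷ vertices π
  vertices {u = u} (exitBot _) = column u ∷ []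
  vertices {u = u} (passUp _ π) = column u ∷ vertices π

  vertices-head : ∀ {b u q} (π : Path f g b u q) → column u ∈ vertices π
  vertices-head (exitTop _) = here refl
  vertices-head (passDown _ _) = here refl
  vertices-head (exitBot _) = here refl
  vertices-head (passUp _ _) = here refl

  vertices-Conn-down : ∀ {x q} (π : Path f g true (inj₁ x) q) → ∀ {v} → v ∈ vertices π → Conn x v
  vertices-Conn-up : ∀ {x q} (π : Path f g false (inj₂ x) q) → ∀ {v} → v ∈ vertices π → Conn x v
  vertices-Conn-down (exitBot _) (here refl) = stay
  vertices-Conn-down (passUp _ _) (here refl) = stay
  vertices-Conn-down (passUp e π) (there v∈) = Conn-trans (below stay e) (vertices-Conn-up π v∈)
  vertices-Conn-up (exitTop _) (here refl) = stay
  vertices-Conn-up (passDown _ _) (here refl) = stay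
  vertices-Conn-up (passDown e π) (there v∈) = Conn-trans (above stay e) (vertices-Conn-down π v∈)

  module _ (f-pairing : Pairing f) (g-pairing : Pairing g) where

    private
      f-inv : ∀ {x y} → f x ≡ y → f y ≡ x
      f-inv {x} refl = proj₂ (f-pairing x)
      g-inv : ∀ {x y} → g x ≡ y → g y ≡ x
      g-inv {x} refl = proj₂ (g-pairing x)

    Conn-sym : ∀ {x y} → Conn x y → Conn y x
    Conn-sym stay = stay
    Conn-sym (below c e) = Conn-trans (below stay (g-inv e)) (Conn-sym c)
    Conn-sym (above c e) = Conn-trans (above stay (f-inv e)) (Conn-sym c)

    Below Above : List (Fin (suc n)) → Fin (suc n) → Set
    Below l v = ∃ λ w → g (inj₁ v) ≡ inj₁ w × w ∈ l
    Above l v = ∃ λ w → f (inj₂ v) ≡ inj₂ w × w ∈ l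

    private
      later : ∀ {a b} {A : Set a} {P : A → Set b} {x : A} {l : List A} → (∃ λ w → P w × w ∈ l) → ∃ λ w → P w × w ∈ (x ∷ l)
      later (w , p , w∈) = w , p , there w∈

    -- For a strand that goes down into the middle row and leaves at the top, its middle dots are
    -- paired below among themselves, and above too except at its two ends. Joining the ends will
    -- therefore close a circle.
    strand-down : ∀ {x j} (π : Path f g true (inj₁ x) (inj₁ j)) → ∀ {v} → v ∈ vertices π →
      Below (vertices π) v × (v ≡ x ⊎ f (inj₂ v) ≡ inj₁ j ⊎ Above (vertices π) v)
    strand-up : ∀ {x j} (π : Path f g false (inj₂ x) (inj₁ j)) → ∀ {v} → v ∈ vertices π →
      (v ≡ x ⊎ Below (vertices π) v) × (f (inj₂ v) ≡ inj₁ j ⊎ Above (vertices π) v)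
    strand-down (passUp e π) (here refl) = (_ , e , there (vertices-head π)) , inj₁ refl
    strand-down (passUp e π) (there v∈) with strand-up π v∈
    ... | inj₁ refl , inj₁ a = (_ , g-inv e , here refl) , inj₂ (inj₁ a)
    ... | inj₁ refl , inj₂ a = (_ , g-inv e , here refl) , inj₂ (inj₂ (later a))
    ... | inj₂ b , inj₁ a = later b , inj₂ (inj₁ a)
    ... | inj₂ b , inj₂ a = later b , inj₂ (inj₂ (later a))
    strand-up (exitTop e) (here refl) = inj₁ refl , inj₁ e
    strand-up (passDown e π) (here refl) = inj₁ refl , inj₂ (_ , e , there (vertices-head π))
    strand-up (passDown e π) (there v∈) with strand-down π v∈
    ... | b , inj₁ refl = inj₂ (later b) , inj₂ (_ , f-inv e , here refl)
    ... | b , inj₂ (inj₁ a) = inj₂ (later b) , inj₁ a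
    ... | b , inj₂ (inj₂ a) = inj₂ (later b) , inj₂ (later a)

    strand-end-down : ∀ {x j} (π : Path f g true (inj₁ x) (inj₁ j)) → ∃ λ v → f (inj₂ v) ≡ inj₁ j × v ∈ vertices π
    strand-end-up : ∀ {x j} (π : Path f g false (inj₂ x) (inj₁ j)) → ∃ λ v → f (inj₂ v) ≡ inj₁ j × v ∈ vertices π
    strand-end-down (passUp e π) = later (strand-end-up π)
    strand-end-up (exitTop e) = _ , e , here refl
    strand-end-up (passDown e π) = later (strand-end-down π)

    -- The tracing of circles in Defs takes two steps at a time.
    next : Fin (suc n) → Fin (suc n)
    next x with g (inj₁ x)
    ... | inj₂ _ = x
    ... | inj₁ y with f (inj₂ y)
    ...   | inj₁ _ = x
    ...   | inj₂ z = z

    next-step : ∀ {x y z} → g (inj₁ x) ≡ inj₁ y → f (inj₂ y) ≡ inj₂ z → next x ≡ z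
    next-step e e' rewrite e | e' = refl

    module _ {k : Fin (suc n)} (loop : ∀ {x} → Conn k x → Inner x) where

      steps : ∀ {x} → Conn k x → ∃ λ y → ∃ λ z → g (inj₁ x) ≡ inj₁ y × f (inj₂ y) ≡ inj₂ z × Conn k z
      steps c with loop c
      ... | (y , e) , _ with loop (below c e)
      ...   | _ , (z , e') = y , z , e , e' , above (below c e) e'

      Conn-next : ∀ {x} → Conn k x → Conn k (next x)
      Conn-next c with steps c
      ... | _ , _ , e , e' , c' = subst (Conn k) (sym (next-step e e')) c'

      -- Both halves of a double step are involutions and can be undone.
      next-injective : ∀ {x x'} → Conn k x → Conn k x' → next x ≡ next x' → x ≡ x'
      next-injective c c' eq with steps c | steps c'
      ... | y , z , e , h , _ | y' , z' , e' , h' , _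
        with trans (sym (next-step e h)) (trans eq (next-step e' h'))
      ...   | refl with inj₂-injective (trans (sym (f-inv h)) (f-inv h'))
      ...     | refl = inj₁-injective (trans (sym (g-inv e)) (g-inv e'))

      orbit : ℕ → Fin (suc n)
      orbit zero = k
      orbit (suc i) = next (orbit i)

      Conn-orbit : ∀ i → Conn k (orbit i)
      Conn-orbit zero = stay
      Conn-orbit (suc i) = Conn-next (Conn-orbit i)

      orbit-return : ∀ i d → orbit i ≡ orbit (i + d) → k ≡ orbit d
      orbit-return zero d e = e
      orbit-return (suc i) d e = orbit-return i d (next-injective (Conn-orbit i) (Conn-orbit (i + d)) e)

      -- Among the first `suc (suc n)` points of the orbit two coincide, and injectivity of `next`
      -- moves the repetition back to `k`. The bound `suc n` is the fuel with which circles are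
      -- traced.
      period : ∃ λ d → orbit (suc d) ≡ k × suc d ≤ suc n
      period with Finₚ.pigeonhole (n<1+n (suc n)) (orbit ∘ toℕ)
      ... | i , j , i<j , e with ℕₚ.m≤n⇒∃[o]m+o≡n i<j
      ...   | d , i+d≡j = d ,
              sym (orbit-return (toℕ i) (suc d) (trans e (cong orbit (trans (sym i+d≡j) (sym (ℕₚ.+-suc (toℕ i) d)))))) ,
              ≤-trans (ℕₚ.m≤n+m (suc d) (toℕ i))
                (subst (_≤ suc n) (trans (sym i+d≡j) (sym (ℕₚ.+-suc (toℕ i) d))) (≤-pred (Finₚ.toℕ<n j)))

-- The tracing of circles in terms of connectivity

module _ {m : ℕ} (D D' : Diag (suc m)) (D-pairing : Pairing (match D)) (D'-pairing : Pairing (match D')) where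

  private
    V : Set
    V = Fin (suc (suc m))
    f g : Pt (suc m) → Pt (suc m)
    f = match D
    g = match D'
    f-inv : ∀ {x y} → f x ≡ y → f y ≡ x
    f-inv {x} refl = proj₂ (D-pairing x)
    g-inv : ∀ {x y} → g x ≡ y → g y ≡ x
    g-inv {x} refl = proj₂ (D'-pairing x)

    -- The successful runs of `trace` from `c` back to `k`, with the dots they list.
    data Loop (k : V) : V → List V → Set where
      last : ∀ {c d} → g (inj₁ c) ≡ inj₁ d → f (inj₂ d) ≡ inj₂ k → Loop k c (c ∷ d ∷ [])
      more : ∀ {c d e l} → g (inj₁ c) ≡ inj₁ d → f (inj₂ d) ≡ inj₂ e → Loop k e l → Loop k c (c ∷ d ∷ l)

    trace-Loop : ∀ fuel {k c l} → trace D D' k c fuel ≡ just l → Loop k c l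
    trace-Loop zero ()
    trace-Loop (suc fuel) {k} {c} t with match D' (inj₁ c) in p
    ... | inj₁ d with match D (inj₂ d) in q
    ...   | inj₂ e with e Finₚ.≟ k
    trace-Loop (suc fuel) refl | inj₁ d | inj₂ e | yes refl = last p q
    ...     | no _ with trace D D' k e fuel in r
    trace-Loop (suc fuel) refl | inj₁ d | inj₂ e | no _ | just l = more p q (trace-Loop fuel r)

    head∈ : ∀ {k c l} → Loop k c l → c ∈ l
    head∈ (last _ _) = here refl
    head∈ (more _ _ _) = here refl

    Loop-last : ∀ {k c l} → Loop k c l → ∃ λ z → f (inj₂ z) ≡ inj₂ k × z ∈ l
    Loop-last (last _ q) = _ , q , there (here refl)
    Loop-last (more _ _ L) with Loop-last L
    ... | z , e , z∈ = z , e , there (there z∈)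

    Loop-below : ∀ {k c l x} → Loop k c l → x ∈ l → ∃ λ y → g (inj₁ x) ≡ inj₁ y × y ∈ l
    Loop-below (last p _) (here refl) = _ , p , there (here refl)
    Loop-below (last p _) (there (here refl)) = _ , g-inv p , here refl
    Loop-below (more p _ _) (here refl) = _ , p , there (here refl)
    Loop-below (more p _ _) (there (here refl)) = _ , g-inv p , here refl
    Loop-below (more _ _ L) (there (there x∈)) with Loop-below L x∈
    ... | y , e , y∈ = y , e , there (there y∈)

    Loop-above : ∀ {k c l x} → Loop k c l → x ∈ l → x ≡ c ⊎ f (inj₂ x) ≡ inj₂ k ⊎ (∃ λ y → f (inj₂ x) ≡ inj₂ y × y ∈ l)
    Loop-above (last _ _) (here refl) = inj₁ refl
    Loop-above (last _ q) (there (here refl)) = inj₂ (inj₁ q)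
    Loop-above (more _ _ _) (here refl) = inj₁ refl
    Loop-above (more _ q L) (there (here refl)) = inj₂ (inj₂ (_ , q , there (there (head∈ L))))
    Loop-above (more _ q L) (there (there x∈)) with Loop-above L x∈
    ... | inj₁ refl = inj₂ (inj₂ (_ , f-inv q , there (here refl)))
    ... | inj₂ (inj₁ e) = inj₂ (inj₁ e)
    ... | inj₂ (inj₂ (y , e , y∈)) = inj₂ (inj₂ (y , e , there (there y∈)))

    -- When the run starts at `k` itself, its list is closed under neighbours above and below, hence
    -- contains the whole component of `k`.
    Loop-closed : ∀ {k l x} → Loop k k l → Conn f g k x → x ∈ l × Inner f g x
    Loop-closed-∈ : ∀ {k l x} → Loop k k l → Conn f g k x → x ∈ l
    Loop-neighbour : ∀ {k l x} → Loop k k l → x ∈ l → ∃ λ y → f (inj₂ x) ≡ inj₂ y × y ∈ l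
    Loop-neighbour L x∈ with Loop-above L x∈
    ... | inj₁ refl with Loop-last L
    ...   | z , e , z∈ = z , f-inv e , z∈
    Loop-neighbour L x∈ | inj₂ (inj₁ e) = _ , e , head∈ L
    Loop-neighbour L x∈ | inj₂ (inj₂ y) = y
    Loop-closed-∈ L stay = head∈ L
    Loop-closed-∈ L (below c e) with Loop-below L (Loop-closed-∈ L c)
    ... | y , e' , y∈ = subst (_∈ _) (inj₁-injective (trans (sym e') e)) y∈
    Loop-closed-∈ L (above c e) with Loop-neighbour L (Loop-closed-∈ L c)
    ... | y , e' , y∈ = subst (_∈ _) (inj₂-injective (trans (sym e') e)) y∈
    Loop-closed L c with Loop-closed-∈ L c
    ... | x∈ with Loop-below L x∈ | Loop-neighbour L x∈
    ...   | y , e , _ | z , e' , _ = x∈ , (y , e) , (z , e')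

    minTest-All : ∀ k l → minTest D D' k (just l) ≡ true → ∀ {x} → x ∈ l → toℕ k ≤ toℕ x
    minTest-All k (x ∷ l) t x∈ with toℕ k ℕ.≤ᵇ toℕ x in b
    minTest-All k (x ∷ l) t (here refl) | true = ℕₚ.≤ᵇ⇒≤ (toℕ k) (toℕ x) (subst T (sym b) tt)
    minTest-All k (x ∷ l) t (there x∈) | true = minTest-All k l t x∈

    All-minTest : ∀ k l → (∀ {x} → x ∈ l → toℕ k ≤ toℕ x) → minTest D D' k (just l) ≡ true
    All-minTest k [] _ = refl
    All-minTest k (x ∷ l) h with toℕ k ℕ.≤ᵇ toℕ x in b
    ... | true = All-minTest k l (h ∘ there)
    ... | false = ⊥-elim (subst T b (ℕₚ.≤⇒≤ᵇ (h (here refl))))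

    module _ {k : V} (loop : ∀ {x} → Conn f g k x → Inner f g x) where

      iterate : ℕ → V → V
      iterate zero x = x
      iterate (suc d) x = iterate d (next f g D-pairing D'-pairing x)

      iterate-orbit : ∀ d i → iterate d (orbit f g D-pairing D'-pairing loop i) ≡ orbit f g D-pairing D'-pairing loop (d + i)
      iterate-orbit zero i = refl
      iterate-orbit (suc d) i = trans (iterate-orbit d (suc i)) (cong (orbit f g D-pairing D'-pairing loop) (ℕₚ.+-suc d i))

      -- The given return to `k` may not be the first one; the trace stops at the first, and the
      -- later return only guarantees that the fuel lasts.
      trace-returns : ∀ fuel d {c} → d < fuel → Conn f g k c → iterate (suc d) c ≡ k →
        ∃ λ l → trace D D' k c fuel ≡ just l × (∀ {x} → x ∈ l → Conn f g k x)
      trace-returns (suc fuel) d {c} (s≤s d≤) C ret with steps f g D-pairing D'-pairing loop C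
      ... | y , z , e , e' , C' with next-step f g D-pairing D'-pairing e e'
      ...   | nxt rewrite e | e' with z Finₚ.≟ k
      ...     | yes refl = _ , refl , λ { (here refl) → C ; (there (here refl)) → below C e }
      trace-returns (suc fuel) zero {c} (s≤s d≤) C ret | y , z , e , e' , C' | nxt | no z≢k = ⊥-elim (z≢k (trans (sym nxt) ret))
      trace-returns (suc fuel) (suc d) {c} (s≤s d≤) C ret | y , z , e , e' , C' | nxt | no z≢k
        with trace-returns fuel d d≤ C' (subst (λ v → iterate (suc d) v ≡ k) nxt ret)
      ...       | l , t , h rewrite t = _ , refl , λ { (here refl) → C ; (there (here refl)) → below C e ; (there (there x∈)) → h x∈ }

  -- With its converse below, this replaces the tracing algorithm by connectivity in all that
  -- follows.
  circleMinAt⇒LoopMin : ∀ k → circleMinAt D D' k ≡ true → LoopMin f g k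
  circleMinAt⇒LoopMin k t C with trace D D' k k (suc (suc m)) in r | trans (sym (circleMinAt-trace D D' k)) t
  ... | just l | t' with Loop-closed (trace-Loop (suc (suc m)) r) C
  ...   | x∈ , inner = inner , minTest-All k l t' x∈

  LoopMin⇒circleMinAt : ∀ k → LoopMin f g k → circleMinAt D D' k ≡ true
  LoopMin⇒circleMinAt k L with period f g D-pairing D'-pairing (proj₁ ∘ L)
  ... | d , ret , d≤ with trace-returns (proj₁ ∘ L) (suc (suc m)) d d≤ stay
                            (trans (iterate-orbit (proj₁ ∘ L) (suc d) 0) (trans (cong (orbit f g D-pairing D'-pairing (proj₁ ∘ L)) (ℕₚ.+-identityʳ (suc d))) ret))
  ...   | l , t , h = trans (circleMinAt-trace D D' k) (trans (cong (minTest D D' k) t) (All-minTest k l (proj₂ ∘ L ∘ h)))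

minimal : ∀ {n} (x : Fin n) l → x ∈ l → ∃ λ k → k ∈ l × (∀ {y} → y ∈ l → toℕ k ≤ toℕ y)
minimal {n} _ (x ∷ l) _ = go x l
  where
  go : ∀ (x : Fin n) l → ∃ λ k → k ∈ (x ∷ l) × (∀ {y} → y ∈ (x ∷ l) → toℕ k ≤ toℕ y)
  go x [] = x , here refl , λ { (here refl) → ≤-refl }
  go x (x' ∷ l) with go x' l
  ... | k , k∈ , k≤ with ℕₚ.≤-total (toℕ x) (toℕ k)
  ...   | inj₁ x≤k = x , here refl , λ { (here refl) → ≤-refl ; (there y∈) → ≤-trans x≤k (k≤ y∈) }
  ...   | inj₂ k≤x = k , there k∈ , λ { (here refl) → k≤x ; (there y∈) → k≤ y∈ }

sum-tabulate-cong : ∀ {N} {h h' : Fin N → ℕ} → (∀ k → h k ≡ h' k) → sum (List.tabulate h) ≡ sum (List.tabulate h')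
sum-tabulate-cong e = cong sum (Listₚ.tabulate-cong e)

sum-tabulate-suc : ∀ {N} {h h' : Fin N → ℕ} k₀ → h' k₀ ≡ suc (h k₀) → (∀ k → k ≢ k₀ → h' k ≡ h k) →
  sum (List.tabulate h') ≡ suc (sum (List.tabulate h))
sum-tabulate-suc zero e₀ e = cong₂ _+_ e₀ (sum-tabulate-cong (λ k → e (suc k) λ ()))
sum-tabulate-suc {h = h} (suc k₀) e₀ e = trans
  (cong₂ _+_ (e zero (λ ())) (sum-tabulate-suc k₀ e₀ (λ k k≢ → e (suc k) (k≢ ∘ Finₚ.suc-injective)))) (ℕₚ.+-suc (h zero) _)

indicator : Bool → ℕ
indicator b = if b then 1 else 0

circles-sum : ∀ {n} (D D' : Diag n) → circles D D' ≡ sum (List.tabulate (indicator ∘ circleMinAt D D'))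
circles-sum D D' = trans (circles-unfold D D') (cong sum (Listₚ.map-tabulate id (indicator ∘ circleMinAt D D')))

bool-ext : ∀ {a b : Bool} → (a ≡ true → b ≡ true) → (b ≡ true → a ≡ true) → a ≡ b
bool-ext {true} {b} f _ = sym (f refl)
bool-ext {false} {true} _ g = g refl
bool-ext {false} {false} _ _ = refl

-- The number of circles under a surgery

module _ {m : ℕ} {D D₁ D' : Diag (suc m)} {h : Pt (suc m) → Pt (suc m)} {a b : Fin (suc (suc m))}
         (D-pairing : Pairing (match D)) (D₁-pairing : Pairing (match D₁)) (D'-pairing : Pairing (match D'))
         (h-pairing : Pairing h) (J : Joins D D' h)
         (S : Surgery (inj₁ a) (inj₁ b) (match D) (match D₁)) where

  private
    V : Set
    V = Fin (suc (suc m))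
    s t : Pt (suc m)
    s = inj₁ a
    t = inj₁ b
    f f₁ g : Pt (suc m) → Pt (suc m)
    f = match D
    f₁ = match D₁
    g = match D'
    open Surgery S
    f-inv : ∀ {x y} → f x ≡ y → f y ≡ x
    f-inv {x} refl = proj₂ (D-pairing x)
    h-inv : ∀ {x y} → h x ≡ y → h y ≡ x
    h-inv {x} refl = proj₂ (h-pairing x)
    clash : ∀ {p : Pt (suc m)} {j k} → p ≡ inj₁ j → p ≡ inj₂ k → ⊥
    clash = inj₁≢inj₂ f f

    keep : ∀ {x y} → f (inj₂ x) ≡ inj₂ y → f₁ (inj₂ x) ≡ inj₂ y
    keep {x} e = trans (off {inj₂ x} (λ ()) (λ ()) (λ c → clash c e) (λ c → clash c e)) e

    -- Between dots of the middle row the surgery can create only one arc, the one joining the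
    -- former partners of `s` and `t`.
    added : ∀ {x y} → f₁ (inj₂ x) ≡ inj₂ y → f (inj₂ x) ≡ inj₂ y ⊎ f (inj₂ x) ≡ s ⊎ f (inj₂ x) ≡ t
    added {x} e with place s t f (inj₂ x)
    ... | mate-s _ _ c = inj₂ (inj₁ c)
    ... | mate-t _ _ c = inj₂ (inj₂ c)
    ... | apart p q c d = inj₁ (trans (sym (off p q c d)) e)

    Conn-keep : ∀ {k x} → Conn f g k x → Conn f₁ g k x
    Conn-keep stay = stay
    Conn-keep (below c e) = below (Conn-keep c) e
    Conn-keep (above c e) = above (Conn-keep c) (keep e)

    -- The partners of `s` and `t` have no arc of `f` within the middle row, so they lie on no
    -- circle of `D ∗ D'`, and the new arc cannot be reached from one.
    LoopMin-keep : ∀ {k} → LoopMin f g k → LoopMin f₁ g k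
    LoopMin-keep {k} L C with L (back C)
      where
      back : ∀ {x} → Conn f₁ g k x → Conn f g k x
      back stay = stay
      back (below c e) = below (back c) e
      back (above c e) with added e
      ... | inj₁ e' = above (back c) e'
      ... | inj₂ (inj₁ e') = ⊥-elim (clash e' (proj₂ (proj₂ (proj₁ (L (back c))))))
      ... | inj₂ (inj₂ e') = ⊥-elim (clash e' (proj₂ (proj₂ (proj₁ (L (back c))))))
    ... | (p , (y , e)) , le = (p , (y , keep e)) , le

    -- A strand of D ∗ D' through a circle of D₁ ∗ D' can leave the middle row
    -- only by an arrow that the surgery removes.
    end-down : ∀ {k x q} → LoopMin f₁ g k → Conn f₁ g k x → Path f g true (inj₁ x) q → q ≡ s ⊎ q ≡ t
    end-up : ∀ {k x q} → LoopMin f₁ g k → Conn f₁ g k x → Path f g false (inj₂ x) q → q ≡ s ⊎ q ≡ t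
    end-down L C (exitBot e) = ⊥-elim (clash (proj₂ (proj₁ (proj₁ (L C)))) e)
    end-down L C (passUp e π) = end-up L (below C e) π
    end-up {x = x} L C (exitTop {j = j} e) with inj₁ j ≟ᴾ s | inj₁ j ≟ᴾ t
    ... | yes c | _ = inj₁ c
    ... | no _ | yes d = inj₂ d
    ... | no c | no d = ⊥-elim (clash (trans (off {inj₂ x} (λ ()) (λ ()) (c ∘ trans (sym e)) (d ∘ trans (sym e))) e) (proj₂ (proj₂ (proj₁ (L C)))))
    end-up L C (passDown e π) = end-down L (above C (keep e)) π

    end-of : ∀ {k p x} → LoopMin f₁ g k → Conn f₁ g k x → isBottom p ≡ false → f p ≡ inj₂ x → h p ≡ s ⊎ h p ≡ t
    end-of {p = inj₁ i} L C _ e with h (inj₁ i) | J (inj₁ i)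
    ... | _ | exitTop e' = ⊥-elim (clash e' e)
    ... | _ | passDown e' π with inj₂-injective (trans (sym e') e)
    ...   | refl = end-down L C π

    LoopMin-back : ∀ {k} → LoopMin f₁ g k → (∀ {x} → Conn f₁ g k x → f (inj₂ x) ≢ s × f (inj₂ x) ≢ t) → LoopMin f g k
    LoopMin-back L no-end C with L (Conn-keep C)
    ... | (p , (y , e)) , le with added e
    ...   | inj₁ e' = (p , (y , e')) , le
    ...   | inj₂ (inj₁ c) = ⊥-elim (proj₁ (no-end (Conn-keep C)) c)
    ...   | inj₂ (inj₂ c) = ⊥-elim (proj₂ (no-end (Conn-keep C)) c)

    circleMinAt-cong : ∀ {k} → (LoopMin f₁ g k → LoopMin f g k) → circleMinAt D₁ D' k ≡ circleMinAt D D' k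
    circleMinAt-cong {k} back = bool-ext
      (LoopMin⇒circleMinAt D D' D-pairing D'-pairing k ∘ back ∘ circleMinAt⇒LoopMin D₁ D' D₁-pairing D'-pairing k)
      (LoopMin⇒circleMinAt D₁ D' D₁-pairing D'-pairing k ∘ LoopMin-keep ∘ circleMinAt⇒LoopMin D D' D-pairing D'-pairing k)

  -- A new circle would contain the new arc. Then the strand of `D ∗ D'` from `s` or from `t` would
  -- run inside it until it leaves at the other of the two dots.
  circles-open : h s ≢ t → circles D₁ D' ≡ circles D D'
  circles-open hs≢t = trans (circles-sum D₁ D') (trans
    (sum-tabulate-cong (λ k → cong indicator (circleMinAt-cong {k} (λ L → LoopMin-back L (no-end L))))) (sym (circles-sum D D')))
    where
    no-end : ∀ {k} → LoopMin f₁ g k → ∀ {x} → Conn f₁ g k x → f (inj₂ x) ≢ s × f (inj₂ x) ≢ t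
    no-end L {x} C = bad-s , bad-t
      where
      bad-s : f (inj₂ x) ≢ s
      bad-s c with end-of {p = s} L C refl (f-inv {inj₂ x} c)
      ... | inj₁ hs≡s = proj₁ (h-pairing s) hs≡s
      ... | inj₂ hs≡t = hs≢t hs≡t
      bad-t : f (inj₂ x) ≢ t
      bad-t c with end-of {p = t} L C refl (f-inv {inj₂ x} c)
      ... | inj₁ ht≡s = hs≢t (h-inv ht≡s)
      ... | inj₂ ht≡t = proj₁ (h-pairing t) ht≡t

  -- As `f s ≢ t`, the strand from `s` to `t` passes through the middle row. The surgery ties its
  -- middle part into one circle, counted at its least dot `k₀`.
  circles-closed : h s ≡ t → f s ≢ t → circles D₁ D' ≡ suc (circles D D')
  circles-closed hs≡t fs≢t = closed strand
    where
    strand : ∃ λ x → f s ≡ inj₂ x × Path f g true (inj₁ x) t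
    strand with subst (Path f g false s) hs≡t (J s)
    ... | exitTop e = ⊥-elim (fs≢t e)
    ... | passDown e π = _ , e , π

    closed : (∃ λ x → f s ≡ inj₂ x × Path f g true (inj₁ x) t) → circles D₁ D' ≡ suc (circles D D')
    closed (x₀ , fs , π) with minimal x₀ (vertices f g π) (vertices-head f g π)
    ... | k₀ , k₀∈ , k₀≤ = trans (circles-sum D₁ D') (trans
            (sum-tabulate-suc k₀ (trans (cong indicator at₁) (cong (suc ∘ indicator) (sym at₀)))
              (λ k k≢ → cong indicator (circleMinAt-cong {k} (λ L → LoopMin-back L (elsewhere k≢ L)))))
            (cong suc (sym (circles-sum D D'))))
      where
      l : List V
      l = vertices f g π

      upper-end : ∃ λ y → f (inj₂ y) ≡ t × y ∈ l
      upper-end = strand-end-down f g D-pairing D'-pairing π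

      -- The first and the last middle dot of the strand become neighbours along the new arc;
      -- elsewhere the neighbour above stays the same.
      neighbour₁ : ∀ {v} → v ∈ l → ∃ λ w → f₁ (inj₂ v) ≡ inj₂ w × w ∈ l
      neighbour₁ {v} v∈ with proj₂ (strand-down f g D-pairing D'-pairing π v∈)
      ... | inj₁ refl = proj₁ upper-end , trans (to-s {inj₂ x₀} (λ ()) (f-inv {s} fs)) (f-inv {inj₂ (proj₁ upper-end)} (proj₁ (proj₂ upper-end))) , proj₂ (proj₂ upper-end)
      ... | inj₂ (inj₁ e) = x₀ , trans (to-t {inj₂ v} (λ ()) e) fs , vertices-head f g π
      ... | inj₂ (inj₂ (w , e , w∈)) = w , keep e , w∈

      closed₁ : ∀ {x y} → x ∈ l → Conn f₁ g x y → y ∈ l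
      closed₁ x∈ stay = x∈
      closed₁ x∈ (below C e) with proj₁ (strand-down f g D-pairing D'-pairing π (closed₁ x∈ C))
      ... | w , e' , w∈ = subst (_∈ l) (inj₁-injective (trans (sym e') e)) w∈
      closed₁ x∈ (above C e) with neighbour₁ (closed₁ x∈ C)
      ... | w , e' , w∈ = subst (_∈ l) (inj₂-injective (trans (sym e') e)) w∈

      at₁ : circleMinAt D₁ D' k₀ ≡ true
      at₁ = LoopMin⇒circleMinAt D₁ D' D₁-pairing D'-pairing k₀ L₁
        where
        L₁ : LoopMin f₁ g k₀
        L₁ C with closed₁ k₀∈ C
        ... | x∈ with proj₁ (strand-down f g D-pairing D'-pairing π x∈) | neighbour₁ x∈
        ...   | w , e , _ | w' , e' , _ = ((w , e) , (w' , e')) , k₀≤ x∈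

      at₀ : circleMinAt D D' k₀ ≡ false
      -- Before the surgery `k₀` is connected to `x₀`, whose upper arc leaves the middle row at `s`.
      at₀ = ¬-not λ c → clash (f-inv {s} fs) (proj₂ (proj₂ (proj₁ (circleMinAt⇒LoopMin D D' D-pairing D'-pairing k₀ c
              (Conn-sym f g D-pairing D'-pairing (vertices-Conn-down f g π k₀∈))))))

      -- A circle of `D₁ ∗ D'` through a former partner of `s` or `t` contains the whole strand, so
      -- its least dot is `k₀`.
      elsewhere : ∀ {k} → k ≢ k₀ → LoopMin f₁ g k → ∀ {x} → Conn f₁ g k x → f (inj₂ x) ≢ s × f (inj₂ x) ≢ t
      elsewhere {k} k≢ L {x} C =
        (λ c → off-strand (subst (_∈ l) (inj₂-injective (trans (sym fs) (f-inv {inj₂ x} c))) (vertices-head f g π))) ,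
        (λ c → off-strand (subst (_∈ l) (inj₂-injective (trans (sym (f-inv {inj₂ (proj₁ upper-end)} (proj₁ (proj₂ upper-end)))) (f-inv {inj₂ x} c))) (proj₂ (proj₂ upper-end))))
        where
        sym₁ : ∀ {x y} → Conn f₁ g x y → Conn f₁ g y x
        sym₁ = Conn-sym f₁ g D₁-pairing D'-pairing
        from-x₀ : ∀ {v} → v ∈ l → Conn f₁ g x₀ v
        from-x₀ = Conn-keep ∘ vertices-Conn-down f g π
        off-strand : x ∈ l → ⊥
        off-strand x∈ = k≢ (toℕ-injective (≤-antisym
          (proj₂ (L (Conn-trans f₁ g C (Conn-trans f₁ g (sym₁ (from-x₀ x∈)) (from-x₀ k₀∈)))))
          (k₀≤ (closed₁ x∈ (sym₁ C)))))

-- Powers of δ in iterated surgeries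

module _ {n : ℕ} where

  closes : Fin n → Diag n → ℕ
  closes i D = indicator (does (match D (cup i) ≟ᴾ cup⁺ i))

  -- the exponent of δ in E_{u₁} ⋯ E_{u_r} D
  loops : List (Fin n) → Diag n → ℕ
  loops [] D = 0
  loops (i ∷ u) D = closes i (acts u D) + loops u D

  closes-yes : ∀ i {D} → match D (cup i) ≡ cup⁺ i → closes i D ≡ 1
  closes-yes i {D} e with match D (cup i) ≟ᴾ cup⁺ i
  ... | yes _ = refl
  ... | no c = ⊥-elim (c e)

  closes-no : ∀ i {D} → match D (cup i) ≢ cup⁺ i → closes i D ≡ 0
  closes-no i {D} c with match D (cup i) ≟ᴾ cup⁺ i
  ... | yes e = ⊥-elim (c e)
  ... | no _ = refl

module _ {m : ℕ} where

  circles-id : ∀ {D' : Diag (suc m)} → Pairing (match D') → circles idDiag D' ≡ 0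
  circles-id {D'} p = trans (circles-sum idDiag D') (trans (sum-tabulate-cong (λ k → cong indicator (open-at k))) (zeros (suc (suc m))))
    where
    open-at : ∀ k → circleMinAt idDiag D' k ≡ false
    open-at k = ¬-not λ c → inj₁≢inj₂ flip flip (match-id (inj₂ k))
      (proj₂ (proj₂ (proj₁ (circleMinAt⇒LoopMin idDiag D' id-pairing p k c stay))))
    zeros : ∀ N → sum (List.tabulate {n = N} (λ _ → 0)) ≡ 0
    zeros zero = refl
    zeros (suc N) = zeros N

  -- The term `closes i D` is a circle that splits off before `D'` is attached; in that case `D` is
  -- unchanged and `F` joins the two dots as well. Otherwise a circle arises exactly when the
  -- strands of `D ∗ D'` at the two dots are one strand.
  circles-act : ∀ i {D D' F : Diag (suc m)} → Pairing (match D) → Pairing (match D') → Pairing (match F) →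
    Joins D D' (match F) → circles (act i D) D' + closes i D ≡ closes i F + circles D D'
  circles-act i {D} {D'} {F} p p' q J with match D (cup i) ≟ᴾ cup⁺ i | match F (cup i) ≟ᴾ cup⁺ i
  ... | yes e | yes _ = trans (cong (λ X → circles X D' + 1) (act-joined i p e)) (ℕₚ.+-comm _ 1)
  ... | yes e | no c = ⊥-elim (c (joined (match F (cup i)) (J (cup i))))
    where
    joined : ∀ q → Path (match D) (match D') false (cup i) q → q ≡ cup⁺ i
    joined _ (exitTop e') = trans (sym e') e
    joined _ (passDown e' _) = ⊥-elim (inj₁≢inj₂ flip flip e e')
  ... | no c | yes e = trans (ℕₚ.+-identityʳ _) (circles-closed p (act-pairing i p) p' q J (act-Surgery i p) e c)
  ... | no _ | no c = trans (ℕₚ.+-identityʳ _) (circles-open p (act-pairing i p) p' q J (act-Surgery i p) c)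

  -- Both sides count the circles of the generators of `u` times `D'`: on the left the generators
  -- are multiplied out first, on the right they are applied to `D'` one by one.
  circles-acts : ∀ u {D' : Diag (suc m)} → Pairing (match D') → circles (acts u idDiag) D' + loops u idDiag ≡ loops u D'
  circles-acts [] p = trans (ℕₚ.+-identityʳ _) (circles-id p)
  circles-acts (i ∷ u) {D'} p = begin
    circles (act i X) D' + (closes i X + loops u idDiag)  ≡⟨ ℕₚ.+-assoc (circles (act i X) D') _ _ ⟨
    circles (act i X) D' + closes i X + loops u idDiag    ≡⟨ cong (_+ loops u idDiag) (circles-act i (acts-pairing u id-pairing) p (acts-pairing u p) (acts-Joins u D' p)) ⟩
    closes i (acts u D') + circles X D' + loops u idDiag  ≡⟨ ℕₚ.+-assoc (closes i (acts u D')) _ _ ⟩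
    closes i (acts u D') + (circles X D' + loops u idDiag) ≡⟨ cong (closes i (acts u D') +_) (circles-acts u p) ⟩
    closes i (acts u D') + loops u D' ∎
    where
    open ≡-Reasoning
    X : Diag (suc m)
    X = acts u idDiag

-- Crossings

<ᵇ-true⇒< : ∀ {a b} → (a ℕ.<ᵇ b) ≡ true → a < b
<ᵇ-true⇒< {a} {b} e = ℕₚ.<ᵇ⇒< a b (subst T (sym e) tt)

<⇒<ᵇ-true : ∀ {a b} → a < b → (a ℕ.<ᵇ b) ≡ true
<⇒<ᵇ-true {a} {b} a<b with a ℕ.<ᵇ b | ℕₚ.<⇒<ᵇ a<b
... | true | _ = refl

≤⇒<ᵇ-false : ∀ {a b} → b ≤ a → (a ℕ.<ᵇ b) ≡ false
≤⇒<ᵇ-false b≤a = ¬-not λ e → <⇒≱ (<ᵇ-true⇒< e) b≤a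

<ᵇ-false⇒≤ : ∀ {a b} → (a ℕ.<ᵇ b) ≡ false → b ≤ a
<ᵇ-false⇒≤ {a} {b} e = ≮⇒≥ λ a<b → case trans (sym (<⇒<ᵇ-true a<b)) e of λ ()

xor-cancel : ∀ a b c → (a xor c) xor (b xor c) ≡ a xor b
xor-cancel true true true = refl
xor-cancel true true false = refl
xor-cancel true false true = refl
xor-cancel true false false = refl
xor-cancel false true true = refl
xor-cancel false true false = refl
xor-cancel false false true = refl
xor-cancel false false false = refl

Between⇒xor : ∀ {a b c} → Between a b c → (b ℕ.<ᵇ a) xor (b ℕ.<ᵇ c) ≡ true
Between⇒xor (inj₁ (a<b , b<c)) rewrite ≤⇒<ᵇ-false (<⇒≤ a<b) | <⇒<ᵇ-true b<c = refl
Between⇒xor (inj₂ (c<b , b<a)) rewrite ≤⇒<ᵇ-false (<⇒≤ c<b) | <⇒<ᵇ-true b<a = refl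

xor⇒Between : ∀ {a b c} → b ≢ a → b ≢ c → (b ℕ.<ᵇ a) xor (b ℕ.<ᵇ c) ≡ true → Between a b c
xor⇒Between {a} {b} {c} b≢a b≢c e with b ℕ.<ᵇ a in p | b ℕ.<ᵇ c in q
... | true | false = inj₂ (≤∧≢⇒< (<ᵇ-false⇒≤ q) (b≢c ∘ sym) , <ᵇ-true⇒< p)
... | false | true = inj₁ (≤∧≢⇒< (<ᵇ-false⇒≤ p) (b≢a ∘ sym) , <ᵇ-true⇒< q)

module _ {n : ℕ} where

  bpos-top≤ : (k : Fin (suc n)) → bpos {n} (inj₁ k) ≤ n
  bpos-top≤ k = ≤-pred (Finₚ.toℕ<n k)

  bpos-bot> : (k : Fin (suc n)) → n < bpos {n} (inj₂ k)
  bpos-bot> k = subst (_≤ bpos {n} (inj₂ k)) (ℕₚ.m+n∸m≡n n (suc n)) (ℕₚ.∸-monoʳ-≤ (n + suc n) (bpos-top≤ k))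

  toℕ≤2n+1 : (k : Fin (suc n)) → toℕ k ≤ n + suc n
  toℕ≤2n+1 k = ≤-trans (bpos-top≤ k) (ℕₚ.m≤m+n n (suc n))

  bpos-injective : ∀ {p q : Pt n} → bpos p ≡ bpos q → p ≡ q
  bpos-injective {inj₁ j} {inj₁ k} e = cong inj₁ (toℕ-injective e)
  bpos-injective {inj₁ j} {inj₂ k} e = ⊥-elim (<-irrefl e (≤-<-trans (bpos-top≤ j) (bpos-bot> k)))
  bpos-injective {inj₂ j} {inj₁ k} e = ⊥-elim (<-irrefl (sym e) (≤-<-trans (bpos-top≤ k) (bpos-bot> j)))
  bpos-injective {inj₂ j} {inj₂ k} e = cong inj₂ (toℕ-injective (ℕₚ.∸-cancelˡ-≡ (toℕ≤2n+1 j) (toℕ≤2n+1 k) e))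

  before : Pt n → Pt n → Bool
  before z a = bpos z ℕ.<ᵇ bpos a

  -- For z distinct from x and y: does z lie on the arc from x to y avoiding
  -- the corner before dot 1?  In this form non-crossing is an equation
  -- between bits, and adding the bits of two chords cancels a common end.
  side : Pt n → Pt n → Pt n → Bool
  side x y z = before z x xor before z y

  Planar : (Pt n → Pt n) → Set
  Planar f = ∀ x z → z ≢ x → z ≢ f x → side x (f x) z ≡ side x (f x) (f z)

  NC⇒Planar : ∀ {D : Diag n} → NCDiagram D → Planar (match D)
  NC⇒Planar {D} (p , nc) x z z≢x z≢fx = bool-ext
    (λ e → Between⇒xor (nc x z (xor⇒Between (z≢x ∘ bpos-injective) (z≢fx ∘ bpos-injective) e)))
    (λ e → Between⇒xor (subst (λ v → Between (bpos x) (bpos v) (bpos (f x))) (proj₂ (p z))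
      (nc x (f z) (xor⇒Between (fz≢x ∘ bpos-injective) (fz≢fx ∘ bpos-injective) e))))
    where
    f : Pt n → Pt n
    f = match D
    fz≢x : f z ≢ x
    fz≢x e = z≢fx (trans (sym (proj₂ (p z))) (cong f e))
    fz≢fx : f z ≢ f x
    fz≢fx e = z≢x (trans (sym (proj₂ (p z))) (trans (cong f e) (proj₂ (p x))))

  Planar⇒NC : ∀ {D : Diag n} → Pairing (match D) → Planar (match D) → NCDiagram D
  Planar⇒NC {D} p nc = p , λ x z b → xor⇒Between
    (λ e → z≢fx x z b (trans (sym (proj₂ (p z))) (cong f (bpos-injective {f z} {x} e))))
    (λ e → z≢x x z b (trans (sym (proj₂ (p z))) (trans (cong f (bpos-injective {f z} {f x} e)) (proj₂ (p x)))))
    (trans (sym (nc x z (z≢x x z b) (z≢fx x z b))) (Between⇒xor b))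
    where
    f : Pt n → Pt n
    f = match D
    z≢x : ∀ x z → Between (bpos x) (bpos z) (bpos (f x)) → z ≢ x
    z≢x x z (inj₁ (a , _)) refl = <-irrefl refl a
    z≢x x z (inj₂ (_ , a)) refl = <-irrefl refl a
    z≢fx : ∀ x z → Between (bpos x) (bpos z) (bpos (f x)) → z ≢ f x
    z≢fx x z (inj₁ (_ , a)) refl = <-irrefl refl a
    z≢fx x z (inj₂ (a , _)) refl = <-irrefl refl a

  -- No other dot lies between `s` and `t` in the boundary order, so they are interchangeable in
  -- every bit `side` taken with other dots.
  record Adjacent (s t : Pt n) : Set where
    field
      before-both : ∀ {z} → z ≢ s → z ≢ t → before z s ≡ before z t
      both-before : ∀ {z} → z ≢ s → z ≢ t → before s z ≡ before t z

  Adjacent-swap : ∀ {s t} → Adjacent s t → Adjacent t s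
  Adjacent-swap A = record
    { before-both = λ a b → sym (before-both b a) ; both-before = λ a b → sym (both-before b a) }
    where open Adjacent A

  side-via : ∀ {x y s z} → side x s z xor side y s z ≡ side x y z
  side-via {x} {y} {s} {z} = xor-cancel (before z x) (before z y) (before z s)

  module _ {f g : Pt n → Pt n} (f-pairing : Pairing f) (f-planar : Planar f) where
    private
      inv : ∀ {x y} → f x ≡ y → f y ≡ x
      inv {x} refl = proj₂ (f-pairing x)

      chord : ∀ {x y} → f x ≡ y → ∀ {z} → z ≢ x → z ≢ y → side x y z ≡ side x y (f z)
      chord {x} refl {z} = f-planar x z

      module _ {s t : Pt n} (A : Adjacent s t) (S : Surgery s t f g) where
        open Adjacent A
        open Surgery S

        g-inv : ∀ {x y} → g x ≡ y → g y ≡ x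
        g-inv {x} refl = proj₂ (Surgery-pairing f-pairing S x)

        flat : ∀ {z} → z ≢ s → z ≢ t → side s t z ≡ false
        flat {z} a b = trans (cong (_xor before z t) (before-both a b)) (xor-same (before z t))

        same-side : ∀ {x y} → x ≢ s → x ≢ t → y ≢ s → y ≢ t → side x y s ≡ side x y t
        same-side a b c d = cong₂ _xor_ (both-before a b) (both-before c d)

        side-s⇒t : ∀ {y z} → z ≢ s → z ≢ t → side y s z ≡ side y t z
        side-s⇒t {y} {z} a b = cong (before z y xor_) (before-both a b)

        planar-at-s : ∀ z → z ≢ s → z ≢ g s → side s (g s) z ≡ side s (g s) (g z)
        planar-at-s z z≢s z≢gs = subst (λ v → side s v z ≡ side s v (g z)) (sym at-s)
          (trans (flat z≢s z≢t) (sym (flat gz≢s gz≢t)))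
          where
          z≢t : z ≢ t
          z≢t e = z≢gs (trans e (sym at-s))
          gz≢s : g z ≢ s
          gz≢s e = z≢gs (sym (g-inv e))
          gz≢t : g z ≢ t
          gz≢t e = z≢s (trans (sym (g-inv e)) at-t)

        -- As `s` and `t` look alike from other dots, the bit of the new chord from `x` to `f t` is
        -- the sum of the bits of the old chords from `x` to `s` and from `f t` to `t`, and these
        -- two chords are not crossed.
        planar-at-mate : f s ≢ t → ∀ x → x ≢ s → x ≢ t → f x ≡ s → ∀ z → z ≢ x → z ≢ g x → side x (g x) z ≡ side x (g x) (g z)
        planar-at-mate fs≢t x x≢s x≢t e z z≢x z≢gx = subst (λ v → side x v z ≡ side x v (g z)) (sym gx≡ft) go
          where
          y : Pt n
          y = f t
          gx≡ft : g x ≡ y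
          gx≡ft = to-s x≢t e
          y≢s : y ≢ s
          y≢s = fs≢t ∘ inv
          y≢t : y ≢ t
          y≢t = proj₁ (f-pairing t)
          go : side x y z ≡ side x y (g z)
          go with place s t f z
          ... | dot-s refl = trans (same-side x≢s x≢t y≢s y≢t) (cong (side x y) (sym at-s))
          ... | dot-t refl = trans (sym (same-side x≢s x≢t y≢s y≢t)) (cong (side x y) (sym at-t))
          ... | mate-s _ _ e' = ⊥-elim (z≢x (trans (sym (inv e')) (inv e)))
          ... | mate-t _ _ e' = ⊥-elim (z≢gx (trans (sym (inv e')) (sym gx≡ft)))
          ... | apart z≢s z≢t fz≢s fz≢t = begin
            side x y z                        ≡⟨ side-via {x} {y} {s} {z} ⟨
            side x s z xor side y s z         ≡⟨ cong₂ _xor_ (chord e z≢x z≢s) (begin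
              side y s z      ≡⟨ side-s⇒t {y} z≢s z≢t ⟩
              side y t z      ≡⟨ chord (proj₂ (f-pairing t)) (z≢gx ∘ (λ c → trans c (sym gx≡ft))) z≢t ⟩
              side y t (f z)  ≡⟨ side-s⇒t {y} fz≢s fz≢t ⟨
              side y s (f z)  ∎) ⟩
            side x s (f z) xor side y s (f z) ≡⟨ side-via {x} {y} {s} {f z} ⟩
            side x y (f z)                    ≡⟨ cong (side x y) (off z≢s z≢t fz≢s fz≢t) ⟨
            side x y (g z)                    ∎
            where open ≡-Reasoning

        -- The side of an untouched chord is passed on from `z` to its old partner `s`, from there
        -- to the adjacent `t`, and on to `f t`, the new partner.
        planar-mates : ∀ {x} → x ≢ s → x ≢ t → f x ≢ s → f x ≢ t → ∀ {z} → z ≢ x → z ≢ f x → z ≢ s → z ≢ t → f z ≡ s →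
          side x (f x) z ≡ side x (f x) (g z)
        planar-mates {x} a b c d {z} z≢x z≢fx z≢s z≢t e = begin
          side x (f x) z     ≡⟨ f-planar x z z≢x z≢fx ⟩
          side x (f x) (f z) ≡⟨ cong (side x (f x)) e ⟩
          side x (f x) s     ≡⟨ same-side a b c d ⟩
          side x (f x) t     ≡⟨ f-planar x t (b ∘ sym) (d ∘ sym) ⟩
          side x (f x) (f t) ≡⟨ cong (side x (f x)) (to-s z≢t e) ⟨
          side x (f x) (g z) ∎
          where open ≡-Reasoning

    Surgery-planar : ∀ {s t} → Adjacent s t → Surgery s t f g → Planar g
    Surgery-planar {s} {t} A S x z with f s ≟ᴾ t
    ... | yes e = λ z≢x z≢gx → subst₂ (λ v w → side x v z ≡ side x v w) (sym (Surgery-joined f-pairing S e x)) (sym (Surgery-joined f-pairing S e z))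
                    (f-planar x z z≢x (z≢gx ∘ λ c → trans c (sym (Surgery-joined f-pairing S e x))))
    ... | no fs≢t with place s t f x
    ...   | dot-s refl = planar-at-s A S z
    ...   | dot-t refl = planar-at-s (Adjacent-swap A) (Surgery-swap S) z
    ...   | mate-s a b e = planar-at-mate A S fs≢t x a b e z
    ...   | mate-t a b e = planar-at-mate (Adjacent-swap A) (Surgery-swap S) (fs≢t ∘ inv) x b a e z
    ...   | apart a b c d = λ z≢x z≢gx → subst (λ v → side x v z ≡ side x v (g z)) (sym gx≡fx) (go z≢x (z≢gx ∘ λ e → trans e (sym gx≡fx)))
      where
      gx≡fx : g x ≡ f x
      gx≡fx = Surgery.off S a b c d
      go : z ≢ x → z ≢ f x → side x (f x) z ≡ side x (f x) (g z)
      go z≢x z≢fx with place s t f z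
      ... | dot-s refl = trans (same-side A S a b c d) (cong (side x (f x)) (sym (Surgery.at-s S)))
      ... | dot-t refl = trans (sym (same-side A S a b c d)) (cong (side x (f x)) (sym (Surgery.at-t S)))
      ... | mate-s p q e = planar-mates A S a b c d z≢x z≢fx p q e
      ... | mate-t p q e = planar-mates (Adjacent-swap A) (Surgery-swap S) b a d c z≢x z≢fx q p e
      ... | apart p q r u = trans (f-planar x z z≢x z≢fx) (cong (side x (f x)) (sym (Surgery.off S p q r u)))

  cup-Adjacent : ∀ i → Adjacent (cup i) (cup⁺ i)
  cup-Adjacent i = record { before-both = λ {z} → before-both {z} ; both-before = λ {z} → both-before {z} }
    where
    a : ℕ
    a = toℕ i
    l : toℕ (inject₁ i) ≡ a
    l = toℕ-inject₁ i
    bpos≢ : ∀ {z} → z ≢ cup i → bpos z ≢ a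
    bpos≢ {z} c e = c (bpos-injective (trans e (sym l)))
    before-both : ∀ {z} → z ≢ cup i → z ≢ cup⁺ i → before z (cup i) ≡ before z (cup⁺ i)
    before-both {z} c d = trans (cong (bpos z ℕ.<ᵇ_) l) (bool-ext
      (λ e → <⇒<ᵇ-true (m≤n⇒m≤1+n (<ᵇ-true⇒< {bpos z} e)))
      (λ e → <⇒<ᵇ-true (≤∧≢⇒< (≤-pred (<ᵇ-true⇒< {bpos z} e)) (bpos≢ c))))
    both-before : ∀ {z} → z ≢ cup i → z ≢ cup⁺ i → before (cup i) z ≡ before (cup⁺ i) z
    both-before {z} c d = trans (cong (ℕ._<ᵇ bpos z) l) (bool-ext
      (λ e → <⇒<ᵇ-true (≤∧≢⇒< (<ᵇ-true⇒< {a} {bpos z} e) (d ∘ bpos-injective ∘ sym)))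
      (λ e → <⇒<ᵇ-true (<-trans (n<1+n a) (<ᵇ-true⇒< {suc a} {bpos z} e))))

  act-planar : ∀ i {D} → Pairing (match D) → Planar (match D) → Planar (match (act i D))
  act-planar i p nc = Surgery-planar p nc (cup-Adjacent i) (act-Surgery i p)

  side-comm : ∀ x y z → side x y z ≡ side y x z
  side-comm x y z = xor-comm (before z x) (before z y)

  flip-planar : Planar flip
  flip-planar = go
    where
    -- Since positions in the bottom row run backwards, both bits amount to `k < j`.
    straight : ∀ {j k} → j ≢ k → side (inj₁ k) (inj₂ k) (inj₁ j) ≡ side (inj₁ k) (inj₂ k) (inj₂ j)
    straight {j} {k} j≢k
      rewrite <⇒<ᵇ-true (≤-<-trans (bpos-top≤ j) (bpos-bot> k))
            | ≤⇒<ᵇ-false (<⇒≤ (≤-<-trans (bpos-top≤ k) (bpos-bot> j)))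
      with toℕ j ℕ.<ᵇ toℕ k in e
    ... | true = sym (≤⇒<ᵇ-false (ℕₚ.∸-monoʳ-≤ (n + suc n) (<⇒≤ (<ᵇ-true⇒< {toℕ j} {toℕ k} e))))
    ... | false = sym (<⇒<ᵇ-true (ℕₚ.∸-monoʳ-< (≤∧≢⇒< (<ᵇ-false⇒≤ {toℕ j} {toℕ k} e) (j≢k ∘ sym ∘ toℕ-injective)) (toℕ≤2n+1 j)))
    go : Planar flip
    go (inj₁ k) (inj₁ j) z≢x _ = straight (z≢x ∘ cong inj₁)
    go (inj₁ k) (inj₂ j) _ z≢fx = sym (straight (z≢fx ∘ cong inj₂))
    go (inj₂ k) (inj₁ j) _ z≢fx = trans (side-comm (inj₂ k) (inj₁ k) (inj₁ j)) (trans (straight (z≢fx ∘ cong inj₁)) (side-comm (inj₁ k) (inj₂ k) (inj₂ j)))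
    go (inj₂ k) (inj₂ j) z≢x _ = trans (side-comm (inj₂ k) (inj₁ k) (inj₂ j)) (trans (sym (straight (z≢x ∘ cong inj₂))) (side-comm (inj₁ k) (inj₂ k) (inj₁ j)))

  Planar-cong : ∀ {f g} → (∀ p → f p ≡ g p) → Planar g → Planar f
  Planar-cong {f} {g} e nc x z a b = subst₂ (λ v w → side x v z ≡ side x v w) (sym (e x)) (sym (e z)) (nc x z a (b ∘ λ c → trans c (sym (e x))))

  acts-planar : ∀ u → Planar (match (acts u idDiag))
  acts-planar [] = Planar-cong match-id flip-planar
  acts-planar (i ∷ u) = act-planar i (acts-pairing u id-pairing) (acts-planar u)

  acts-NC : ∀ u → NCDiagram (acts u idDiag)
  acts-NC u = Planar⇒NC (acts-pairing u id-pairing) (acts-planar u)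

-- A planar pairing is determined by its tails and heads

double-<⇒< : ∀ {j k} → j + j < k + k → j < k
double-<⇒< {j} {k} lt = ≰⇒> λ k≤j → <⇒≱ lt (+-mono-≤ k≤j k≤j)

double-≤⇒≤ : ∀ {j k} → j + j ≤ k + k → j ≤ k
double-≤⇒≤ {j} {k} le = ≮⇒≥ λ k<j → ℕₚ.≤⇒≯ le (ℕₚ.+-mono-< k<j k<j)

double-< : ∀ {j k} → j < k → suc (j + j) < k + k
double-< {j} j<k = ≤-trans (s≤s (≤-reflexive (sym (ℕₚ.+-suc j j)))) (+-mono-≤ j<k j<k)

odd≢even : ∀ {j k} → suc (j + j) ≢ k + k
odd≢even {j} {k} e = <-irrefl e (double-< (double-<⇒< {j} {k} (≤-reflexive e)))

module _ {n : ℕ} where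

  -- Sweep the dots in the order 1′, 1, 2′, 2, …  A vertical arrow (x, x′) is
  -- then opened by x′ and closed by x.
  time : Pt n → ℕ
  time (inj₁ k) = suc (toℕ k + toℕ k)
  time (inj₂ k) = toℕ k + toℕ k

  time-injective : ∀ {p q} → time p ≡ time q → p ≡ q
  time-injective {inj₁ j} {inj₁ k} e = cong inj₁ (toℕ-injective (≤-antisym
    (double-≤⇒≤ (≤-reflexive (ℕₚ.suc-injective e))) (double-≤⇒≤ (≤-reflexive (sym (ℕₚ.suc-injective e))))))
  time-injective {inj₁ j} {inj₂ k} e = ⊥-elim (odd≢even {toℕ j} {toℕ k} e)
  time-injective {inj₂ j} {inj₁ k} e = ⊥-elim (odd≢even {toℕ k} {toℕ j} (sym e))
  time-injective {inj₂ j} {inj₂ k} e = cong inj₂ (toℕ-injective (≤-antisym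
    (double-≤⇒≤ (≤-reflexive e)) (double-≤⇒≤ (≤-reflexive (sym e)))))

  isTop : Pt n → Bool
  isTop (inj₁ _) = true
  isTop (inj₂ _) = false

  private
    top<top : ∀ (j k : Fin (suc n)) → toℕ j < toℕ k → before {n} (inj₁ j) (inj₁ k) ≡ true
    top<top _ _ = <⇒<ᵇ-true
    top≮top : ∀ (j k : Fin (suc n)) → toℕ k ≤ toℕ j → before {n} (inj₁ j) (inj₁ k) ≡ false
    top≮top _ _ = ≤⇒<ᵇ-false
    top<bot : ∀ (j k : Fin (suc n)) → before {n} (inj₁ j) (inj₂ k) ≡ true
    top<bot j k = <⇒<ᵇ-true (≤-<-trans (bpos-top≤ j) (bpos-bot> k))
    bot≮top : ∀ (j k : Fin (suc n)) → before {n} (inj₂ j) (inj₁ k) ≡ false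
    bot≮top j k = ≤⇒<ᵇ-false (<⇒≤ (≤-<-trans (bpos-top≤ k) (bpos-bot> j)))
    bot<bot : ∀ (j k : Fin (suc n)) → toℕ k < toℕ j → before {n} (inj₂ j) (inj₂ k) ≡ true
    bot<bot j _ lt = <⇒<ᵇ-true (ℕₚ.∸-monoʳ-< lt (toℕ≤2n+1 j))
    bot≮bot : ∀ (j k : Fin (suc n)) → toℕ j ≤ toℕ k → before {n} (inj₂ j) (inj₂ k) ≡ false
    bot≮bot _ _ le = ≤⇒<ᵇ-false (ℕₚ.∸-monoʳ-≤ (n + suc n) le)

    xor₃ : ∀ {a b c a' b' c' : Bool} → a ≡ a' → b ≡ b' → c ≡ c' → a xor (b xor c) ≡ a' xor (b' xor c')
    xor₃ refl refl refl = refl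

    halve : (j k : Fin (suc n)) → toℕ j + toℕ j < toℕ k + toℕ k → toℕ j < toℕ k
    halve _ _ = double-<⇒<
    halve≤ : (j k : Fin (suc n)) → toℕ j + toℕ j ≤ toℕ k + toℕ k → toℕ j ≤ toℕ k
    halve≤ _ _ = double-≤⇒≤

  -- The left side is the cyclic orientation of the three dots.
  orientation : ∀ p q r → time q < time p → time p < time r →
    before q p xor (before r p xor before r q) ≡ isTop p
  orientation (inj₁ k) (inj₁ j) (inj₁ l) qp pr = xor₃ (top<top j k j<k) (top≮top l k (<⇒≤ k<l)) (top≮top l j (<⇒≤ (<-trans j<k k<l)))
    where
    j<k = halve j k (≤-pred qp)
    k<l = halve k l (≤-pred pr)
  orientation (inj₁ k) (inj₁ j) (inj₂ l) qp pr = xor₃ (top<top j k (halve j k (≤-pred qp))) (bot≮top l k) (bot≮top l j)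
  orientation (inj₁ k) (inj₂ j) (inj₁ l) qp pr = xor₃ (bot≮top j k) (top≮top l k (<⇒≤ (halve k l (≤-pred pr)))) (top<bot l j)
  orientation (inj₁ k) (inj₂ j) (inj₂ l) qp pr = xor₃ (bot≮top j k) (bot≮top l k)
    (bot<bot l j (≤-<-trans (halve≤ j k (≤-pred qp)) (halve k l (<⇒≤ pr))))
  orientation (inj₂ k) (inj₁ j) (inj₁ l) qp pr = xor₃ (top<bot j k) (top<bot l k)
    (top≮top l j (<⇒≤ (<-≤-trans (halve j k (<⇒≤ qp)) (halve≤ k l (≤-pred pr)))))
  orientation (inj₂ k) (inj₁ j) (inj₂ l) qp pr = xor₃ (top<bot j k) (bot<bot l k (halve k l pr)) (bot≮top l j)
  orientation (inj₂ k) (inj₂ j) (inj₁ l) qp pr = xor₃ (bot≮bot j k (<⇒≤ (halve j k qp))) (top<bot l k) (top<bot l j)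
  orientation (inj₂ k) (inj₂ j) (inj₂ l) qp pr = xor₃ (bot≮bot j k (<⇒≤ j<k)) (bot<bot l k k<l) (bot<bot l j (<-trans j<k k<l))
    where
    j<k = halve j k qp
    k<l = halve k l pr

  before-asym : ∀ {p q : Pt n} → before p q ≡ before q p → p ≡ q
  before-asym {p} {q} e with before p q in c
  ... | true = ⊥-elim (ℕₚ.<-asym (<ᵇ-true⇒< {bpos p} {bpos q} c) (<ᵇ-true⇒< {bpos q} {bpos p} (sym e)))
  ... | false = bpos-injective (≤-antisym (<ᵇ-false⇒≤ {bpos q} {bpos p} (sym e)) (<ᵇ-false⇒≤ {bpos p} {bpos q} c))

  Closes : (Pt n → Pt n) → Pt n → Set
  Closes f p = time (f p) < time p

  module _ {f f' : Pt n → Pt n} (P : Pairing f) (P' : Pairing f') (nc : Planar f) (nc' : Planar f')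
           (same : ∀ p → Closes f p → Closes f' p) (same' : ∀ p → Closes f' p → Closes f p) where

    private
      inv : ∀ {x y} → f x ≡ y → f y ≡ x
      inv {x} refl = proj₂ (P x)
      inv' : ∀ {x y} → f' x ≡ y → f' y ≡ x
      inv' {x} refl = proj₂ (P' x)

      -- If p were closed by different partners q and q', then q' would be
      -- closed after p by f, and q after p by f'.
      step : ∀ p → (∀ r → time r < time p → Closes f r → f r ≡ f' r) → Closes f p → f p ≡ f' p
      step p ih p-closes with f p ≟ᴾ f' p
      ... | yes e = e
      ... | no q≢q' = ⊥-elim (q≢q' (before-asym bits))
        where
        q q' r r' : Pt n
        q = f p
        q' = f' p
        r = f q'
        r' = f' q

        r≢p : r ≢ p
        r≢p e = q≢q' (inv e)
        r'≢p : r' ≢ p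
        r'≢p e = q≢q' (sym (inv' e))

        q<p : time q < time p
        q<p = p-closes
        q'<p : time q' < time p
        q'<p = same p p-closes

        -- If `r` came before `p`, the pair of `q'` and `r` would be closed before `p`, where `f`
        -- and `f'` agree; but `f'` pairs `q'` with `p`.
        r≮p : ¬ time r < time p
        r≮p r<p with ℕₚ.<-cmp (time r) (time q')
        ... | tri< r<q' _ _ = r≢p (trans (ih q' q'<p r<q') (proj₂ (P' p)))
        ... | tri≈ _ e _ = proj₁ (P q') (time-injective e)
        ... | tri> _ _ q'<r = r≢p (trans (sym (inv' (trans (sym (ih r r<p (subst (λ v → time v < time r) (sym (proj₂ (P q'))) q'<r))) (proj₂ (P q'))))) (proj₂ (P' p)))

        r'≮p : ¬ time r' < time p
        r'≮p r'<p with ℕₚ.<-cmp (time r') (time q)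
        ... | tri< r'<q _ _ = r'≢p (trans (sym (ih q q<p (same' q r'<q))) (proj₂ (P p)))
        ... | tri≈ _ e _ = proj₁ (P' q) (time-injective e)
        ... | tri> _ _ q<r' = r'≢p (trans (sym (inv (trans (ih r' r'<p (same' r' (subst (λ v → time v < time r') (sym (proj₂ (P' q))) q<r'))) (proj₂ (P' q))))) (proj₂ (P p)))

        later : ∀ {x} → x ≢ p → ¬ time x < time p → time p < time x
        later x≢p x≮p = ≤∧≢⇒< (≮⇒≥ x≮p) (x≢p ∘ time-injective ∘ sym)

        cancel : ∀ a b c d → a xor (b xor c) ≡ b xor (a xor d) → c ≡ d
        cancel true true true true e = refl
        cancel true true false false e = refl
        cancel true false true true e = refl
        cancel true false false false e = refl
        cancel false true true true e = refl
        cancel false true false false e = refl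
        cancel false false true true e = refl
        cancel false false false false e = refl

        -- Planarity replaces `q'` by `r` and `q` by `r'`, dots later than `p`. Then `orientation`
        -- turns both sums into the same bit `isTop p`, and cancelling leaves a comparison of `q`
        -- and `q'` equal to its reverse.
        bits : before q q' ≡ before q' q
        bits = sym (cancel (before q p) (before q' p) (before q' q) (before q q') (begin
          before q p xor side p q q'   ≡⟨ cong (before q p xor_) (nc p q' (proj₁ (P' p)) (q≢q' ∘ sym)) ⟩
          before q p xor side p q r    ≡⟨ orientation p q r q<p (later r≢p r≮p) ⟩
          isTop p                      ≡⟨ orientation p q' r' q'<p (later r'≢p r'≮p) ⟨
          before q' p xor side p q' r' ≡⟨ cong (before q' p xor_) (nc' p q (proj₁ (P p)) q≢q') ⟨
          before q' p xor side p q' q  ∎))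
          where open ≡-Reasoning

      closers : ∀ p → Closes f p → f p ≡ f' p
      closers p = go p (<-wellFounded (time p))
        where
        go : ∀ p → Acc _<_ (time p) → Closes f p → f p ≡ f' p
        go p (acc rec) = step p (λ r r<p → go r (rec r<p))

    Planar-unique : ∀ p → f p ≡ f' p
    Planar-unique p with ℕₚ.<-cmp (time (f p)) (time p)
    ... | tri< c _ _ = closers p c
    ... | tri≈ _ e _ = ⊥-elim (proj₁ (P p) (time-injective e))
    ... | tri> _ _ c = sym (inv' (trans (sym (closers (f p) (subst (λ v → time v < time (f p)) (sym (proj₂ (P p))) c))) (proj₂ (P p))))

  -- Arrows within a row and slanted arrows are treated alike: only the columns matter, and
  -- strictness excludes vertical arrows.
  IsTail IsHead : (Pt n → Pt n) → Fin (suc n) → Set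
  IsTail f k = toℕ k < toℕ (column (f (inj₁ k)))
  IsHead f k = toℕ (column (f (inj₂ k))) < toℕ k

  module _ {f : Pt n → Pt n} (P : Pairing f) where

    private
      double-mono-< : ∀ {j k} → j < k → j + j < k + k
      double-mono-< lt = ℕₚ.+-mono-< lt lt

    Closes-top⇒¬IsTail : ∀ {k} → Closes f (inj₁ k) → ¬ IsTail f k
    Closes-top⇒¬IsTail {k} c tail with f (inj₁ k)
    ... | inj₁ j = ℕₚ.<-asym tail (double-<⇒< (≤-pred c))
    ... | inj₂ j = <⇒≱ tail (double-≤⇒≤ (≤-pred c))

    ¬IsTail⇒Closes-top : ∀ {k} → ¬ IsTail f k → Closes f (inj₁ k)
    ¬IsTail⇒Closes-top {k} c with f (inj₁ k) | proj₁ (P (inj₁ k))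
    ... | inj₁ j | j≢k = s≤s (double-mono-< (≤∧≢⇒< (≮⇒≥ c) (j≢k ∘ cong inj₁ ∘ toℕ-injective)))
    ... | inj₂ j | _ = s≤s (+-mono-≤ (≮⇒≥ c) (≮⇒≥ c))

    Closes-bot⇒IsHead : ∀ {k} → Closes f (inj₂ k) → IsHead f k
    Closes-bot⇒IsHead {k} c with f (inj₂ k)
    ... | inj₁ j = double-<⇒< (<⇒≤ c)
    ... | inj₂ j = double-<⇒< c

    IsHead⇒Closes-bot : ∀ {k} → IsHead f k → Closes f (inj₂ k)
    IsHead⇒Closes-bot {k} c with f (inj₂ k)
    ... | inj₁ j = double-< c
    ... | inj₂ j = double-mono-< c

  InI⇒IsTail : ∀ {D : Diag n} {i} → InI D (suc (toℕ i)) → IsTail (match D) i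
  InI⇒IsTail (i' , e , j , m , lt) with toℕ-injective (ℕₚ.suc-injective e)
  InI⇒IsTail (i' , e , j , inj₁ m , lt) | refl = subst (λ v → toℕ i' < toℕ (column v)) (sym m) lt
  InI⇒IsTail (i' , e , j , inj₂ m , lt) | refl = subst (λ v → toℕ i' < toℕ (column v)) (sym m) lt

  IsTail⇒InI : ∀ {D : Diag n} {i} → IsTail (match D) i → InI D (suc (toℕ i))
  IsTail⇒InI {D} {i} t with match D (inj₁ i) in e
  ... | inj₁ j = i , refl , j , inj₁ e , t
  ... | inj₂ j = i , refl , j , inj₂ e , t

  InJ⇒IsHead : ∀ {D : Diag n} {b} → InJ D (toℕ b) → IsHead (match D) b
  InJ⇒IsHead (b' , e , c , m , lt) with toℕ-injective e
  InJ⇒IsHead (b' , e , c , inj₁ m , lt) | refl = subst (λ v → toℕ (column v) < toℕ b') (sym m) lt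
  InJ⇒IsHead (b' , e , c , inj₂ m , lt) | refl = subst (λ v → toℕ (column v) < toℕ b') (sym m) lt

  IsHead⇒InJ : ∀ {D : Diag n} {b} → IsHead (match D) b → InJ D (toℕ b)
  IsHead⇒InJ {D} {b} t with match D (inj₂ b) in e
  ... | inj₁ j = b , refl , j , inj₂ e , t
  ... | inj₂ j = b , refl , j , inj₁ e , t

  NC-determined : ∀ {D D' : Diag n} → NCDiagram D → NCDiagram D' →
    (∀ k → InI D k → InI D' k) → (∀ k → InI D' k → InI D k) →
    (∀ k → InJ D k → InJ D' k) → (∀ k → InJ D' k → InJ D k) → D ≡ D'
  NC-determined {D} {D'} N N' i i' j j' = diag-ext (Planar-unique (proj₁ N) (proj₁ N') (NC⇒Planar N) (NC⇒Planar N')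
    (closes-transfer (proj₁ N) (proj₁ N') i' j) (closes-transfer (proj₁ N') (proj₁ N) i j'))
    where
    closes-transfer : ∀ {D D' : Diag n} → Pairing (match D) → Pairing (match D') →
      (∀ k → InI D' k → InI D k) → (∀ k → InJ D k → InJ D' k) → ∀ p → Closes (match D) p → Closes (match D') p
    closes-transfer {D} {D'} P P' i' j (inj₁ k) c =
      ¬IsTail⇒Closes-top P' (Closes-top⇒¬IsTail P c ∘ InI⇒IsTail {D} ∘ i' _ ∘ IsTail⇒InI {D'})
    closes-transfer {D} {D'} P P' i' j (inj₂ k) c =
      IsHead⇒Closes-bot P' (InJ⇒IsHead {D'} (j _ (IsHead⇒InJ {D} (Closes-bot⇒IsHead P c))))

-- Tails and heads of the diagram of a canonical form

module _ {n : ℕ} {f g : Pt n → Pt n} (i : Fin n) (P : Pairing f) (S : Surgery (cup i) (cup⁺ i) f g)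
         (left : ¬ IsTail f (inject₁ i)) (right : suc (toℕ i) ≤ toℕ (column (f (cup⁺ i)))) where

  private
    open Surgery S
    inv : ∀ {x y} → f x ≡ y → f y ≡ x
    inv {x} refl = proj₂ (P x)
    a≡ : toℕ (inject₁ i) ≡ toℕ i
    a≡ = toℕ-inject₁ i
    column≤ : toℕ (column (f (cup i))) ≤ toℕ i
    column≤ = subst (toℕ (column (f (cup i))) ≤_) a≡ (≮⇒≥ left)
    column-cong : ∀ {x p : Pt n} → x ≡ p → toℕ (column p) ≡ toℕ (column x)
    column-cong refl = refl

  -- By `left` and `right` the partner of `cup i` is not to the right of it, and that of `cup⁺ i` is
  -- not to the left. Joining the partners to each other leaves top dots among them tails or not as
  -- before, and only the two cups change.
  act-tails : ∀ k → IsTail g k ⇔ ((IsTail f k × k ≢ suc i) ⊎ k ≡ inject₁ i)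
  act-tails k with place (cup i) (cup⁺ i) f (inj₁ k)
  ... | dot-s refl = mk⇔ (λ _ → inj₂ refl) (λ _ → subst (toℕ k <_) (column-cong at-s) (s≤s (≤-reflexive a≡)))
  ... | dot-t refl = mk⇔
          (λ tail → ⊥-elim (<⇒≱ tail (subst (_≤ suc (toℕ i)) (trans (sym a≡) (column-cong at-t)) (n≤1+n _))))
          (λ { (inj₁ (_ , c)) → ⊥-elim (c refl) ; (inj₂ e) → ⊥-elim (cup≢cup⁺ i (cong inj₁ (sym e))) })
  ... | mate-s k≢s k≢t e = mk⇔ (λ _ → inj₁ (tail , k≢t ∘ cong inj₁))
          (λ _ → subst (toℕ k <_) (sym (column-cong (sym (to-s k≢t e)))) (≤-trans (s≤s k≤i) right))
    where
    k≤i : toℕ k ≤ toℕ i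
    k≤i = subst (_≤ toℕ i) (column-cong (sym (inv e))) column≤
    tail : IsTail f k
    tail = subst (toℕ k <_) (trans (sym a≡) (column-cong e)) (≤∧≢⇒< k≤i (k≢s ∘ cong inj₁ ∘ toℕ-injective ∘ λ c → trans c (sym a≡)))
  ... | mate-t k≢s k≢t e = mk⇔
          (λ tail → ⊥-elim (<⇒≱ tail (≤-trans (subst (_≤ toℕ i) (column-cong (to-t k≢s e)) column≤) (<⇒≤ i<k))))
          (λ { (inj₁ (tail , _)) → ⊥-elim (<⇒≱ tail (subst (_≤ toℕ k) (column-cong e) i<k)) ; (inj₂ c) → ⊥-elim (k≢s (cong inj₁ c)) })
    where
    i<k : toℕ i < toℕ k
    i<k = subst (suc (toℕ i) ≤_) (column-cong (sym (inv e))) right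
  ... | apart k≢s k≢t c d = mk⇔ (λ tail → inj₁ (subst (toℕ k <_) (sym (column-cong (off k≢s k≢t c d))) tail , k≢t ∘ cong inj₁))
          (λ { (inj₁ (tail , _)) → subst (toℕ k <_) (column-cong (off k≢s k≢t c d)) tail ; (inj₂ e) → ⊥-elim (k≢s (cong inj₁ e)) })

  -- A bottom dot joined to `cup⁺ i` receives a partner in a column at most `toℕ i`. It becomes a
  -- head even if its arrow was vertical, and this is how an interval contributes its right end.
  act-heads : ∀ b → IsHead g b ⇔ (IsHead f b ⊎ f (cup⁺ i) ≡ inj₂ b)
  act-heads b with place (cup i) (cup⁺ i) f (inj₂ b)
  ... | mate-s _ _ e = mk⇔
          (λ head → ⊥-elim (<⇒≱ (subst (_< toℕ b) (column-cong (sym (to-s (λ ()) e))) head) (≤-trans b≤i (≤-trans (n≤1+n _) right))))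
          (λ { (inj₁ head) → ⊥-elim (<⇒≱ (subst (_< toℕ b) (trans (sym (column-cong e)) a≡) head) b≤i)
             ; (inj₂ c) → ⊥-elim (s≢t (trans (sym e) (inv c))) })
    where
    b≤i : toℕ b ≤ toℕ i
    b≤i = subst (_≤ toℕ i) (column-cong (sym (inv e))) column≤
  ... | mate-t _ _ e = mk⇔ (λ _ → inj₂ (inv e))
          (λ _ → subst (_< toℕ b) (column-cong (to-t (λ ()) e)) (≤-trans (s≤s column≤) (subst (suc (toℕ i) ≤_) (column-cong (sym (inv e))) right)))
  ... | apart b≢s b≢t c d = mk⇔ (λ head → inj₁ (subst (_< toℕ b) (sym (column-cong (off b≢s b≢t c d))) head))
          (λ { (inj₁ head) → subst (_< toℕ b) (column-cong (off b≢s b≢t c d)) head ; (inj₂ e) → ⊥-elim (d (inv e)) })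

  act-left : f (cup i) ≢ cup⁺ i
  act-left e = <⇒≱ (s≤s column≤) (≤-reflexive (column-cong e))

  act-arch : ∀ {i'} → suc (toℕ i') ≡ suc (toℕ i) → g (cup i') ≡ cup⁺ i'
  act-arch e = subst (λ v → g (cup v) ≡ cup⁺ v) (sym (toℕ-injective (ℕₚ.suc-injective e))) at-s

  act-vertical : ∀ {k} → suc (toℕ i) < toℕ k → f (inj₁ k) ≡ inj₂ k → g (inj₁ k) ≡ inj₂ k
  act-vertical {k} i<k v = trans
    (off (λ e → <⇒≱ (<⇒≤ i<k) (≤-reflexive (trans (sym (column-cong e)) a≡)))
         (λ e → <-irrefl (column-cong e) i<k)
         (λ e → inj₁≢inj₂ f f e v) (λ e → inj₁≢inj₂ f f e v)) v

range-applyUpTo : ∀ i j → range i j ≡ List.applyUpTo (i +_) (suc j ∸ i)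
range-applyUpTo i j = Listₚ.map-upTo (i +_) (suc j ∸ i)

range-∷ : ∀ {i j} → i ≤ j → range i j ≡ i ∷ range (suc i) j
range-∷ {i} {j} i≤j = trans (range-applyUpTo i j) (trans (cong (List.applyUpTo (i +_)) (ℕₚ.+-∸-assoc 1 i≤j))
  (cong₂ _∷_ (ℕₚ.+-identityʳ i) (trans (applyUpTo-cong (ℕₚ.+-suc i) (j ∸ i)) (sym (range-applyUpTo (suc i) j)))))
  where
  applyUpTo-cong : ∀ {f g : ℕ → ℕ} → (∀ x → f x ≡ g x) → ∀ k → List.applyUpTo f k ≡ List.applyUpTo g k
  applyUpTo-cong e zero = refl
  applyUpTo-cong e (suc k) = cong₂ _∷_ (e 0) (applyUpTo-cong (e ∘ suc) k)

range-[] : ∀ j → range (suc j) j ≡ []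
range-[] j = trans (range-applyUpTo (suc j) j) (cong (List.applyUpTo (suc j +_)) (ℕₚ.n∸n≡0 j))

_≻_ : ℕ × ℕ → ℕ × ℕ → Set
p ≻ q = proj₁ q < proj₁ p × proj₂ q < proj₂ p

≻-bound : ∀ {p ws} → All (p ≻_) ws → (∀ {i} → i ∈ map proj₁ ws → i < proj₁ p) × (∀ {j} → j ∈ map proj₂ ws → j < proj₂ p)
≻-bound [] = (λ ()) , (λ ())
≻-bound (r ∷ rs) = (λ { (here refl) → proj₁ r ; (there i∈) → proj₁ (≻-bound rs) i∈ })
                 , (λ { (here refl) → proj₂ r ; (there j∈) → proj₂ (≻-bound rs) j∈ })

module _ {n : ℕ} where

  label : Fin n → ℕ
  label i = suc (toℕ i)

  label-surjective : ∀ {m} → 1 ≤ m → m ≤ n → ∃ λ i → label i ≡ m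
  label-surjective (s≤s z≤n) m≤n = fromℕ< m≤n , cong suc (Finₚ.toℕ-fromℕ< m≤n)

  toLetter-label : ∀ i → toLetter n (label i) ≡ just i
  toLetter-label i with toℕ i ℕ.<? n
  ... | yes p = cong just (Finₚ.fromℕ<-toℕ i p)
  ... | no c = ⊥-elim (c (Finₚ.toℕ<n i))

  mapMaybe-label : ∀ u → mapMaybe (toLetter n) (map label u) ≡ u
  mapMaybe-label [] = refl
  mapMaybe-label (i ∷ u) rewrite toLetter-label i = cong (i ∷_) (mapMaybe-label u)

  acts-++ : ∀ u v (D : Diag n) → acts (u ++ v) D ≡ acts u (acts v D)
  acts-++ u v D = Listₚ.foldr-++ act D u v

  loops-++ : ∀ u v (D : Diag n) → loops (u ++ v) D ≡ loops u (acts v D) + loops v D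
  loops-++ [] v D = refl
  loops-++ (i ∷ u) v D = trans (cong₂ _+_ (cong (closes i) (acts-++ u v D)) (loops-++ u v D)) (sym (ℕₚ.+-assoc (closes i (acts u (acts v D))) _ _))

  prodE-acts : ∀ u → prodE {n} (map label u) ≡ acts u idDiag
  prodE-acts [] = refl
  prodE-acts (i ∷ u) = trans (cong (λ D → foldl (λ D b → D ∗ E b) D (map label u)) (E-act i)) (go (i ∷ []) u)
    where
    go : ∀ v u → foldl (λ D b → D ∗ E b) (acts v idDiag) (map label u) ≡ acts (v ++ u) idDiag
    go v [] = cong (λ w → acts w idDiag) (sym (Listₚ.++-identityʳ v))
    go v (j ∷ u) = trans (cong (λ D → foldl (λ D b → D ∗ E b) D (map label u)) step)
      (trans (go (v ++ j ∷ []) u) (cong (λ w → acts w idDiag) (Listₚ.++-assoc v (j ∷ []) u)))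
      where
      step : acts v idDiag ∗ E (label j) ≡ acts (v ++ j ∷ []) idDiag
      step = trans (cong (acts v idDiag ∗_) (E-act j)) (trans (acts-∗ v (act j idDiag) (act-pairing j id-pairing)) (sym (acts-++ v (j ∷ []) idDiag)))

  -- Acting by [m, j] on a diagram whose tails lie left of m and which is
  -- vertical from dot j + 1 on.
  record Block (D₀ D : Diag n) (m j : ℕ) : Set where
    field
      tails : ∀ k → IsTail (match D) k ⇔ (IsTail (match D₀) k ⊎ suc (toℕ k) ≡ m)
      heads : ∀ b → IsHead (match D) b ⇔ (IsHead (match D₀) b ⊎ toℕ b ≡ j)
      arch : ∀ i → label i ≡ m → match D (cup i) ≡ cup⁺ i
      vertical : ∀ k → j < toℕ k → match D (inj₁ k) ≡ inj₂ k

  act-block : ∀ {D₀ D j} i → Pairing (match D) → (left : ¬ IsTail (match D) (inject₁ i))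
    (right : suc (toℕ i) ≤ toℕ (column (match D (cup⁺ i)))) →
    (∀ k → (IsTail (match D) k × k ≢ suc i) ⇔ IsTail (match D₀) k) →
    (∀ b → (IsHead (match D) b ⊎ match D (cup⁺ i) ≡ inj₂ b) ⇔ (IsHead (match D₀) b ⊎ toℕ b ≡ j)) →
    label i ≤ j → (∀ k → j < toℕ k → match D (inj₁ k) ≡ inj₂ k) → Block D₀ (act i D) (label i) j
  act-block {D = D} i P left right T H i≤j vertical = record
    { tails = λ k → mk⇔
        (λ t → case to⇔ (act-tails i P S left right k) t of λ
          { (inj₁ x) → inj₁ (to⇔ (T k) x) ; (inj₂ refl) → inj₂ (cong suc ι) })
        (λ { (inj₁ t₀) → from⇔ (act-tails i P S left right k) (inj₁ (from⇔ (T k) t₀))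
           ; (inj₂ e) → from⇔ (act-tails i P S left right k)
               (inj₂ (toℕ-injective (trans (ℕₚ.suc-injective e) (sym ι)))) })
    ; heads = λ b → mk⇔
        (to⇔ (H b) ∘ to⇔ (act-heads i P S left right b))
        (from⇔ (act-heads i P S left right b) ∘ from⇔ (H b))
    ; arch = λ i' → act-arch i P S left right {i'}
    ; vertical = λ k j<k → act-vertical i P S left right (≤-<-trans i≤j j<k) (vertical k j<k) }
    where
    S : Surgery (cup i) (cup⁺ i) (match D) (match (act i D))
    S = act-Surgery i P
    ι : toℕ (inject₁ i) ≡ toℕ i
    ι = toℕ-inject₁ i

  module _ {D₀ : Diag n} (P₀ : Pairing (match D₀)) {i₁ j : ℕ} (1≤i₁ : 1 ≤ i₁) (j≤n : j ≤ n)
           (tails₀ : ∀ {k} → IsTail (match D₀) k → suc (toℕ k) < i₁)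
           (vertical₀ : ∀ k → j ≤ toℕ k → match D₀ (inj₁ k) ≡ inj₂ k) where

    -- The letter `j` acts first and meets the vertical arrow at dot `j + 1`, which makes `j` an
    -- element of J. Each further letter `m` meets the arch at the dots `m + 1` and `m + 2` left by
    -- its predecessor, and shifts the new tail from `m + 1` to `m`.
    block : ∀ d {m} → m + d ≡ j → i₁ ≤ m → ∃ λ u → map label u ≡ range m j × loops u D₀ ≡ 0 × Block D₀ (acts u D₀) m j
    block zero {m} m+0≡j i₁≤m with trans (sym (ℕₚ.+-identityʳ m)) m+0≡j
    ... | refl with label-surjective (≤-trans 1≤i₁ i₁≤m) j≤n
    ...   | i , refl = i ∷ [] , sym (trans (range-∷ {m} ≤-refl) (cong (m ∷_) (range-[] m))) ,
              cong (_+ 0) (closes-no i {D₀} (act-left i P₀ (act-Surgery i P₀) left right)) ,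
              act-block i P₀ left right
                (λ k → mk⇔ proj₁ (λ t₀ → t₀ , λ { refl → <⇒≱ (<-trans (n<1+n _) (tails₀ t₀)) i₁≤m }))
                (λ b → mk⇔
                  (λ { (inj₁ h₀) → inj₁ h₀ ; (inj₂ e) → inj₂ (cong toℕ (inj₂-injective (trans (sym e) t-vertical))) })
                  (λ { (inj₁ h₀) → inj₁ h₀ ; (inj₂ e) → inj₂ (trans t-vertical (cong inj₂ (toℕ-injective (sym e)))) }))
                ≤-refl (λ k i<k → vertical₀ k (<⇒≤ i<k))
      where
      t-vertical : match D₀ (cup⁺ i) ≡ inj₂ (suc i)
      t-vertical = vertical₀ (suc i) ≤-refl
      left : ¬ IsTail (match D₀) (inject₁ i)
      left t = <⇒≱ (tails₀ t) (subst (i₁ ≤_) (cong suc (sym (toℕ-inject₁ i))) i₁≤m)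
      right : suc (toℕ i) ≤ toℕ (column (match D₀ (cup⁺ i)))
      right = ≤-reflexive (cong (toℕ ∘ column) (sym t-vertical))
    block (suc d) {m} m+d≡j i₁≤m with block d (trans (sym (ℕₚ.+-suc m d)) m+d≡j) (m≤n⇒m≤1+n i₁≤m)
                                    | label-surjective (≤-trans 1≤i₁ i₁≤m) (≤-trans (ℕₚ.m+n≤o⇒m≤o m (≤-reflexive m+d≡j)) j≤n)
    ... | u , u-range , no-loops , B | i , refl with m<n
      where
      m<n : m < n
      m<n = ≤-trans (ℕₚ.m+n≤o⇒m≤o (suc m) (≤-reflexive (trans (sym (ℕₚ.+-suc m d)) m+d≡j))) j≤n
    ...   | m<n with label-surjective (s≤s z≤n) m<n
    ...     | i⁺ , i⁺≡ = i ∷ u ,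
              trans (cong (m ∷_) u-range) (sym (range-∷ (ℕₚ.m+n≤o⇒m≤o m (≤-reflexive m+d≡j)))) ,
              cong₂ _+_ (closes-no i {D} (act-left i P (act-Surgery i P) left right)) no-loops ,
              act-block i P left right
                (λ k → mk⇔
                  (λ { (t , k≢) → case to⇔ (Block.tails B k) t of λ
                       { (inj₁ t₀) → t₀ ; (inj₂ e) → ⊥-elim (k≢ (toℕ-injective (ℕₚ.suc-injective e))) } })
                  (λ t₀ → from⇔ (Block.tails B k) (inj₁ t₀) , λ { refl → <⇒≱ (<-trans (n<1+n _) (tails₀ t₀)) i₁≤m }))
                (λ b → mk⇔
                  (λ { (inj₁ h) → to⇔ (Block.heads B b) h ; (inj₂ e) → ⊥-elim (inj₁≢inj₂ flip flip t-arch e) })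
                  (inj₁ ∘ from⇔ (Block.heads B b)))
                (ℕₚ.m+n≤o⇒m≤o m (≤-reflexive m+d≡j)) (Block.vertical B)
      where
      D : Diag n
      D = acts u D₀
      P : Pairing (match D)
      P = acts-pairing u P₀
      t-arch : match D (cup⁺ i) ≡ cup⁺ i⁺
      t-arch = trans (cong (match D ∘ inj₁) (toℕ-injective (sym (trans (toℕ-inject₁ i⁺) (ℕₚ.suc-injective i⁺≡))))) (Block.arch B i⁺ i⁺≡)
      left : ¬ IsTail (match D) (inject₁ i)
      left t with to⇔ (Block.tails B (inject₁ i)) t
      ... | inj₁ t₀ = <⇒≱ (tails₀ t₀) (subst (i₁ ≤_) (cong suc (sym (toℕ-inject₁ i))) i₁≤m)
      ... | inj₂ e = 1+n≢n (sym (trans (sym (toℕ-inject₁ i)) (ℕₚ.suc-injective e)))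
      right : suc (toℕ i) ≤ toℕ (column (match D (cup⁺ i)))
      right = subst (λ p → suc (toℕ i) ≤ toℕ (column p)) (sym t-arch) (≤-trans (n≤1+n _) (≤-reflexive (sym i⁺≡)))

  -- `reduced` says that no circle arises, so that the image of the monomial carries no power of δ.
  -- `vertical` is what the next interval to the left requires.
  record Spells (ws : List (ℕ × ℕ)) (u : List (Fin n)) : Set where
    field
      spelling : map label u ≡ cword ws
      reduced : loops u idDiag ≡ 0
      tails : ∀ k → IsTail (match (acts u idDiag)) k ⇔ (suc (toℕ k) ∈ map proj₁ ws)
      heads : ∀ b → IsHead (match (acts u idDiag)) b ⇔ (toℕ b ∈ map proj₂ ws)
      vertical : ∀ k → (∀ {j} → j ∈ map proj₂ ws → j < toℕ k) → match (acts u idDiag) (inj₁ k) ≡ inj₂ k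

  -- The last interval acts first. By the inequalities each new interval starts to the right of all
  -- tails present and ends to the right of all heads present, as `block` demands.
  spell : ∀ {ws} → All (λ p → 1 ≤ proj₁ p × proj₁ p ≤ proj₂ p × proj₂ p ≤ n) ws → AllPairs _≻_ ws → ∃ (Spells ws)
  spell [] [] = [] , record
    { spelling = refl ; reduced = refl
    ; tails = λ k → mk⇔ (λ t → ⊥-elim (<-irrefl (cong (toℕ ∘ column) (sym (match-id (inj₁ k)))) t)) (λ ())
    ; heads = λ b → mk⇔ (λ t → ⊥-elim (<-irrefl (cong (toℕ ∘ column) (match-id (inj₂ b))) t)) (λ ())
    ; vertical = λ k _ → match-id (inj₁ k) }
  spell {(i , j) ∷ ws} ((1≤i , i≤j , j≤n) ∷ bounds) (top ∷ pairs) with spell bounds pairs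
  ... | v , V with block (acts-pairing v id-pairing) 1≤i j≤n (proj₁ (≻-bound top) ∘ to⇔ (Spells.tails V _))
                     (λ k j≤k → Spells.vertical V k λ j'∈ → <-≤-trans (proj₂ (≻-bound top) j'∈) j≤k)
                     (j ∸ i) (ℕₚ.m+[n∸m]≡n i≤j) ≤-refl
  ...   | u , u-range , u-loops , B rewrite sym (acts-++ u v idDiag) = u ++ v , record
    { spelling = trans (Listₚ.map-++ label u v) (cong₂ _++_ u-range (Spells.spelling V))
    ; reduced = trans (loops-++ u v idDiag) (cong₂ _+_ u-loops (Spells.reduced V))
    ; tails = λ k → mk⇔
        (λ t → case to⇔ (Block.tails B k) t of λ
          { (inj₁ t₀) → there (to⇔ (Spells.tails V k) t₀) ; (inj₂ e) → here e })
        (λ { (here e) → from⇔ (Block.tails B k) (inj₂ e)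
           ; (there k∈) → from⇔ (Block.tails B k) (inj₁ (from⇔ (Spells.tails V k) k∈)) })
    ; heads = λ b → mk⇔
        (λ t → case to⇔ (Block.heads B b) t of λ
          { (inj₁ t₀) → there (to⇔ (Spells.heads V b) t₀) ; (inj₂ e) → here e })
        (λ { (here e) → from⇔ (Block.heads B b) (inj₂ e)
           ; (there b∈) → from⇔ (Block.heads B b) (inj₁ (from⇔ (Spells.heads V b) b∈)) })
    ; vertical = λ k bound → Block.vertical B k (bound (here refl)) }

  canonical-spell : ∀ {ws} → Canonical n ws → ∃ (Spells ws)
  canonical-spell (bounds , linked) = spell bounds (Linked⇒AllPairs (λ (a , b) (c , d) → <-trans c a , <-trans d b) linked)

  𝒟-acts : ∀ {ws u} → Spells ws u → 𝒟 n ws ≡ acts u idDiag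
  𝒟-acts {ws} {u} V = trans (cong prodE (sym (Spells.spelling V))) (prodE-acts u)

-- Every planar pairing comes from a canonical form

module _ (P : ℕ → Bool) where

  downFrom : ℕ → List ℕ
  downFrom zero = []
  downFrom (suc m) = if P (suc m) then suc m ∷ downFrom m else downFrom m

  downFrom-complete : ∀ m {k} → 1 ≤ k → k ≤ m → P k ≡ true → k ∈ downFrom m
  downFrom-complete zero 1≤k k≤0 _ = ⊥-elim (<⇒≱ 1≤k k≤0)
  downFrom-complete (suc m) {k} 1≤k k≤m Pk with P (suc m) in e | ℕₚ.m≤n⇒m<n∨m≡n k≤m
  ... | true | inj₁ (s≤s k≤m′) = there (downFrom-complete m 1≤k k≤m′ Pk)
  ... | true | inj₂ refl = here refl
  ... | false | inj₁ (s≤s k≤m′) = downFrom-complete m 1≤k k≤m′ Pk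
  ... | false | inj₂ refl = case trans (sym Pk) e of λ ()

  downFrom-sound : ∀ m {k} → k ∈ downFrom m → 1 ≤ k × k ≤ m × P k ≡ true
  downFrom-sound (suc m) k∈ with P (suc m) in e
  downFrom-sound (suc m) (here refl) | true = s≤s z≤n , ≤-refl , e
  downFrom-sound (suc m) (there k∈) | true with downFrom-sound m k∈
  ... | a , b , c = a , m≤n⇒m≤1+n b , c
  downFrom-sound (suc m) k∈ | false with downFrom-sound m k∈
  ... | a , b , c = a , m≤n⇒m≤1+n b , c

  downFrom-decreasing : ∀ m → AllPairs (λ x y → y < x) (downFrom m)
  downFrom-decreasing zero = []
  downFrom-decreasing (suc m) with P (suc m)
  ... | true = All.tabulate (λ k∈ → s≤s (proj₁ (proj₂ (downFrom-sound m k∈)))) ∷ downFrom-decreasing m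
  ... | false = downFrom-decreasing m

module _ (P Q : ℕ → Bool) where

  private
    #P #Q : ℕ → ℕ
    #P m = length (downFrom P m)
    #Q m = length (downFrom Q m)

  Pairs : ℕ → List ℕ → List (ℕ × ℕ) → Set
  Pairs m pending ws = map proj₁ ws ≡ downFrom P m × map proj₂ ws ≡ pending ++ downFrom Q m × All (λ p → proj₁ p ≤ proj₂ p) ws

  private
    enqueue : ∀ (x : ℕ) pending {k l} → length pending + suc k ≡ l → length (pending ++ x ∷ []) + k ≡ l
    enqueue x pending {k} e = trans (cong (_+ k) (Listₚ.length-++ pending)) (trans (ℕₚ.+-assoc (length pending) 1 k) e)

  -- Going down, each k with Q k joins a queue, from which each k with P k
  -- takes its partner; #Q ≤ #P below keeps the queue from running dry.
  pair-up : ∀ m pending → All (m <_) pending → length pending + #Q m ≡ #P m → (∀ {k} → k < m → #Q k ≤ #P k) → ∃ (Pairs m pending)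
  pair-up zero [] _ _ _ = [] , refl , refl , []
  pair-up (suc m) pending m<pending e le with P (suc m) | Q (suc m)
  ... | false | false with pair-up m pending (All.map <⇒≤ m<pending) e (λ k<m → le (m≤n⇒m≤1+n k<m))
  ...   | ws , a , b , c = ws , a , b , c
  pair-up (suc m) pending m<pending e le | false | true
    with pair-up m (pending ++ suc m ∷ []) (++⁺ (All.map <⇒≤ m<pending) (n<1+n m ∷ [])) (enqueue (suc m) pending e) (λ k<m → le (m≤n⇒m≤1+n k<m))
  ...   | ws , a , b , c = ws , a , trans b (Listₚ.++-assoc pending (suc m ∷ []) _) , c
  pair-up (suc m) [] _ e le | true | false = ⊥-elim (<⇒≱ (≤-reflexive (sym e)) (le (n<1+n m)))
  pair-up (suc m) (j ∷ pending) (m<j ∷ m<pending) e le | true | false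
    with pair-up m pending (All.map <⇒≤ m<pending) (ℕₚ.suc-injective e) (λ k<m → le (m≤n⇒m≤1+n k<m))
  ...   | ws , a , b , c = (suc m , j) ∷ ws , cong (suc m ∷_) a , cong (j ∷_) b , <⇒≤ m<j ∷ c
  pair-up (suc m) [] _ e le | true | true
    with pair-up m [] [] (ℕₚ.suc-injective e) (λ k<m → le (m≤n⇒m≤1+n k<m))
  ...   | ws , a , b , c = (suc m , suc m) ∷ ws , cong (suc m ∷_) a , cong (suc m ∷_) b , ≤-refl ∷ c
  pair-up (suc m) (j ∷ pending) (m<j ∷ m<pending) e le | true | true
    with pair-up m (pending ++ suc m ∷ []) (++⁺ (All.map <⇒≤ m<pending) (n<1+n m ∷ [])) (enqueue (suc m) pending (ℕₚ.suc-injective e)) (λ k<m → le (m≤n⇒m≤1+n k<m))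
  ...   | ws , a , b , c = (suc m , j) ∷ ws , cong (suc m ∷_) a , cong (j ∷_) (trans b (Listₚ.++-assoc pending (suc m ∷ []) _)) , <⇒≤ m<j ∷ c

  canonical-from : ∀ n → #Q n ≡ #P n → (∀ {k} → k < n → #Q k ≤ #P k) →
    ∃ λ ws → Canonical n ws × map proj₁ ws ≡ downFrom P n × map proj₂ ws ≡ downFrom Q n
  canonical-from n e le with pair-up n [] [] e le
  ... | ws , a , b , c = ws , (bounds , AllPairs⇒Linked (zip (subst (AllPairs _) (sym a) (downFrom-decreasing P n)) (subst (AllPairs _) (sym b) (downFrom-decreasing Q n)))) , a , b
    where
    bounds : All (λ p → 1 ≤ proj₁ p × proj₁ p ≤ proj₂ p × proj₂ p ≤ n) ws
    bounds = All.tabulate λ p∈ →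
      proj₁ (downFrom-sound P n (subst (_ ∈_) a (∈ₚ.∈-map⁺ proj₁ p∈))) , All.lookup c p∈ ,
      proj₁ (proj₂ (downFrom-sound Q n (subst (_ ∈_) b (∈ₚ.∈-map⁺ proj₂ p∈))))
    zip : ∀ {ws} → AllPairs (λ x y → y < x) (map proj₁ ws) → AllPairs (λ x y → y < x) (map proj₂ ws) → AllPairs _≻_ ws
    zip {[]} _ _ = []
    zip {w ∷ ws} (p ∷ ps) (q ∷ qs) = All.tabulate (λ v∈ → All.lookup p (∈ₚ.∈-map⁺ proj₁ v∈) , All.lookup q (∈ₚ.∈-map⁺ proj₂ v∈)) ∷ zip ps qs

-- x, y, z: the numbers of open strands before, between and after two dots.
module _ (x y z p q : ℕ) where

  private
    +-suc² : z + (suc q + suc q) ≡ suc (suc (z + (q + q)))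
    +-suc² = trans (cong (λ v → z + suc v) (ℕₚ.+-suc q q)) (trans (ℕₚ.+-suc z _) (cong suc (ℕₚ.+-suc z _)))
    suc-+-suc : suc (suc (p + p)) ≡ suc p + suc p
    suc-+-suc = cong suc (sym (ℕₚ.+-suc p p))

  tail-head : y ≡ suc x → y ≡ suc z → x + (q + q) ≡ suc (p + p) → z + (suc q + suc q) ≡ suc (suc p + suc p)
  tail-head refl refl e = trans +-suc² (trans (cong (2 +_) e) (cong suc suc-+-suc))

  tail-only : y ≡ suc x → z ≡ suc y → x + (q + q) ≡ suc (p + p) → z + (q + q) ≡ suc (suc p + suc p)
  tail-only refl refl e = trans (cong (2 +_) e) (cong suc suc-+-suc)

  head-only : x ≡ suc y → y ≡ suc z → x + (q + q) ≡ suc (p + p) → z + (suc q + suc q) ≡ suc (p + p)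
  head-only refl refl e = trans +-suc² e

  neither : x ≡ suc y → z ≡ suc y → x + (q + q) ≡ suc (p + p) → z + (q + q) ≡ suc (p + p)
  neither refl refl e = e

-- Counting the open arrows of the sweep

module _ {n : ℕ} where

  total : (Pt n → ℕ) → ℕ
  total h = sum (List.tabulate (h ∘ inj₁)) + sum (List.tabulate (h ∘ inj₂))

  total-suc : ∀ {h h' : Pt n → ℕ} q → h' q ≡ suc (h q) → (∀ p → p ≢ q → h' p ≡ h p) → total h' ≡ suc (total h)
  total-suc (inj₁ k) e same = cong₂ _+_ (sum-tabulate-suc k e (λ j j≢k → same _ (j≢k ∘ inj₁-injective))) (sum-tabulate-cong (λ j → same (inj₂ j) λ ()))
  total-suc {h} (inj₂ k) e same = trans
    (cong₂ _+_ (sum-tabulate-cong (λ j → same (inj₁ j) λ ())) (sum-tabulate-suc k e (λ j j≢k → same _ (j≢k ∘ inj₂-injective))))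
    (ℕₚ.+-suc (sum (List.tabulate (h ∘ inj₁))) _)

  total-zero : ∀ {h : Pt n → ℕ} → (∀ p → h p ≡ 0) → total h ≡ 0
  total-zero e = cong₂ _+_ (zeros _ (e ∘ inj₁)) (zeros _ (e ∘ inj₂))
    where
    zeros : ∀ N {g : Fin N → ℕ} → (∀ k → g k ≡ 0) → sum (List.tabulate g) ≡ 0
    zeros zero e = refl
    zeros (suc N) e = cong₂ _+_ (e zero) (zeros N (e ∘ suc))

  module _ {f : Pt n → Pt n} (F : Pairing f) where

    private
      inv : ∀ {x y} → f x ≡ y → f y ≡ x
      inv {x} refl = proj₂ (F x)

    -- An arrow open at time `τ` is registered at its opening dot only, so `cut` counts it once.
    isOpen : ℕ → Pt n → Bool
    isOpen τ q = (time q ℕ.<ᵇ τ) ∧ not (time (f q) ℕ.<ᵇ τ)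

    cut : ℕ → ℕ
    cut τ = total (indicator ∘ isOpen τ)

    private
      ∧-falseˡ : ∀ {a b} → a ≡ false → a ∧ b ≡ false
      ∧-falseˡ refl = refl

      <ᵇ-suc : ∀ {a τ} → a ≢ τ → (a ℕ.<ᵇ suc τ) ≡ (a ℕ.<ᵇ τ)
      <ᵇ-suc {a} {τ} a≢τ = bool-ext
        (λ e → <⇒<ᵇ-true (≤∧≢⇒< (≤-pred (<ᵇ-true⇒< {a} {suc τ} e)) a≢τ))
        (λ e → <⇒<ᵇ-true (m≤n⇒m≤1+n (<ᵇ-true⇒< {a} {τ} e)))

      isOpen-same : ∀ {τ q} → time q ≢ τ → time (f q) ≢ τ → isOpen (suc τ) q ≡ isOpen τ q
      isOpen-same a b = cong₂ (λ u v → u ∧ not v) (<ᵇ-suc a) (<ᵇ-suc b)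

    cut-opener : ∀ p → ¬ Closes f p → cut (suc (time p)) ≡ suc (cut (time p))
    cut-opener p ¬c = total-suc p (trans (cong indicator at-p′) (cong (suc ∘ indicator) (sym at-p))) elsewhere
      where
      τ : ℕ
      τ = time p
      τ<fp : τ < time (f p)
      τ<fp = ≤∧≢⇒< (≮⇒≥ ¬c) (proj₁ (F p) ∘ time-injective ∘ sym)
      at-p : isOpen τ p ≡ false
      at-p = ∧-falseˡ (≤⇒<ᵇ-false (≤-refl {τ}))
      at-p′ : isOpen (suc τ) p ≡ true
      at-p′ = cong₂ (λ u v → u ∧ not v) (<⇒<ᵇ-true (n<1+n τ)) (≤⇒<ᵇ-false τ<fp)
      elsewhere : ∀ q → q ≢ p → indicator (isOpen (suc τ) q) ≡ indicator (isOpen τ q)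
      elsewhere q q≢p with f q ≟ᴾ p
      ... | no fq≢p = cong indicator (isOpen-same (q≢p ∘ time-injective) (fq≢p ∘ time-injective))
      ... | yes fq≡p = cong indicator (trans (∧-falseˡ (≤⇒<ᵇ-false τ<q)) (sym (∧-falseˡ (≤⇒<ᵇ-false (<⇒≤ τ<q)))))
        where
        τ<q : τ < time q
        τ<q = subst (λ v → τ < time v) (inv fq≡p) τ<fp

    cut-closer : ∀ p → Closes f p → cut (time p) ≡ suc (cut (suc (time p)))
    cut-closer p c = total-suc (f p) (trans (cong indicator at-q) (cong (suc ∘ indicator) (sym at-q′))) elsewhere
      where
      τ : ℕ
      τ = time p
      ffp : time (f (f p)) ≡ τ
      ffp = cong time (proj₂ (F p))
      at-q : isOpen τ (f p) ≡ true
      at-q = cong₂ (λ u v → u ∧ not v) (<⇒<ᵇ-true c) (≤⇒<ᵇ-false (≤-reflexive (sym ffp)))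
      at-q′ : isOpen (suc τ) (f p) ≡ false
      at-q′ = cong₂ (λ u v → u ∧ not v) (<⇒<ᵇ-true (m≤n⇒m≤1+n c)) (<⇒<ᵇ-true (s≤s (≤-reflexive ffp)))
      elsewhere : ∀ q → q ≢ f p → indicator (isOpen τ q) ≡ indicator (isOpen (suc τ) q)
      elsewhere q q≢fp with q ≟ᴾ p
      ... | no q≢p = cong indicator (sym (isOpen-same (q≢p ∘ time-injective) (λ e → q≢fp (sym (inv (time-injective e))))))
      ... | yes refl = cong indicator (trans (∧-falseˡ (≤⇒<ᵇ-false (≤-refl {τ})))
              (sym (trans (cong (λ v → (τ ℕ.<ᵇ suc τ) ∧ not v) (<⇒<ᵇ-true (m≤n⇒m≤1+n c))) (∧-zeroʳ (τ ℕ.<ᵇ suc τ)))))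

    tailᵇ headᵇ : Fin (suc n) → Bool
    tailᵇ k = toℕ k ℕ.<ᵇ toℕ (column (f (inj₁ k)))
    headᵇ k = toℕ (column (f (inj₂ k))) ℕ.<ᵇ toℕ k

    -- The labels of the paper: i for the top dot i, j for the bottom dot (j + 1)′.
    tailLabel headLabel : ℕ → Bool
    tailLabel zero = false
    tailLabel (suc k) = tailᵇ (clampFin k)
    headLabel k = headᵇ (clampFin k)

    private
      #P #Q : ℕ → ℕ
      #P m = length (downFrom tailLabel m)
      #Q m = length (downFrom headLabel m)

      clamp : ∀ {k} → k ≤ n → toℕ (clampFin {n} k) ≡ k
      clamp {k} k≤n with k ℕ.<? suc n
      ... | yes p = Finₚ.toℕ-fromℕ< p
      ... | no c = ⊥-elim (c (s≤s k≤n))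

      Bottom Top : ℕ → Set
      Bottom k = (headLabel k ≡ true × cut (k + k) ≡ suc (cut (suc (k + k)))) ⊎ (headLabel k ≡ false × cut (suc (k + k)) ≡ suc (cut (k + k)))
      Top k = (tailLabel (suc k) ≡ true × cut (suc (suc (k + k))) ≡ suc (cut (suc (k + k))))
            ⊎ (tailLabel (suc k) ≡ false × cut (suc (k + k)) ≡ suc (cut (suc (suc (k + k)))))

      bottom : ∀ {k} → k ≤ n → Bottom k
      bottom {k} k≤n with headᵇ (clampFin k) in e
      ... | true = inj₁ (refl , subst (λ v → cut (v + v) ≡ suc (cut (suc (v + v)))) (clamp k≤n)
                     (cut-closer (inj₂ (clampFin k)) (IsHead⇒Closes-bot F (<ᵇ-true⇒< e))))
      ... | false = inj₂ (refl , subst (λ v → cut (suc (v + v)) ≡ suc (cut (v + v))) (clamp k≤n)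
                     (cut-opener (inj₂ (clampFin k)) (λ c → <⇒≱ (Closes-bot⇒IsHead F c) (<ᵇ-false⇒≤ e))))

      top : ∀ {k} → k ≤ n → Top k
      top {k} k≤n with tailᵇ (clampFin k) in e
      ... | true = inj₁ (refl , subst (λ v → cut (suc (suc (v + v))) ≡ suc (cut (suc (v + v)))) (clamp k≤n)
                     (cut-opener (inj₁ (clampFin k)) (λ c → Closes-top⇒¬IsTail F c (<ᵇ-true⇒< e))))
      ... | false = inj₂ (refl , subst (λ v → cut (suc (v + v)) ≡ suc (cut (suc (suc (v + v))))) (clamp k≤n)
                     (cut-closer (inj₁ (clampFin k)) (¬IsTail⇒Closes-top F (λ t → <⇒≱ t (<ᵇ-false⇒≤ e)))))

      cut-zero : cut 0 ≡ 0
      cut-zero = total-zero (λ p → refl)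

      -- From one column to the next the cut changes by 2, 0 or -2.
      balance : ∀ k → k ≤ n → cut (suc (k + k)) + (#Q k + #Q k) ≡ suc (#P k + #P k)
      balance zero _ with bottom {0} z≤n
      -- No arrow is open yet, so the first dot of the sweep cannot close one.
      ... | inj₁ (_ , c) = case trans (sym cut-zero) c of λ ()
      ... | inj₂ (_ , c) = cong (_+ 0) (trans c (cong suc cut-zero))
      balance (suc k) k<n with balance k (<⇒≤ k<n) | top {k} (<⇒≤ k<n) | bottom {suc k} k<n
      ... | ih | T | B rewrite ℕₚ.+-suc k k with T | B
      ... | inj₁ (t , c) | inj₁ (b , d) rewrite t | b = tail-head _ _ _ (#P k) (#Q k) c d ih
      ... | inj₁ (t , c) | inj₂ (b , d) rewrite t | b = tail-only _ _ _ (#P k) (#Q k) c d ih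
      ... | inj₂ (t , c) | inj₁ (b , d) rewrite t | b = head-only _ _ _ (#P k) (#Q k) c d ih
      ... | inj₂ (t , c) | inj₂ (b , d) rewrite t | b = neither _ _ _ (#P k) (#Q k) c d ih

      -- By `balance`, twice `#Q k` exceeds twice `#P k` by at most one, and parity removes the one.
      #Q≤#P : ∀ {k} → k ≤ n → #Q k ≤ #P k
      #Q≤#P {k} k≤n = ≮⇒≥ λ p<q → <⇒≱ (double-< p<q) (subst (#Q k + #Q k ≤_) (balance k k≤n) (ℕₚ.m≤n+m (#Q k + #Q k) (cut (suc (k + k)))))

      cut-end : cut (suc (suc (n + n))) ≡ 0
      cut-end = total-zero (λ p → cong indicator (trans (cong (λ v → (time p ℕ.<ᵇ suc (suc (n + n))) ∧ not v) (<⇒<ᵇ-true (time-bound (f p))))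
                                                        (∧-zeroʳ (time p ℕ.<ᵇ suc (suc (n + n))))))
        where
        time-bound : ∀ p → time p < suc (suc (n + n))
        time-bound (inj₁ k) = s≤s (s≤s (+-mono-≤ (bpos-top≤ k) (bpos-top≤ k)))
        time-bound (inj₂ k) = s≤s (m≤n⇒m≤1+n (+-mono-≤ (bpos-top≤ k) (bpos-top≤ k)))

      -- No arrow is open in the end, so the last top dot closes one and exactly one was open before
      -- it; `balance` at `n` is then an equality without slack.
      #Q≡#P : #Q n ≡ #P n
      #Q≡#P with top {n} ≤-refl
      ... | inj₁ (_ , c) = case trans (sym cut-end) c of λ ()
      ... | inj₂ (_ , c) = ≤-antisym (#Q≤#P ≤-refl) (double-≤⇒≤ (≤-reflexive (sym (ℕₚ.suc-injective
              (trans (cong (_+ (#Q n + #Q n)) (sym (trans c (cong suc cut-end)))) (balance n ≤-refl))))))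

    canonical-labels : ∃ λ ws → Canonical n ws
      × (∀ k → (∃ λ i → suc (toℕ i) ≡ k × IsTail f i) ⇔ k ∈ map proj₁ ws)
      × (∀ k → (∃ λ b → toℕ b ≡ k × IsHead f b) ⇔ k ∈ map proj₂ ws)
    canonical-labels with canonical-from tailLabel headLabel n #Q≡#P (#Q≤#P ∘ <⇒≤)
    ... | ws , canonical , a , b = ws , canonical , tails , heads
      where
      tails : ∀ k → (∃ λ i → suc (toℕ i) ≡ k × IsTail f i) ⇔ k ∈ map proj₁ ws
      tails k = mk⇔
        (λ { (i , refl , t) → subst (_ ∈_) (sym a) (downFrom-complete tailLabel n (s≤s z≤n) (≤-trans t (bpos-top≤ (column (f (inj₁ i)))))
               (trans (cong tailᵇ (clampFin-toℕ i)) (<⇒<ᵇ-true t))) })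
        (λ k∈ → from k (downFrom-sound tailLabel n (subst (_ ∈_) a k∈)))
        where
        from : ∀ k → 1 ≤ k × k ≤ n × tailLabel k ≡ true → ∃ λ i → suc (toℕ i) ≡ k × IsTail f i
        from (suc k) (_ , k<n , t) = clampFin k , cong suc (clamp (<⇒≤ k<n)) , <ᵇ-true⇒< t
      heads : ∀ k → (∃ λ b → toℕ b ≡ k × IsHead f b) ⇔ k ∈ map proj₂ ws
      heads k = mk⇔
        (λ { (c , refl , h) → subst (_ ∈_) (sym b) (downFrom-complete headLabel n (≤-trans (s≤s z≤n) h) (bpos-top≤ c)
               (trans (cong headᵇ (clampFin-toℕ c)) (<⇒<ᵇ-true h))) })
        (λ k∈ → from k (downFrom-sound headLabel n (subst (_ ∈_) b k∈)))
        where
        from : ∀ k → 1 ≤ k × k ≤ n × headLabel k ≡ true → ∃ λ b → toℕ b ≡ k × IsHead f b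
        from k (_ , k≤n , h) = clampFin k , clamp k≤n , <ᵇ-true⇒< h

-- The bijection

decreasing-unique : ∀ {xs ys : List ℕ} → AllPairs (λ x y → y < x) xs → AllPairs (λ x y → y < x) ys →
  (∀ {z} → z ∈ xs → z ∈ ys) → (∀ {z} → z ∈ ys → z ∈ xs) → xs ≡ ys
decreasing-unique {[]} {[]} _ _ _ _ = refl
decreasing-unique {[]} {y ∷ ys} _ _ _ from = case from (here refl) of λ ()
decreasing-unique {x ∷ xs} {[]} _ _ to _ = case to (here refl) of λ ()
decreasing-unique {x ∷ xs} {y ∷ ys} (x> ∷ ps) (y> ∷ qs) to from
  with ≤-antisym (bound y> (to (here refl))) (bound x> (from (here refl)))
  where
  bound : ∀ {a b l} → All (_< a) l → b ∈ (a ∷ l) → b ≤ a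
  bound _ (here refl) = ≤-refl
  bound h (there b∈) = <⇒≤ (All.lookup h b∈)
... | refl = cong (x ∷_) (decreasing-unique ps qs (restrict x> to) (restrict y> from))
  where
  restrict : ∀ {l l'} → All (_< x) l → (∀ {z} → z ∈ (x ∷ l) → z ∈ (x ∷ l')) → ∀ {z} → z ∈ l → z ∈ l'
  restrict h sub z∈ with sub (there z∈)
  ... | here refl = ⊥-elim (<-irrefl refl (All.lookup h z∈))
  ... | there z∈' = z∈'

map-proj-injective : ∀ {ws ws' : List (ℕ × ℕ)} → map proj₁ ws ≡ map proj₁ ws' → map proj₂ ws ≡ map proj₂ ws' → ws ≡ ws'
map-proj-injective {[]} {[]} _ _ = refl
map-proj-injective {(i , j) ∷ ws} {(i' , j') ∷ ws'} e e' =
  cong₂ _∷_ (cong₂ _,_ (Listₚ.∷-injectiveˡ e) (Listₚ.∷-injectiveˡ e'))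
    (map-proj-injective (Listₚ.∷-injectiveʳ e) (Listₚ.∷-injectiveʳ e'))

canonical-decreasing : ∀ {n ws} → Canonical n ws → AllPairs (λ x y → y < x) (map proj₁ ws) × AllPairs (λ x y → y < x) (map proj₂ ws)
canonical-decreasing (_ , linked) = go (Linked⇒AllPairs (λ (a , b) (c , d) → <-trans c a , <-trans d b) linked)
  where
  go : ∀ {ws} → AllPairs _≻_ ws → AllPairs (λ x y → y < x) (map proj₁ ws) × AllPairs (λ x y → y < x) (map proj₂ ws)
  go [] = [] , []
  go (p ∷ ps) = All.tabulate (proj₁ (≻-bound p)) ∷ proj₁ (go ps) , All.tabulate (proj₂ (≻-bound p)) ∷ proj₂ (go ps)

module _ {n : ℕ} where

  InI⇔tail : ∀ {D : Diag n} k → InI D k ⇔ (∃ λ i → suc (toℕ i) ≡ k × IsTail (match D) i)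
  InI⇔tail {D} k = mk⇔ (λ { (i , refl , x) → i , refl , InI⇒IsTail {D = D} (i , refl , x) }) (λ { (i , refl , t) → IsTail⇒InI {D = D} t })

  InJ⇔head : ∀ {D : Diag n} k → InJ D k ⇔ (∃ λ b → toℕ b ≡ k × IsHead (match D) b)
  InJ⇔head {D} k = mk⇔ (λ { (b , refl , x) → b , refl , InJ⇒IsHead {D = D} (b , refl , x) }) (λ { (b , refl , h) → IsHead⇒InJ {D = D} h })

  module _ {ws : List (ℕ × ℕ)} (canonical : Canonical n ws) where

    private
      u : List (Fin n)
      u = proj₁ (canonical-spell canonical)
      U : Spells ws u
      U = proj₂ (canonical-spell canonical)
      bound : ∀ {p} → p ∈ ws → 1 ≤ proj₁ p × proj₁ p ≤ proj₂ p × proj₂ p ≤ n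
      bound = All.lookup (proj₁ canonical)

    𝒟-NC : NCDiagram (𝒟 n ws)
    𝒟-NC = subst NCDiagram (sym (𝒟-acts U)) (acts-NC u)

    𝒟-InI : ∀ k → InI (𝒟 n ws) k ⇔ k ∈ map proj₁ ws
    𝒟-InI k rewrite 𝒟-acts U = mk⇔
      (λ x → case to⇔ (InI⇔tail {D = acts u idDiag} k) x of λ { (i , refl , t) → to⇔ (Spells.tails U i) t })
      (λ k∈ → from⇔ (InI⇔tail {D = acts u idDiag} k) (from k∈ (∈ₚ.∈-map⁻ proj₁ k∈)))
      where
      from : ∀ {k} → k ∈ map proj₁ ws → (∃ λ p → p ∈ ws × k ≡ proj₁ p) → ∃ λ i → suc (toℕ i) ≡ k × IsTail (match (acts u idDiag)) i
      from k∈ (p , p∈ , refl) with bound p∈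
      ... | 1≤i , i≤j , j≤n with label-surjective 1≤i (≤-trans i≤j j≤n)
      ...   | i , e = inject₁ i , trans (cong suc (toℕ-inject₁ i)) e ,
                      from⇔ (Spells.tails U (inject₁ i)) (subst (_∈ map proj₁ ws) (sym (trans (cong suc (toℕ-inject₁ i)) e)) k∈)

    𝒟-InJ : ∀ k → InJ (𝒟 n ws) k ⇔ k ∈ map proj₂ ws
    𝒟-InJ k rewrite 𝒟-acts U = mk⇔
      (λ x → case to⇔ (InJ⇔head {D = acts u idDiag} k) x of λ { (b , refl , h) → to⇔ (Spells.heads U b) h })
      (λ k∈ → from⇔ (InJ⇔head {D = acts u idDiag} k) (from k∈ (∈ₚ.∈-map⁻ proj₂ k∈)))
      where
      from : ∀ {k} → k ∈ map proj₂ ws → (∃ λ p → p ∈ ws × k ≡ proj₂ p) → ∃ λ b → toℕ b ≡ k × IsHead (match (acts u idDiag)) b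
      from k∈ (p , p∈ , refl) with bound p∈
      ... | _ , _ , j≤n = fromℕ< (s≤s j≤n) , Finₚ.toℕ-fromℕ< (s≤s j≤n) ,
                          from⇔ (Spells.heads U _) (subst (_∈ map proj₂ ws) (sym (Finₚ.toℕ-fromℕ< (s≤s j≤n))) k∈)

    𝒟-unique : ∀ {D : Diag n} → NCDiagram D → (∀ k → InI D k ⇔ k ∈ map proj₁ ws) → (∀ k → InJ D k ⇔ k ∈ map proj₂ ws) → D ≡ 𝒟 n ws
    𝒟-unique N I J = NC-determined N 𝒟-NC
      (λ k → from⇔ (𝒟-InI k) ∘ to⇔ (I k)) (λ k → from⇔ (I k) ∘ to⇔ (𝒟-InI k))
      (λ k → from⇔ (𝒟-InJ k) ∘ to⇔ (J k)) (λ k → from⇔ (J k) ∘ to⇔ (𝒟-InJ k))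

  𝒟-injective : ∀ {ws ws'} → Canonical n ws → Canonical n ws' → 𝒟 n ws ≡ 𝒟 n ws' → ws ≡ ws'
  𝒟-injective {ws} {ws'} c c' e = map-proj-injective
    (decreasing-unique (proj₁ (canonical-decreasing c)) (proj₁ (canonical-decreasing c')) (to-I c c' e) (to-I c' c (sym e)))
    (decreasing-unique (proj₂ (canonical-decreasing c)) (proj₂ (canonical-decreasing c')) (to-J c c' e) (to-J c' c (sym e)))
    where
    to-I : ∀ {ws ws'} → Canonical n ws → Canonical n ws' → 𝒟 n ws ≡ 𝒟 n ws' → ∀ {z} → z ∈ map proj₁ ws → z ∈ map proj₁ ws'
    to-I c c' e {z} z∈ = to⇔ (𝒟-InI c' z) (subst (λ D → InI D z) e (from⇔ (𝒟-InI c z) z∈))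
    to-J : ∀ {ws ws'} → Canonical n ws → Canonical n ws' → 𝒟 n ws ≡ 𝒟 n ws' → ∀ {z} → z ∈ map proj₂ ws → z ∈ map proj₂ ws'
    to-J c c' e {z} z∈ = to⇔ (𝒟-InJ c' z) (subst (λ D → InJ D z) e (from⇔ (𝒟-InJ c z) z∈))

  𝒟-surjective : ∀ {D : Diag n} → NCDiagram D → ∃ λ ws → Canonical n ws × 𝒟 n ws ≡ D
  𝒟-surjective {D} N with canonical-labels (proj₁ N)
  ... | ws , c , tails , heads = ws , c , sym (𝒟-unique c N
          (λ k → mk⇔ (to⇔ (tails k) ∘ to⇔ (InI⇔tail {D = D} k)) (from⇔ (InI⇔tail {D = D} k) ∘ from⇔ (tails k)))
          (λ k → mk⇔ (to⇔ (heads k) ∘ to⇔ (InJ⇔head {D = D} k)) (from⇔ (InJ⇔head {D = D} k) ∘ from⇔ (heads k))))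

-- Reduction of Temperley–Lieb monomials to canonical forms

range-snoc : ∀ {i k} → i ≤ suc k → range i (suc k) ≡ range i k ++ suc k ∷ []
range-snoc {i} {k} i≤1+k with ℕₚ.m≤n⇒∃[o]m+o≡n i≤1+k
... | d , e = go d e
  where
  go : ∀ d {i k} → i + d ≡ suc k → range i (suc k) ≡ range i k ++ suc k ∷ []
  go zero {i} {k} e with trans (sym (ℕₚ.+-identityʳ i)) e
  ... | refl = trans (range-∷ {suc k} ≤-refl) (trans (cong (suc k ∷_) (range-[] (suc k))) (cong (_++ suc k ∷ []) (sym (range-[] k))))
  go (suc d) {i} {k} e with ℕₚ.m+n≤o⇒m≤o i (≤-reflexive (ℕₚ.suc-injective (trans (sym (ℕₚ.+-suc i d)) e)))
  ... | i≤k = trans (range-∷ {i} (m≤n⇒m≤1+n i≤k)) (trans (cong (i ∷_) (go d (trans (sym (ℕₚ.+-suc i d)) e))) (cong (_++ suc k ∷ []) (sym (range-∷ i≤k))))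

range-++ : ∀ {i k} → i ≤ suc k → ∀ d → range i (d + k) ≡ range i k ++ range (suc k) (d + k)
range-++ {i} {k} i≤1+k zero = trans (sym (Listₚ.++-identityʳ _)) (cong (range i k ++_) (sym (range-[] k)))
range-++ {i} {k} i≤1+k (suc d) = begin
  range i (suc (d + k))                                     ≡⟨ range-snoc (≤-trans i≤1+k (s≤s (ℕₚ.m≤n+m k d))) ⟩
  range i (d + k) ++ suc (d + k) ∷ []                       ≡⟨ cong (_++ suc (d + k) ∷ []) (range-++ i≤1+k d) ⟩
  (range i k ++ range (suc k) (d + k)) ++ suc (d + k) ∷ []  ≡⟨ Listₚ.++-assoc (range i k) _ _ ⟩
  range i k ++ (range (suc k) (d + k) ++ suc (d + k) ∷ [])  ≡⟨ cong (range i k ++_) (range-snoc (s≤s (ℕₚ.m≤n+m k d))) ⟨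
  range i k ++ range (suc k) (suc (d + k))                  ∎
  where open ≡-Reasoning

range-split : ∀ {i k l} → i ≤ suc k → k ≤ l → range i l ≡ range i k ++ range (suc k) l
range-split {i} {k} {l} i≤1+k k≤l = subst (λ v → range i v ≡ range i k ++ range (suc k) v) (ℕₚ.m∸n+n≡m k≤l) (range-++ i≤1+k (l ∸ k))

range-bounds : ∀ {i j} → All (λ x → i ≤ x × x ≤ j) (range i j)
range-bounds {i} {j} with i ℕ.≤? suc j
... | yes i≤1+j = go (suc j ∸ i) (ℕₚ.m+[n∸m]≡n i≤1+j)
  where
  go : ∀ d {i} → i + d ≡ suc j → All (λ x → i ≤ x × x ≤ j) (range i j)
  go zero {i} e with trans (sym (ℕₚ.+-identityʳ i)) e
  ... | refl rewrite range-[] j = []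
  go (suc d) {i} e with ℕₚ.m+n≤o⇒m≤o i (≤-reflexive (ℕₚ.suc-injective (trans (sym (ℕₚ.+-suc i d)) e)))
  ... | i≤j rewrite range-∷ i≤j = (≤-refl , i≤j) ∷ All.map (λ (a , b) → <⇒≤ a , b) (go d (trans (sym (ℕₚ.+-suc i d)) e))
... | no i≰1+j rewrite range-applyUpTo i j | ℕₚ.m≤n⇒m∸n≡0 (<⇒≤ (≰⇒> i≰1+j)) = []

module _ (n : ℕ) where

  IsLetter : ℕ → Set
  IsLetter i = 1 ≤ i × i ≤ n

  Apart : ℕ → ℕ → Set
  Apart i j = suc (suc i) ≤ j ⊎ suc (suc j) ≤ i

  -- Rewriting up to scalars: `square` drops its factor δ, which `↠⇒⇝` restores. Letters are natural
  -- numbers so that intervals can be handled by `range`.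
  data _↠_ : List ℕ → List ℕ → Set where
    ↠-refl : ∀ {x} → x ↠ x
    _⟫_ : ∀ {x y z} → x ↠ y → y ↠ z → x ↠ z
    prepend : ∀ p {x y} → x ↠ y → (p ++ x) ↠ (p ++ y)
    append : ∀ q {x y} → x ↠ y → (x ++ q) ↠ (y ++ q)
    square : ∀ {i} → IsLetter i → (i ∷ i ∷ []) ↠ (i ∷ [])
    braid₁ : ∀ {i} → IsLetter i → IsLetter (suc i) → (i ∷ suc i ∷ i ∷ []) ↠ (i ∷ [])
    braid₂ : ∀ {i} → IsLetter i → IsLetter (suc i) → (suc i ∷ i ∷ suc i ∷ []) ↠ (suc i ∷ [])
    commute : ∀ {i j} → IsLetter i → IsLetter j → Apart i j → (i ∷ j ∷ []) ↠ (j ∷ i ∷ [])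

  infixr 5 _⟫_

  private
    ≡⇒↠ : ∀ {x y} → x ≡ y → x ↠ y
    ≡⇒↠ refl = ↠-refl

    assoc : ∀ x y {z : List ℕ} → (x ++ y) ++ z ≡ x ++ (y ++ z)
    assoc x y = Listₚ.++-assoc x y _

    Word≤ : ℕ → List ℕ → Set
    Word≤ m = All (λ x → 1 ≤ x × x ≤ m)

    weaken : ∀ {m m' w} → m ≤ m' → Word≤ m w → Word≤ m' w
    weaken m≤m' = All.map (λ (a , b) → a , ≤-trans b m≤m')

    past : ∀ {y u} → IsLetter y → All (λ x → IsLetter x × Apart y x) u → (y ∷ u) ↠ (u ++ y ∷ [])
    past _ [] = ↠-refl
    past {y} {x ∷ u} Ly ((Lx , a) ∷ as) = append u (commute Ly Lx a) ⟫ prepend (x ∷ []) (past Ly as)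

    swap : ∀ {u v} → All IsLetter u → All IsLetter v → All (λ x → All (Apart x) v) u → (u ++ v) ↠ (v ++ u)
    swap {v = v} [] _ [] = ≡⇒↠ (sym (Listₚ.++-identityʳ v))
    swap {x ∷ u} {v} (Lx ∷ Lu) Lv (a ∷ as) =
      prepend (x ∷ []) (swap Lu Lv as) ⟫ append u (past Lx (All.zip (Lv , a))) ⟫ ≡⇒↠ (assoc v (x ∷ []))

    letters≤ : ∀ {m w} → m ≤ n → Word≤ m w → All IsLetter w
    letters≤ m≤n = All.map (λ (a , b) → a , ≤-trans b m≤n)

    -- y commutes with the words in letters below y - 1.
    module _ {m y : ℕ} (m+2≤y : suc (suc m) ≤ y) (y≤n : y ≤ n) where
      private
        Ly : IsLetter y
        Ly = ≤-trans (s≤s z≤n) m+2≤y , y≤n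
        m≤n : m ≤ n
        m≤n = ≤-trans (≤-trans (n≤1+n m) (n≤1+n (suc m))) (≤-trans m+2≤y y≤n)

      right : ∀ {u} → Word≤ m u → (y ∷ u) ↠ (u ++ y ∷ [])
      right b = past Ly (All.map (λ (p , q) → (p , ≤-trans q m≤n) , inj₂ (≤-trans (s≤s (s≤s q)) m+2≤y)) b)

      left : ∀ {u} → Word≤ m u → (u ++ y ∷ []) ↠ (y ∷ u)
      left b = swap (letters≤ m≤n b) (Ly ∷ []) (All.map (λ (_ , q) → inj₁ (≤-trans (s≤s (s≤s q)) m+2≤y) ∷ []) b)

      right-in : ∀ {u} v → Word≤ m u → (y ∷ u ++ v) ↠ (u ++ y ∷ v)
      right-in {u} v b = append v (right b) ⟫ ≡⇒↠ (assoc u (y ∷ []))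

      left-in : ∀ {u} v → Word≤ m u → (u ++ y ∷ v) ↠ (y ∷ u ++ v)
      left-in {u} v b = ≡⇒↠ (sym (assoc u (y ∷ []))) ⟫ append v (left b)

    Isolated : ℕ → List ℕ → Set
    Isolated m w = ∃ λ u → ∃ λ v → w ↠ (u ++ suc m ∷ v) × Word≤ m u × Word≤ m v

  -- The largest letter need not occur more than once (Jones).
  isolate : ∀ m → suc m ≤ n → ∀ {w} → Word≤ (suc m) w → (∃ λ v → w ↠ v × Word≤ m v) ⊎ Isolated m w
  merge : ∀ m → suc m ≤ n → ∀ {u v} → Word≤ m u → Word≤ m v → Isolated m (suc m ∷ u ++ suc m ∷ v)
  isolate m m<n [] = inj₁ ([] , ↠-refl , [])
  isolate m m<n {x ∷ w} ((1≤x , x≤) ∷ bs) with isolate m m<n bs | ℕₚ.m≤n⇒m<n∨m≡n x≤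
  ... | inj₁ (v , r , vb) | inj₁ (s≤s x≤m) = inj₁ (x ∷ v , prepend (x ∷ []) r , (1≤x , x≤m) ∷ vb)
  ... | inj₁ (v , r , vb) | inj₂ refl = inj₂ ([] , v , prepend (x ∷ []) r , [] , vb)
  ... | inj₂ (u , v , r , ub , vb) | inj₁ (s≤s x≤m) = inj₂ (x ∷ u , v , prepend (x ∷ []) r , (1≤x , x≤m) ∷ ub , vb)
  ... | inj₂ (u , v , r , ub , vb) | inj₂ refl with merge m m<n ub vb
  ...   | u' , v' , r' , ub' , vb' = inj₂ (u' , v' , prepend (x ∷ []) r ⟫ r' , ub' , vb')
  merge zero m<n {[]} {v} [] vb = [] , v , append v (square (s≤s z≤n , m<n)) , [] , vb
  merge zero m<n {x ∷ u} ((1≤x , x≤0) ∷ _) _ = ⊥-elim (<⇒≱ 1≤x x≤0)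
  merge (suc m) m<n {u} {v} ub vb with isolate m (<⇒≤ m<n) ub
  -- Without `suc m` between the two copies of `M`, everything between commutes with `M`, and the
  -- copies meet.
  ... | inj₁ (u₀ , r , b₀) = u₀ , v ,
          (prepend (M ∷ []) (append (M ∷ v) r) ⟫ right-in ≤-refl m<n (M ∷ v) b₀ ⟫ prepend u₀ (append v (square (s≤s z≤n , m<n)))) ,
          weaken (n≤1+n m) b₀ , vb
    where
    M : ℕ
    M = suc (suc m)
  -- With a single `suc m` between them, the lower letters move out on both sides and the braid
  -- relation leaves one `M`.
  ... | inj₂ (u₁ , u₂ , r , b₁ , b₂) = u₁ , u₂ ++ v ,
          (prepend (M ∷ []) (append (M ∷ v) r ⟫ ≡⇒↠ (assoc u₁ (suc m ∷ u₂)))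
           ⟫ right-in ≤-refl m<n (suc m ∷ u₂ ++ M ∷ v) b₁
           ⟫ prepend u₁ (prepend (M ∷ suc m ∷ []) (left-in ≤-refl m<n v b₂)
                         ⟫ append (u₂ ++ v) (braid₂ (s≤s z≤n , <⇒≤ m<n) (s≤s z≤n , m<n)))) ,
          weaken (n≤1+n m) b₁ , ++⁺ (weaken (n≤1+n m) b₂) vb
    where
    M : ℕ
    M = suc (suc m)

  -- Only the next lower letter obstructs the way of the largest one to the front. That letter is
  -- isolated and brought to the front as the end of an interval by recursion, and the largest
  -- letter then follows it up to that interval.
  lead : ∀ m → suc m ≤ n → ∀ {u} → Word≤ m u →
    ∃ λ i → ∃ λ v → (u ++ suc m ∷ []) ↠ (range i (suc m) ++ v) × 1 ≤ i × i ≤ suc m × Word≤ m v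
  lead zero m<n [] = 1 , [] , ↠-refl , s≤s z≤n , s≤s z≤n , []
  lead zero m<n ((1≤x , x≤0) ∷ _) = ⊥-elim (<⇒≱ 1≤x x≤0)
  lead (suc m) m<n {u} ub with isolate m (<⇒≤ m<n) ub
  ... | inj₁ (u₀ , r , b₀) = suc (suc m) , u₀ ,
          (append _ r ⟫ left ≤-refl m<n b₀ ⟫ ≡⇒↠ (cong (_++ u₀) (sym (trans (range-∷ {suc (suc m)} ≤-refl) (cong (suc (suc m) ∷_) (range-[] (suc (suc m)))))))) ,
          s≤s z≤n , ≤-refl , weaken (n≤1+n m) b₀
  ... | inj₂ (u₁ , u₂ , r , b₁ , b₂) with lead m (<⇒≤ m<n) b₁
  ...   | i , v , r' , 1≤i , i≤ , vb = i , v ++ u₂ ,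
          (append (M ∷ []) r ⟫ ≡⇒↠ (assoc u₁ (suc m ∷ u₂))
           ⟫ prepend u₁ (prepend (suc m ∷ []) (left ≤-refl m<n b₂))
           ⟫ ≡⇒↠ (sym (assoc u₁ (suc m ∷ [])))
           ⟫ append (M ∷ u₂) r'
           ⟫ ≡⇒↠ (assoc (range i (suc m)) v)
           ⟫ prepend (range i (suc m)) (left-in ≤-refl m<n u₂ vb)
           ⟫ ≡⇒↠ (trans (sym (assoc (range i (suc m)) (M ∷ []))) (cong (_++ v ++ u₂) (sym (range-snoc (m≤n⇒m≤1+n i≤)))))) ,
          1≤i , m≤n⇒m≤1+n i≤ , ++⁺ (weaken (n≤1+n m) vb) (weaken (n≤1+n m) b₂)
    where
    M : ℕ
    M = suc (suc m)

  -- [i, M][k, j] = [k + 2, M][i, j] for i ≤ k ≤ j < M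
  exchange : ∀ {i k j M} → 1 ≤ i → i ≤ suc k → suc k ≤ j → j < M → M ≤ n →
    (range i M ++ range (suc k) j) ↠ (range (suc (suc (suc k))) M ++ range i j)
  exchange {i} {k} {j} {M} 1≤i i≤K K≤j j<M M≤n =
    ≡⇒↠ (cong₂ _++_ split-iM (range-∷ K≤j))
    ⟫ ≡⇒↠ (trans (assoc (range i k ++ K ∷ []) (suc K ∷ hi)) (assoc (range i k) (K ∷ [])))
    -- The second `K` moves left past `hi`, and `K (K + 1) K` contracts to `K`.
    ⟫ prepend (range i k) (
        prepend (K ∷ suc K ∷ []) (≡⇒↠ (sym (assoc hi (K ∷ []))) ⟫ append rest (swap Lhi (LK ∷ []) (All.map (λ (a , _) → inj₂ a ∷ []) (range-bounds {suc (suc K)} {M}))))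
        ⟫ append (hi ++ rest) (braid₁ LK LK⁺))
    ⟫ ≡⇒↠ (trans (sym (assoc (range i k) (K ∷ []))) (trans (cong (_++ hi ++ rest) (sym (range-snoc i≤K))) (sym (assoc (range i K) hi))))
    -- The letters of `[i, K]` and of `hi` differ by at least two; after the swap `[i, K]` and
    -- `rest` combine to `[i, j]`.
    ⟫ append rest (swap LiK Lhi (All.map (λ (_ , x≤K) → All.map (λ (a , _) → inj₁ (≤-trans (s≤s (s≤s x≤K)) a)) (range-bounds {suc (suc K)} {M})) (range-bounds {i} {K})))
    ⟫ ≡⇒↠ (trans (assoc hi (range i K)) (cong (hi ++_) (sym (range-split (m≤n⇒m≤1+n i≤K) K≤j))))
    where
    K : ℕ
    K = suc k
    hi rest : List ℕ
    hi = range (suc (suc K)) M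
    rest = range (suc K) j
    K<M : K < M
    K<M = ≤-<-trans K≤j j<M
    LK : IsLetter K
    LK = s≤s z≤n , ≤-trans (<⇒≤ K<M) M≤n
    LK⁺ : IsLetter (suc K)
    LK⁺ = s≤s z≤n , ≤-trans K<M M≤n
    Lhi : All IsLetter hi
    Lhi = All.map (λ (a , b) → ≤-trans (s≤s z≤n) a , ≤-trans b M≤n) range-bounds
    LiK : All IsLetter (range i K)
    LiK = All.map (λ (a , b) → ≤-trans 1≤i a , ≤-trans b (proj₂ LK)) range-bounds
    split-iM : range i M ≡ (range i k ++ K ∷ []) ++ suc K ∷ hi
    split-iM = trans (range-split (m≤n⇒m≤1+n i≤K) (<⇒≤ K<M)) (cong₂ _++_ (range-snoc i≤K) (range-∷ K<M))

  private
    cword-bounds : ∀ {m ws} → All (λ p → 1 ≤ proj₁ p × proj₁ p ≤ proj₂ p × proj₂ p ≤ m) ws → Word≤ m (cword ws)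
    cword-bounds [] = []
    cword-bounds ((1≤i , _ , j≤m) ∷ bs) = ++⁺ (All.map (λ (a , b) → ≤-trans 1≤i a , ≤-trans b j≤m) range-bounds) (cword-bounds bs)

    Canonical-weaken : ∀ {m ws} → Canonical m ws → Canonical (suc m) ws
    Canonical-weaken (bs , l) = All.map (λ (a , b , c) → a , b , m≤n⇒m≤1+n c) bs , l

    Reduces : ℕ → List ℕ → Set
    Reduces m w = ∃ λ ws → w ↠ cword ws × Canonical m ws

    reduce-after : ∀ {m w w'} → w ↠ w' → Reduces m w' → Reduces m w
    reduce-after r (ws , r' , c) = ws , (r ⟫ r') , c

    -- d bounds the number of exchanges, which raise the start of the leading interval.
    reduce-lead : ∀ m → suc m ≤ n → (∀ {w} → Word≤ m w → Reduces m w) → ∀ d {i v} → suc m ≤ i + d → 1 ≤ i → i ≤ suc m → Word≤ m v →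
      Reduces (suc m) (range i (suc m) ++ v)
    reduce-lead m m<n reduce-m d {i} {v} m≤i+d 1≤i i≤ vb with reduce-m vb
    ... | [] , r , _ = (i , suc m) ∷ [] , prepend (range i (suc m)) r , (1≤i , i≤ , ≤-refl) ∷ [] , [-]
    ... | (i₁ , j₁) ∷ ws , r , (b@(1≤i₁ , i₁≤j₁ , j₁≤m) ∷ bs) , l with i₁ ℕ.<? i
    ...   | yes i₁<i = (i , suc m) ∷ (i₁ , j₁) ∷ ws , prepend (range i (suc m)) r ,
              (1≤i , i≤ , ≤-refl) ∷ All.map (λ (a , b , c) → a , b , m≤n⇒m≤1+n c) (b ∷ bs) , (i₁<i , s≤s j₁≤m) ∷ l
    reduce-lead m m<n reduce-m d {i} {v} m≤i+d 1≤i i≤ vb | (suc k , j₁) ∷ ws , r , (b@(1≤i₁ , i₁≤j₁ , j₁≤m) ∷ bs) , l | no i₁≮i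
      = reduce-after exchanged (continue d m≤i+d)
      where
      vb' : Word≤ m (range i j₁ ++ cword ws)
      vb' = ++⁺ (All.map (λ (a , b) → ≤-trans 1≤i a , ≤-trans b j₁≤m) range-bounds) (cword-bounds bs)
      exchanged : (range i (suc m) ++ v) ↠ (range (3 + k) (suc m) ++ (range i j₁ ++ cword ws))
      exchanged = prepend (range i (suc m)) r
        ⟫ ≡⇒↠ (sym (assoc (range i (suc m)) (range (suc k) j₁)))
        ⟫ append (cword ws) (exchange 1≤i (≮⇒≥ i₁≮i) i₁≤j₁ (s≤s j₁≤m) m<n)
        ⟫ ≡⇒↠ (assoc (range (3 + k) (suc m)) (range i j₁))
      continue : ∀ d → suc m ≤ i + d → Reduces (suc m) (range (3 + k) (suc m) ++ (range i j₁ ++ cword ws))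
      continue d _ with (3 + k) ℕ.≤? suc m
      -- Here `suc k` equals `m`: the raised interval is empty, and no letter `suc m` remains.
      ... | no 3+k≰ with ≤-antisym (≤-trans i₁≤j₁ j₁≤m) (≤-pred (≤-pred (≰⇒> 3+k≰)))
      ...   | refl with reduce-m vb'
      ...     | ws' , r' , c' = ws' , (≡⇒↠ (cong (_++ (range i j₁ ++ cword ws)) (range-[] (suc m))) ⟫ r') , Canonical-weaken c'
      continue zero m≤i+0 | yes 3+k≤ = ⊥-elim (<⇒≱ (≤-trans (≤-trans (s≤s (≮⇒≥ i₁≮i)) (n≤1+n _)) 3+k≤) (subst (suc m ≤_) (ℕₚ.+-identityʳ i) m≤i+0))
      continue (suc d') m≤i+d | yes 3+k≤ = reduce-lead m m<n reduce-m d'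
        (≤-trans m≤i+d (≤-trans (≤-reflexive (ℕₚ.+-suc i d')) (ℕₚ.+-monoˡ-≤ d' (≤-trans (s≤s (≮⇒≥ i₁≮i)) (n≤1+n _)))))
        (s≤s z≤n) 3+k≤ vb'

  reduce : ∀ m → m ≤ n → ∀ {w} → Word≤ m w → ∃ λ ws → w ↠ cword ws × Canonical m ws
  reduce zero _ [] = [] , ↠-refl , [] , []
  reduce zero _ ((1≤x , x≤0) ∷ _) = ⊥-elim (<⇒≱ 1≤x x≤0)
  reduce (suc m) m<n b with isolate m m<n b
  ... | inj₁ (v , r , vb) with reduce m (<⇒≤ m<n) vb
  ...   | ws , r' , c = ws , (r ⟫ r') , Canonical-weaken c
  reduce (suc m) m<n b | inj₂ (u , v , r , ub , vb) with lead m m<n ub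
  ...   | i , v' , r' , 1≤i , i≤ , vb' = reduce-after
            (r ⟫ ≡⇒↠ (sym (assoc u (suc m ∷ []))) ⟫ append v r' ⟫ ≡⇒↠ (assoc (range i (suc m)) v'))
            (reduce-lead m m<n (reduce m (<⇒≤ m<n)) (suc m) (ℕₚ.m≤n+m (suc m) i) 1≤i i≤ (++⁺ vb' vb))

-- Formal linear combinations

module LinearCombinations {c ℓ : Level} (R : CommutativeRing c ℓ) (δ : CommutativeRing.Carrier R) (n : ℕ) where

  open CommutativeRing R public
    using (Carrier; _≈_; 0#; 1#; -_; setoid; reflexive; +-cong; +-congˡ; +-congʳ; *-cong; *-congˡ; *-congʳ; +-assoc; +-comm;
      +-identityˡ; +-identityʳ; *-assoc; *-comm; *-identityˡ; *-identityʳ; zeroˡ; zeroʳ; distribˡ; distribʳ; -‿inverseˡ)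
    renaming (_+_ to _⊕_; _*_ to _⊗_; refl to ≈-refl; sym to ≈-sym; trans to ≈-trans)
  open Alg R δ n
  open import Relation.Binary.Reasoning.Setoid setoid

  -- the value at a linear combination of the linear extension of f
  ev : ∀ {X : Set} → (X → Carrier) → FreeMod X → Carrier
  ev f [] = 0#
  ev f ((r , x) ∷ l) = r ⊗ f x ⊕ ev f l

  ev-cong : ∀ {X : Set} {f g : X → Carrier} → (∀ x → f x ≈ g x) → ∀ l → ev f l ≈ ev g l
  ev-cong e [] = ≈-refl
  ev-cong e ((r , x) ∷ l) = +-cong (*-congˡ (e x)) (ev-cong e l)

  ev-++ : ∀ {X : Set} (f : X → Carrier) l l' → ev f (l ++ l') ≈ ev f l ⊕ ev f l'
  ev-++ f [] l' = ≈-sym (+-identityˡ _)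
  ev-++ f ((r , x) ∷ l) l' = ≈-trans (+-congˡ (ev-++ f l l')) (≈-sym (+-assoc _ _ _))

  ev-scale : ∀ {X : Set} (f : X → Carrier) r l → ev f (scale r l) ≈ r ⊗ ev f l
  ev-scale f r [] = ≈-sym (zeroʳ r)
  ev-scale f r ((s , x) ∷ l) = ≈-trans (+-cong (*-assoc r s (f x)) (ev-scale f r l)) (≈-sym (distribˡ r _ _))

  ev-factor : ∀ {X : Set} (f : X → Carrier) r l → ev (λ x → r ⊗ f x) l ≈ r ⊗ ev f l
  ev-factor f r [] = ≈-sym (zeroʳ r)
  ev-factor f r ((s , x) ∷ l) = ≈-trans (+-cong move (ev-factor f r l)) (≈-sym (distribˡ r _ _))
    where
    move : s ⊗ (r ⊗ f x) ≈ r ⊗ (s ⊗ f x)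
    move = ≈-trans (≈-sym (*-assoc s r (f x))) (≈-trans (*-congʳ (*-comm s r)) (*-assoc r s (f x)))

  ev-mul : ∀ {X : Set} (f : X → Carrier) (m : X → X → Carrier × X) xs ys →
    ev f (mulF m xs ys) ≈ ev (λ a → ev (λ b → proj₁ (m a b) ⊗ f (proj₂ (m a b))) ys) xs
  ev-mul f m [] ys = ≈-refl
  ev-mul {X} f m ((r , a) ∷ xs) ys = ≈-trans (ev-++ f (row ys) (mulF m xs ys)) (+-cong (ev-row ys) (ev-mul f m xs ys))
    where
    row : FreeMod X → FreeMod X
    row = map (λ q → (r ⊗ proj₁ q) ⊗ proj₁ (m a (proj₂ q)) , proj₂ (m a (proj₂ q)))
    ev-row : ∀ ys → ev f (row ys) ≈ r ⊗ ev (λ b → proj₁ (m a b) ⊗ f (proj₂ (m a b))) ys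
    ev-row [] = ≈-sym (zeroʳ r)
    ev-row ((s , b) ∷ ys) = ≈-trans (+-cong (≈-trans (*-assoc _ _ _) (*-assoc r s _)) (ev-row ys)) (≈-sym (distribˡ r _ _))

  kron : Bool → Carrier
  kron b = if b then 1# else 0#

  module _ {X : Set} (_≟_ : DecidableEquality X) where

    coeff-ev : ∀ x l → coeff _≟_ x l ≈ ev (λ y → kron (does (x ≟ y))) l
    coeff-ev x [] = ≈-refl
    coeff-ev x ((r , y) ∷ l) = +-cong (head (does (x ≟ y))) (coeff-ev x l)
      where
      head : ∀ b → (if b then r else 0#) ≈ r ⊗ kron b
      head true = ≈-sym (*-identityʳ r)
      head false = ≈-sym (zeroʳ r)

    remove : X → FreeMod X → FreeMod X
    remove x [] = []
    remove x ((r , y) ∷ l) with x ≟ y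
    ... | yes _ = remove x l
    ... | no _ = (r , y) ∷ remove x l

    length-remove : ∀ x l → length (remove x l) ≤ length l
    length-remove x [] = z≤n
    length-remove x ((r , y) ∷ l) with x ≟ y
    ... | yes _ = m≤n⇒m≤1+n (length-remove x l)
    ... | no _ = s≤s (length-remove x l)

    length-remove-head : ∀ {x r} l → length (remove x ((r , x) ∷ l)) < suc (length l)
    length-remove-head {x} l with x ≟ x
    ... | yes _ = s≤s (length-remove x l)
    ... | no x≢x = ⊥-elim (x≢x refl)

    ev-remove : ∀ f x l → ev f l ≈ coeff _≟_ x l ⊗ f x ⊕ ev f (remove x l)
    ev-remove f x [] = ≈-sym (≈-trans (+-identityʳ _) (zeroˡ _))
    ev-remove f x ((r , y) ∷ l) with x ≟ y
    ... | yes refl = ≈-trans (+-congˡ (ev-remove f x l)) (≈-trans (≈-sym (+-assoc _ _ _)) (+-congʳ (≈-sym (distribʳ _ _ _))))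
    ... | no _ = begin
      r ⊗ f y ⊕ ev f l                                         ≈⟨ +-congˡ (ev-remove f x l) ⟩
      r ⊗ f y ⊕ (coeff _≟_ x l ⊗ f x ⊕ ev f (remove x l))      ≈⟨ +-assoc _ _ _ ⟨
      (r ⊗ f y ⊕ coeff _≟_ x l ⊗ f x) ⊕ ev f (remove x l)      ≈⟨ +-congʳ (+-comm _ _) ⟩
      (coeff _≟_ x l ⊗ f x ⊕ r ⊗ f y) ⊕ ev f (remove x l)      ≈⟨ +-assoc _ _ _ ⟩
      coeff _≟_ x l ⊗ f x ⊕ (r ⊗ f y ⊕ ev f (remove x l))      ≈⟨ +-congʳ (*-congʳ (+-identityˡ _)) ⟨
      (0# ⊕ coeff _≟_ x l) ⊗ f x ⊕ (r ⊗ f y ⊕ ev f (remove x l)) ∎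

    coeff-remove-same : ∀ x l → coeff _≟_ x (remove x l) ≈ 0#
    coeff-remove-same x [] = ≈-refl
    coeff-remove-same x ((r , y) ∷ l) with x ≟ y
    ... | yes _ = coeff-remove-same x l
    ... | no x≢y with x ≟ y
    ...   | yes x≡y = ⊥-elim (x≢y x≡y)
    ...   | no _ = ≈-trans (+-identityˡ _) (coeff-remove-same x l)

    coeff-remove-other : ∀ {x z} → z ≢ x → ∀ l → coeff _≟_ z (remove x l) ≈ coeff _≟_ z l
    coeff-remove-other z≢x [] = ≈-refl
    coeff-remove-other {x} {z} z≢x ((r , y) ∷ l) with x ≟ y
    ... | no _ = +-congˡ (coeff-remove-other z≢x l)
    ... | yes refl with z ≟ x
    ...   | yes z≡x = ⊥-elim (z≢x z≡x)
    ...   | no _ = ≈-trans (coeff-remove-other z≢x l) (≈-sym (+-identityˡ _))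

    private
      SameCoeff : FreeMod X → FreeMod X → Set ℓ
      SameCoeff l l' = ∀ x → coeff _≟_ x l ≈ coeff _≟_ x l'

      remove-same : ∀ x {l l'} → SameCoeff l l' → SameCoeff (remove x l) (remove x l')
      remove-same x {l} {l'} e z with z ≟ x
      ... | yes refl = ≈-trans (coeff-remove-same x l) (≈-sym (coeff-remove-same x l'))
      ... | no z≢x = ≈-trans (coeff-remove-other z≢x l) (≈-trans (e z) (≈-sym (coeff-remove-other z≢x l')))

    -- Lists may repeat basis elements, so there is no induction along one list. Instead all terms
    -- with the first basis element of either list are collected and removed from both, which
    -- shortens the total length.
    ev-coeff : ∀ f {l l'} → (∀ x → coeff _≟_ x l ≈ coeff _≟_ x l') → ev f l ≈ ev f l'
    ev-coeff f {l} {l'} = go (length l + length l') {l} {l'} ≤-refl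
      where
      go : ∀ k {l l'} → length l + length l' ≤ k → SameCoeff l l' → ev f l ≈ ev f l'
      split : ∀ k x {l l'} → length (remove x l) + length (remove x l') ≤ k → SameCoeff l l' → ev f l ≈ ev f l'
      split k x {l} {l'} b e = ≈-trans (ev-remove f x l)
        (≈-trans (+-cong (*-congʳ (e x)) (go k {remove x l} {remove x l'} b (remove-same x {l} {l'} e))) (≈-sym (ev-remove f x l')))
      go k {[]} {[]} _ _ = ≈-refl
      go (suc k) {(r , x) ∷ l} {l'} (s≤s b) e = split k x {(r , x) ∷ l} {l'}
        (≤-trans (+-mono-≤ (≤-pred (length-remove-head {x} {r} l)) (length-remove x l')) b) e
      go (suc k) {[]} {(r , x) ∷ l'} (s≤s b) e = split k x {[]} {(r , x) ∷ l'} (≤-trans (≤-pred (length-remove-head {x} {r} l')) b) e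

  _≟ᵂ_ : DecidableEquality Word
  _≟ᵂ_ = Listₚ.≡-dec Finₚ._≟_

  -- Equality is tested on all linear functionals; products are then compared without computing any
  -- coefficient of a product.
  ≈D-ev : ∀ x y → (∀ f → ev f x ≈ ev f y) → x ≈D y
  ≈D-ev x y e d = ≈-trans (coeff-ev _≟D_ d x) (≈-trans (e _) (≈-sym (coeff-ev _≟D_ d y)))

  ≈T-ev : ∀ {x y} → (∀ f → ev f x ≈ ev f y) → x ≈T y
  ≈T-ev {x} {y} e = coeff-eq λ u → ≈-trans (coeff-ev _≟ᵂ_ u x) (≈-trans (e _) (≈-sym (coeff-ev _≟ᵂ_ u y)))

  ev-≈D : ∀ {x y} → x ≈D y → ∀ f → ev f x ≈ ev f y
  ev-≈D {x} {y} e f = ev-coeff _≟D_ f {x} {y} e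

  ev-single : ∀ {X : Set} (f : X → Carrier) {r s} {x y : X} → r ≈ s → x ≡ y → ev f ((r , x) ∷ []) ≈ ev f ((s , y) ∷ [])
  ev-single f e refl = +-congʳ (*-congʳ e)

  ++-congD : ∀ {x x' y y'} → x ≈D x' → y ≈D y' → (x ++ y) ≈D (x' ++ y')
  ++-congD {x} {x'} {y} {y'} e e' = ≈D-ev (x ++ y) (x' ++ y') λ f → ≈-trans (ev-++ f x y) (≈-trans (+-cong (ev-≈D {x} {x'} e f) (ev-≈D {y} {y'} e' f)) (≈-sym (ev-++ f x' y')))

  scale-congD : ∀ r {x y} → x ≈D y → scale r x ≈D scale r y
  scale-congD r {x} {y} e = ≈D-ev (scale r x) (scale r y) λ f → ≈-trans (ev-scale f r x) (≈-trans (*-congˡ (ev-≈D {x} {y} e f)) (≈-sym (ev-scale f r y)))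

  *-congD : ∀ {x x' y y'} → x ≈D x' → y ≈D y' → (x *D y) ≈D (x' *D y')
  *-congD {x} {x'} {y} {y'} e e' = ≈D-ev (x *D y) (x' *D y') λ f → begin
    ev f (x *D y)                        ≈⟨ ev-mul f mD x y ⟩
    ev (λ a → ev (g f a) y) x            ≈⟨ ev-cong (λ a → ev-≈D {y} {y'} e' (g f a)) x ⟩
    ev (λ a → ev (g f a) y') x           ≈⟨ ev-≈D {x} {x'} e (λ a → ev (g f a) y') ⟩
    ev (λ a → ev (g f a) y') x'          ≈⟨ ev-mul f mD x' y' ⟨
    ev f (x' *D y')                      ∎
    where
    mD : Diag n → Diag n → Carrier × Diag n
    mD D D' = pow (circles D D') , D ∗ D'
    g : (Diag n → Carrier) → Diag n → Diag n → Carrier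
    g f a b = pow (circles a b) ⊗ f (a ∗ b)

  pow-+ : ∀ a b → pow (a + b) ≈ pow a ⊗ pow b
  pow-+ zero b = ≈-sym (*-identityˡ _)
  pow-+ (suc a) b = ≈-trans (*-congˡ (pow-+ a b)) (≈-sym (*-assoc _ _ _))

  mono-++ : ∀ r s u v → (((r , u) ∷ []) *T ((s , v) ∷ [])) ≈T ((r ⊗ s , u ++ v) ∷ [])
  mono-++ r s u v = ≈T-ev λ f → ev-single f (*-identityʳ _) refl

  ≈T-refl : ∀ x → x ≈T x
  ≈T-refl x = coeff-eq λ _ → ≈-refl

  single-cong : ∀ {r s u v} → r ≈ s → u ≡ v → ((r , u) ∷ []) ≈T ((s , v) ∷ [])
  single-cong e e' = ≈T-ev λ f → ev-single f e e'

  -- The scalar is left unspecified: the comparison of normal forms uses only the diagrams and the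
  -- circle-freeness of canonical words.
  _⇝_ : Word → Word → Set (c ⊔ ℓ)
  u ⇝ v = Σ Carrier λ r → mono u ≈T ((r , v) ∷ [])

  ⇝-scale : ∀ r {u v} → ((s , _) : u ⇝ v) → ((r , u) ∷ []) ≈T ((r ⊗ s , v) ∷ [])
  ⇝-scale r {u} {v} (s , e) = trans-T (single-cong (≈-sym (*-identityʳ r)) refl)
    (trans-T (sym-T (mono-++ r 1# [] u)) (trans-T (*-cong-T (≈T-refl ((r , []) ∷ [])) e) (mono-++ r s [] v)))

  ⇝-trans : ∀ {u v w} → u ⇝ v → v ⇝ w → u ⇝ w
  ⇝-trans (r , e) e' = r ⊗ proj₁ e' , trans-T e (⇝-scale r e')

  ⇝-prepend : ∀ p {u v} → u ⇝ v → (p ++ u) ⇝ (p ++ v)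
  ⇝-prepend p {u} {v} (r , e) = 1# ⊗ r , trans-T (single-cong (≈-sym (*-identityʳ 1#)) refl)
    (trans-T (sym-T (mono-++ 1# 1# p u)) (trans-T (*-cong-T (≈T-refl (mono p)) e) (mono-++ 1# r p v)))

  ⇝-append : ∀ q {u v} → u ⇝ v → (u ++ q) ⇝ (v ++ q)
  ⇝-append q {u} {v} (r , e) = r ⊗ 1# , trans-T (single-cong (≈-sym (*-identityʳ 1#)) refl)
    (trans-T (sym-T (mono-++ 1# 1# u q)) (trans-T (*-cong-T e (≈T-refl (mono q))) (mono-++ r 1# v q)))

  letters : List ℕ → Word
  letters = mapMaybe (toLetter n)

  private
    letters-++ : ∀ x y → letters (x ++ y) ≡ letters x ++ letters y
    letters-++ = Listₚ.mapMaybe-++ (toLetter n)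

    relation : ∀ {u v} → u ⇝ v → letters (map label u) ⇝ letters (map label v)
    relation {u} {v} = subst₂ _⇝_ (sym (mapMaybe-label u)) (sym (mapMaybe-label v))

    commutation : ∀ {i j : Fin n} → Apart n (label i) (label j) → (i ∷ j ∷ []) ⇝ (j ∷ i ∷ [])
    commutation (inj₁ a) = 1# , rel-comm _ _ (≤-pred a)
    commutation (inj₂ a) = 1# , sym-T (rel-comm _ _ (≤-pred a))

  ↠⇒⇝ : ∀ {x y} → _↠_ n x y → letters x ⇝ letters y
  ↠⇒⇝ ↠-refl = 1# , ≈T-refl _
  ↠⇒⇝ (r ⟫ s) = ⇝-trans (↠⇒⇝ r) (↠⇒⇝ s)
  ↠⇒⇝ (prepend p {x} {y} r) = subst₂ _⇝_ (sym (letters-++ p x)) (sym (letters-++ p y)) (⇝-prepend (letters p) (↠⇒⇝ r))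
  ↠⇒⇝ (append q {x} {y} r) = subst₂ _⇝_ (sym (letters-++ x q)) (sym (letters-++ y q)) (⇝-append (letters q) (↠⇒⇝ r))
  ↠⇒⇝ (square (1≤i , i≤n)) with label-surjective 1≤i i≤n
  ... | i , refl = relation {i ∷ i ∷ []} {i ∷ []} (δ , rel-sq i)
  ↠⇒⇝ (braid₁ (1≤i , i≤n) (1≤j , j≤n)) with label-surjective 1≤i i≤n | label-surjective 1≤j j≤n
  ... | i , refl | j , e = subst (λ v → letters (label i ∷ v ∷ label i ∷ []) ⇝ letters (label i ∷ [])) e
        (relation {i ∷ j ∷ i ∷ []} {i ∷ []} (1# , rel-br₁ i j (ℕₚ.suc-injective e)))
  ↠⇒⇝ (braid₂ (1≤i , i≤n) (1≤j , j≤n)) with label-surjective 1≤i i≤n | label-surjective 1≤j j≤n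
  ... | i , refl | j , e = subst (λ v → letters (v ∷ label i ∷ v ∷ []) ⇝ letters (v ∷ [])) e
        (relation {j ∷ i ∷ j ∷ []} {j ∷ []} (1# , rel-br₂ i j (ℕₚ.suc-injective e)))
  ↠⇒⇝ (commute (1≤i , i≤n) (1≤j , j≤n) a) with label-surjective 1≤i i≤n | label-surjective 1≤j j≤n
  ... | i , refl | j , refl = relation {i ∷ j ∷ []} {j ∷ i ∷ []} (commutation a)

  CanonicalWord : Word → Set
  CanonicalWord u = ∃ λ ws → Canonical n ws × Spells ws u

  word-reduces : ∀ u → ∃ λ v → u ⇝ v × CanonicalWord v
  word-reduces u with reduce n n ≤-refl (labels u)
    where
    labels : ∀ u → All (λ x → 1 ≤ x × x ≤ n) (map label u)
    labels [] = []
    labels (i ∷ u) = (s≤s z≤n , Finₚ.toℕ<n i) ∷ labels u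
  ... | ws , r , c with canonical-spell c
  ...   | v , V = v , subst₂ _⇝_ (mapMaybe-label u) (trans (cong letters (sym (Spells.spelling V))) (mapMaybe-label v)) (↠⇒⇝ r) , ws , c , V

  normalise : ∀ x → ∃ λ x' → x ≈T x' × All (CanonicalWord ∘ proj₂) x'
  normalise [] = [] , ≈T-refl [] , []
  normalise ((r , u) ∷ x) with word-reduces u | normalise x
  ... | v , e , V | x' , e' , X' = (r ⊗ proj₁ e , v) ∷ x' , +-cong-T (⇝-scale r e) e' , V ∷ X'

-- The Temperley–Lieb relations for diagrams

module _ {n : ℕ} where

  -- Joining s–t, then t–u, then s–t again straightens a zigzag.
  Surgery-zigzag : ∀ {s t u : Pt n} {f g h : Pt n → Pt n} → Pairing f → f s ≡ t → s ≢ u →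
    Surgery t u f g → Surgery s t g h → ∀ p → h p ≡ f p
  Surgery-zigzag {s} {t} {u} {f} {g} {h} P fs≡t s≢u S T = Surgery-unique G T restored
    where
    inv : ∀ {x y} → f x ≡ y → f y ≡ x
    inv {x} refl = proj₂ (P x)
    G : Pairing g
    G = Surgery-pairing P S
    g-inv : ∀ {x y} → g x ≡ y → g y ≡ x
    g-inv {x} refl = proj₂ (G x)
    gs≡fu : g s ≡ f u
    gs≡fu = Surgery.to-s S s≢u fs≡t
    restored : Surgery s t g f
    restored = record
      { s≢t = Surgery.s≢t T
      ; at-s = fs≡t
      ; at-t = inv fs≡t
      ; to-s = λ {p} _ e → trans (cong f (trans (sym (g-inv e)) gs≡fu)) (trans (proj₂ (P u)) (sym (Surgery.at-s S)))
      ; to-t = λ {p} _ e → trans (cong f (trans (sym (g-inv e)) (Surgery.at-s S))) (sym gs≡fu)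
      ; off = λ {p} p≢s p≢t gp≢s gp≢t → sym (Surgery.off S p≢t
          (λ { refl → gp≢t (Surgery.at-t S) })
          (λ e → p≢s (trans (sym (inv e)) (inv fs≡t)))
          (λ e → gp≢s (g-inv (trans gs≡fu (inv e))))) }

  -- The inequalities keep `s`, `t` and their partners away from `u` and `v`, so the two surgeries
  -- do not interact. They hold for distant generators on the identity diagram, where the partners
  -- lie in the bottom row.
  Surgery-commute : ∀ {s t u v : Pt n} {f g g' h h' : Pt n → Pt n} → Pairing f →
    s ≢ u → s ≢ v → t ≢ u → t ≢ v → f s ≢ u → f s ≢ v → f t ≢ u → f t ≢ v →
    Surgery s t f g → Surgery u v g h → Surgery u v f g' → Surgery s t g' h' → ∀ p → h' p ≡ h p
  Surgery-commute {s} {t} {u} {v} {f} {g} {g'} {h} {h'} P s≢u s≢v t≢u t≢v fs≢u fs≢v ft≢u ft≢v S T S' T' = Surgery-unique G' T' swapped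
    where
    inv : ∀ {x y} → f x ≡ y → f y ≡ x
    inv {x} refl = proj₂ (P x)
    G' : Pairing g'
    G' = Surgery-pairing P S'
    g-inv : ∀ {x y} → g x ≡ y → g y ≡ x
    g-inv {x} refl = proj₂ (Surgery-pairing P S x)
    g'-inv : ∀ {x y} → g' x ≡ y → g' y ≡ x
    g'-inv {x} refl = proj₂ (G' x)
    g's : g' s ≡ f s
    g's = Surgery.off S' s≢u s≢v fs≢u fs≢v
    g't : g' t ≡ f t
    g't = Surgery.off S' t≢u t≢v ft≢u ft≢v
    gu : g u ≡ f u
    gu = Surgery.off S (s≢u ∘ sym) (t≢u ∘ sym) (fs≢u ∘ inv) (ft≢u ∘ inv)
    gv : g v ≡ f v
    gv = Surgery.off S (s≢v ∘ sym) (t≢v ∘ sym) (fs≢v ∘ inv) (ft≢v ∘ inv)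
    g-fs : f s ≢ t → g (f s) ≡ f t
    g-fs fs≢t = Surgery.to-s S fs≢t (proj₂ (P s))
    g-ft : f t ≢ s → g (f t) ≡ f s
    g-ft ft≢s = Surgery.to-t S ft≢s (proj₂ (P t))
    h-off : ∀ {p q} → p ≢ u → p ≢ v → g p ≡ q → q ≢ u → q ≢ v → h p ≡ q
    h-off a b e c d = trans (Surgery.off T a b (c ∘ trans (sym e)) (d ∘ trans (sym e))) e

    off′ : ∀ {p} → p ≢ s → p ≢ t → g' p ≢ s → g' p ≢ t → h p ≡ g' p
    off′ {p} p≢s p≢t g'p≢s g'p≢t with place u v g p
    ... | dot-s refl = trans (Surgery.at-s T) (sym (Surgery.at-s S'))
    ... | dot-t refl = trans (Surgery.at-t T) (sym (Surgery.at-t S'))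
    ... | mate-s p≢u p≢v e = trans (Surgery.to-s T p≢v e) (trans gv (sym (Surgery.to-s S' p≢v (inv (trans (sym gu) (g-inv e))))))
    ... | mate-t p≢u p≢v e = trans (Surgery.to-t T p≢u e) (trans gu (sym (Surgery.to-t S' p≢u (inv (trans (sym gv) (g-inv e))))))
    ... | apart p≢u p≢v gp≢u gp≢v = trans (Surgery.off T p≢u p≢v gp≢u gp≢v) (trans gp≡fp (sym (Surgery.off S' p≢u p≢v (gp≢u ∘ trans gp≡fp) (gp≢v ∘ trans gp≡fp))))
      where
      gp≡fp : g p ≡ f p
      gp≡fp = Surgery.off S p≢s p≢t
        (λ e → g'p≢s (trans (Surgery.off S' p≢u p≢v (s≢u ∘ trans (sym e)) (s≢v ∘ trans (sym e))) e))
        (λ e → g'p≢t (trans (Surgery.off S' p≢u p≢v (t≢u ∘ trans (sym e)) (t≢v ∘ trans (sym e))) e))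

    swapped : Surgery s t g' h
    swapped = record
      { s≢t = Surgery.s≢t S
      ; at-s = h-off s≢u s≢v (Surgery.at-s S) t≢u t≢v
      ; at-t = h-off t≢u t≢v (Surgery.at-t S) s≢u s≢v
      ; to-s = λ {p} p≢t e → let p≡fs = trans (sym (g'-inv e)) g's in
          trans (cong h p≡fs) (trans (h-off fs≢u fs≢v (g-fs (p≢t ∘ trans p≡fs)) ft≢u ft≢v) (sym g't))
      ; to-t = λ {p} p≢s e → let p≡ft = trans (sym (g'-inv e)) g't in
          trans (cong h p≡ft) (trans (h-off ft≢u ft≢v (g-ft (p≢s ∘ trans p≡ft)) fs≢u fs≢v) (sym g's))
      ; off = off′ }

  private
    id-cup : ∀ {j : Fin (suc n)} {q} → q ≡ inj₁ j → ∀ k → match idDiag (inj₁ k) ≢ q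
    id-cup refl k e = inj₁≢inj₂ flip flip e (match-id (inj₁ k))

  loops-id : ∀ i → closes i idDiag ≡ 0
  loops-id i = closes-no i {idDiag} (id-cup refl (inject₁ i))

  closes-act : ∀ i {D : Diag n} → Pairing (match D) → closes i (act i D) ≡ 1
  closes-act i {D} P = closes-yes i {act i D} (Surgery.at-s (act-Surgery i {D} P))

  act-idem : ∀ i {D : Diag n} → Pairing (match D) → act i (act i D) ≡ act i D
  act-idem i {D} P = act-joined i (act-pairing i {D} P) (Surgery.at-s (act-Surgery i {D} P))

  module _ {i j : Fin n} (e : toℕ j ≡ suc (toℕ i)) where

    private
      cup⁺i≡cupj : cup⁺ i ≡ cup j
      cup⁺i≡cupj = cong inj₁ (toℕ-injective (trans (sym e) (sym (toℕ-inject₁ j))))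
      cupi≢cup⁺j : cup i ≢ cup⁺ j
      cupi≢cup⁺j c = ℕₚ.<⇒≢ (<-trans (n<1+n _) (n<1+n _)) (trans (trans (sym (toℕ-inject₁ i)) (cong (toℕ ∘ column) c)) (cong suc e))

    module _ {D : Diag n} (P : Pairing (match D)) where

      private
        D₁ D₂ : Diag n
        D₁ = act i D
        D₂ = act j D
        P₁ : Pairing (match D₁)
        P₁ = act-pairing i P
        P₂ : Pairing (match D₂)
        P₂ = act-pairing j P
        joined₁ : match D₁ (cup i) ≡ cup j
        joined₁ = trans (Surgery.at-s (act-Surgery i P)) cup⁺i≡cupj
        joined₂ : match D₂ (cup⁺ j) ≡ cup j
        joined₂ = Surgery.at-t (act-Surgery j P)
        inv : ∀ (D : Diag n) x {y} → Pairing (match D) → match D x ≡ y → match D y ≡ x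
        inv _ x Q refl = proj₂ (Q x)
        S₁ : Surgery (cup i) (cup j) (match (act j D₁)) (match (act i (act j D₁)))
        S₁ = subst (λ t → Surgery (cup i) t (match (act j D₁)) (match (act i (act j D₁)))) cup⁺i≡cupj (act-Surgery i (act-pairing j P₁))
        S₂ : Surgery (cup j) (cup i) (match D₂) (match (act i D₂))
        S₂ = Surgery-swap (subst (λ t → Surgery (cup i) t (match D₂) (match (act i D₂))) cup⁺i≡cupj (act-Surgery i P₂))

      act-braid₁ : act i (act j (act i D)) ≡ act i D
      act-braid₁ = diag-ext (Surgery-zigzag P₁ joined₁ cupi≢cup⁺j (act-Surgery j P₁) S₁)

      act-braid₂ : act j (act i (act j D)) ≡ act j D
      act-braid₂ = diag-ext (Surgery-zigzag P₂ joined₂ (cupi≢cup⁺j ∘ sym) S₂ (Surgery-swap (act-Surgery j (act-pairing i P₂))))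

      closes-braid₁ : closes j D₁ ≡ 0 × closes i (act j D₁) ≡ 0
      closes-braid₁ =
        closes-no j {D₁} (λ c → cupi≢cup⁺j (trans (sym (inv D₁ (cup i) P₁ joined₁)) c)) ,
        closes-no i {act j D₁} (λ c → cupi≢cup⁺j (trans (sym (inv D₁ (cup i) P₁ joined₁))
          (inv D₁ (cup⁺ j) P₁ (trans (sym (Surgery.to-s (act-Surgery j P₁) cupi≢cup⁺j joined₁)) (trans c cup⁺i≡cupj)))))

      closes-braid₂ : closes i D₂ ≡ 0 × closes j (act i D₂) ≡ 0
      closes-braid₂ =
        closes-no i {D₂} (λ c → cupi≢cup⁺j (trans (sym (inv D₂ (cup i) P₂ (trans c cup⁺i≡cupj))) (inv D₂ (cup⁺ j) P₂ joined₂))) ,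
        closes-no j {act i D₂} (λ c → cupi≢cup⁺j (sym (trans (sym c) (Surgery.at-s S₂))))

  module _ {i j : Fin n} (far : suc (suc (toℕ i)) ≤ toℕ j) where

    private
      i<j : toℕ i < toℕ j
      i<j = <⇒≤ far
      cups : ∀ {x y : Fin (suc n)} → toℕ x < toℕ y → _≢_ {A = Pt n} (inj₁ x) (inj₁ y)
      cups lt e = <-irrefl (cong (toℕ ∘ column) e) lt
      ι : ∀ i → toℕ (inject₁ {n} i) ≡ toℕ i
      ι = toℕ-inject₁
      a₁ : cup i ≢ cup j
      a₁ = cups (subst₂ _<_ (sym (ι i)) (sym (ι j)) i<j)
      a₂ : cup i ≢ cup⁺ j
      a₂ = cups (subst (_< suc (toℕ j)) (sym (ι i)) (m≤n⇒m≤1+n i<j))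
      a₃ : cup⁺ i ≢ cup j
      a₃ = cups (subst (suc (toℕ i) <_) (sym (ι j)) far)
      a₄ : cup⁺ i ≢ cup⁺ j
      a₄ = cups (s≤s i<j)

    act-commute : act i (act j idDiag) ≡ act j (act i idDiag)
    act-commute = diag-ext (Surgery-commute id-pairing a₁ a₂ a₃ a₄
      (id-cup refl (inject₁ i)) (id-cup refl (inject₁ i)) (id-cup refl (suc i)) (id-cup refl (suc i))
      (act-Surgery i id-pairing) (act-Surgery j (act-pairing i id-pairing))
      (act-Surgery j id-pairing) (act-Surgery i (act-pairing j id-pairing)))

    closes-commute : closes i (act j idDiag) ≡ 0 × closes j (act i idDiag) ≡ 0
    closes-commute =
      closes-no i {act j idDiag} (stays j a₁ a₂) ,
      closes-no j {act i idDiag} (stays i (a₁ ∘ sym) (a₃ ∘ sym))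
      where
      stays : ∀ k {x y} → inj₁ x ≢ cup k → inj₁ x ≢ cup⁺ k → match (act k idDiag) (inj₁ x) ≢ inj₁ y
      stays k {x} a b e = inj₁≢inj₂ flip flip (trans (sym (Surgery.off (act-Surgery k id-pairing) a b (id-cup refl x) (id-cup refl x))) e) (match-id (inj₁ x))

  loops-braid₁ : ∀ {i j : Fin n} → toℕ j ≡ suc (toℕ i) → loops (i ∷ j ∷ i ∷ []) idDiag ≡ loops (i ∷ []) idDiag
  loops-braid₁ {i} {j} e = cong₂ (λ a b → a + (b + loops (i ∷ []) idDiag))
    (proj₂ (closes-braid₁ e {D = idDiag} id-pairing)) (proj₁ (closes-braid₁ e {D = idDiag} id-pairing))

  loops-braid₂ : ∀ {i j : Fin n} → toℕ j ≡ suc (toℕ i) → loops (j ∷ i ∷ j ∷ []) idDiag ≡ loops (j ∷ []) idDiag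
  loops-braid₂ {i} {j} e = cong₂ (λ a b → a + (b + loops (j ∷ []) idDiag))
    (proj₂ (closes-braid₂ e {D = idDiag} id-pairing)) (proj₁ (closes-braid₂ e {D = idDiag} id-pairing))

  loops-commute : ∀ {i j : Fin n} → suc (suc (toℕ i)) ≤ toℕ j → loops (i ∷ j ∷ []) idDiag ≡ loops (j ∷ i ∷ []) idDiag
  loops-commute {i} {j} far = cong₂ _+_ (trans (proj₁ (closes-commute far)) (sym (proj₂ (closes-commute far))))
    (cong (_+ 0) (trans (loops-id j) (sym (loops-id i))))

-- The isomorphism

module _ {c ℓ : Level} (R : CommutativeRing c ℓ) (δ : CommutativeRing.Carrier R) {m : ℕ} where

  private
    n : ℕ
    n = suc m

  open Alg R δ n
  open LinearCombinations R δ n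
  open import Relation.Binary.Reasoning.Setoid setoid

  private
    diagram : Word → Diag n
    diagram u = acts u idDiag
    weight : Word → Carrier
    weight u = pow (loops u idDiag)

  -- Every word is sent to its diagram with the power of δ read off by `loops`. Nothing is reduced
  -- beforehand, so additivity and multiplicativity hold on representatives, before well-definedness
  -- is known.
  φ : TLE → DE
  φ = map (λ p → proj₁ p ⊗ weight (proj₂ p) , diagram (proj₂ p))

  private
    ev-φ : ∀ f x → ev f (φ x) ≈ ev (λ u → weight u ⊗ f (diagram u)) x
    ev-φ f [] = ≈-refl
    ev-φ f ((r , u) ∷ x) = +-cong (*-assoc _ _ _) (ev-φ f x)

    φ-++ : ∀ x y → φ (x ++ y) ≡ φ x ++ φ y
    φ-++ x y = Listₚ.map-++ _ x y

    ≡⇒≈D : ∀ {x y} → x ≡ y → x ≈D y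
    ≡⇒≈D refl _ = ≈-refl

    φ-+ : ∀ x y → φ (x ++ y) ≈D (φ x ++ φ y)
    φ-+ x y = ≡⇒≈D (φ-++ x y)

    φ-· : ∀ r x → φ (scale r x) ≈D scale r (φ x)
    φ-· r x = ≈D-ev (φ (scale r x)) (scale r (φ x)) λ f → begin
      ev f (φ (scale r x))  ≈⟨ ev-φ f (scale r x) ⟩
      ev _ (scale r x)      ≈⟨ ev-scale _ r x ⟩
      r ⊗ ev _ x            ≈⟨ *-congˡ (ev-φ f x) ⟨
      r ⊗ ev f (φ x)        ≈⟨ ev-scale f r (φ x) ⟨
      ev f (scale r (φ x))  ∎

    weight-++ : ∀ u v → weight (u ++ v) ≈ (weight u ⊗ weight v) ⊗ pow (circles (diagram u) (diagram v))
    weight-++ u v = begin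
      pow (loops (u ++ v) idDiag)                      ≡⟨ cong pow (loops-++ u v idDiag) ⟩
      pow (loops u (diagram v) + loops v idDiag)       ≡⟨ cong (λ k → pow (k + loops v idDiag)) (circles-acts u (acts-pairing v id-pairing)) ⟨
      pow (k + loops u idDiag + loops v idDiag)        ≡⟨ cong pow (trans (ℕₚ.+-assoc k (loops u idDiag) _) (ℕₚ.+-comm k _)) ⟩
      pow (loops u idDiag + loops v idDiag + k)        ≈⟨ pow-+ (loops u idDiag + loops v idDiag) k ⟩
      pow (loops u idDiag + loops v idDiag) ⊗ pow k    ≈⟨ *-congʳ (pow-+ (loops u idDiag) _) ⟩
      (weight u ⊗ weight v) ⊗ pow k                    ∎
      where
      k : ℕ
      k = circles (diagram u) (diagram v)

    diagram-++ : ∀ u v → diagram (u ++ v) ≡ diagram u ∗ diagram v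
    diagram-++ u v = trans (acts-++ u v idDiag) (sym (acts-∗ u (diagram v) (acts-pairing v id-pairing)))

    φ-* : ∀ x y → φ (x *T y) ≈D (φ x *D φ y)
    φ-* x y = ≈D-ev (φ (x *T y)) (φ x *D φ y) λ f → begin
      ev f (φ (x *T y))
        ≈⟨ ev-φ f (x *T y) ⟩
      ev (λ w → weight w ⊗ f (diagram w)) (x *T y)
        ≈⟨ ev-mul _ (λ u v → 1# , u ++ v) x y ⟩
      ev (λ u → ev (λ v → 1# ⊗ (weight (u ++ v) ⊗ f (diagram (u ++ v)))) y) x
        ≈⟨ ev-cong (λ u → ≈-trans (ev-cong (term f u) y) (ev-factor _ (weight u) y)) x ⟩
      ev (λ u → weight u ⊗ ev (λ v → weight v ⊗ (pow (circles (diagram u) (diagram v)) ⊗ f (diagram u ∗ diagram v))) y) x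
        ≈⟨ ev-cong (λ u → *-congˡ (ev-φ _ y)) x ⟨
      ev (λ u → weight u ⊗ ev (λ b → pow (circles (diagram u) b) ⊗ f (diagram u ∗ b)) (φ y)) x
        ≈⟨ ev-φ (λ a → ev (λ b → pow (circles a b) ⊗ f (a ∗ b)) (φ y)) x ⟨
      ev (λ a → ev (λ b → pow (circles a b) ⊗ f (a ∗ b)) (φ y)) (φ x)
        ≈⟨ ev-mul f (λ a b → pow (circles a b) , a ∗ b) (φ x) (φ y) ⟨
      ev f (φ x *D φ y) ∎
      where
      term : ∀ f u v → 1# ⊗ (weight (u ++ v) ⊗ f (diagram (u ++ v))) ≈
        weight u ⊗ (weight v ⊗ (pow (circles (diagram u) (diagram v)) ⊗ f (diagram u ∗ diagram v)))
      term f u v = begin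
        1# ⊗ (weight (u ++ v) ⊗ f (diagram (u ++ v)))  ≈⟨ *-identityˡ _ ⟩
        weight (u ++ v) ⊗ f (diagram (u ++ v))         ≈⟨ *-cong (weight-++ u v) (reflexive (cong f (diagram-++ u v))) ⟩
        ((weight u ⊗ weight v) ⊗ pow (circles (diagram u) (diagram v))) ⊗ f (diagram u ∗ diagram v) ≈⟨ *-assoc _ _ _ ⟩
        (weight u ⊗ weight v) ⊗ (pow (circles (diagram u) (diagram v)) ⊗ f (diagram u ∗ diagram v)) ≈⟨ *-assoc _ _ _ ⟩
        weight u ⊗ (weight v ⊗ (pow (circles (diagram u) (diagram v)) ⊗ f (diagram u ∗ diagram v))) ∎

    single-congD : ∀ {r s D D'} → r ≈ s → D ≡ D' → ((r , D) ∷ []) ≈D ((s , D') ∷ [])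
    single-congD {r} {s} {D} {D'} e e' = ≈D-ev ((r , D) ∷ []) ((s , D') ∷ []) λ f → ev-single f e e'

    φ-mono : ∀ u v → diagram u ≡ diagram v → loops u idDiag ≡ loops v idDiag → φ (mono u) ≈D φ (mono v)
    φ-mono u v e e' = single-congD (*-congˡ (reflexive (cong pow e'))) e

  -- Multiplicativity on representatives settles `*-cong-T`, so the relations are needed only for
  -- the bare words, that is, on the identity diagram.
  φ-well-defined : ∀ {x y} → x ≈T y → φ x ≈D φ y
  φ-well-defined (coeff-eq {x} {y} e) = ≈D-ev (φ x) (φ y) λ f →
    ≈-trans (ev-φ f x) (≈-trans (ev-coeff _≟ᵂ_ _ {x} {y} e) (≈-sym (ev-φ f y)))
  φ-well-defined (sym-T e) d = ≈-sym (φ-well-defined e d)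
  φ-well-defined (trans-T e e') d = ≈-trans (φ-well-defined e d) (φ-well-defined e' d)
  φ-well-defined (+-cong-T {x} {x'} {y} {y'} e e') d = ≈-trans (φ-+ x y d) (≈-trans
    (++-congD {φ x} {φ x'} {φ y} {φ y'} (φ-well-defined e) (φ-well-defined e') d) (≈-sym (φ-+ x' y' d)))
  φ-well-defined (*-cong-T {x} {x'} {y} {y'} e e') d = ≈-trans (φ-* x y d) (≈-trans
    (*-congD {φ x} {φ x'} {φ y} {φ y'} (φ-well-defined e) (φ-well-defined e') d) (≈-sym (φ-* x' y' d)))
  φ-well-defined (rel-sq i) = single-congD coefficient (act-idem i id-pairing)
    where
    coefficient : 1# ⊗ weight (i ∷ i ∷ []) ≈ δ ⊗ weight (i ∷ [])
    coefficient = ≈-trans (*-identityˡ _) (reflexive (cong (λ k → pow (k + loops (i ∷ []) idDiag)) (closes-act i id-pairing)))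
  φ-well-defined (rel-br₁ i j e) = φ-mono (i ∷ j ∷ i ∷ []) (i ∷ []) (act-braid₁ e {D = idDiag} id-pairing) (loops-braid₁ e)
  φ-well-defined (rel-br₂ i j e) = φ-mono (j ∷ i ∷ j ∷ []) (j ∷ []) (act-braid₂ e {D = idDiag} id-pairing) (loops-braid₂ e)
  φ-well-defined (rel-comm i j far) = φ-mono (i ∷ j ∷ []) (j ∷ i ∷ []) (act-commute far) (loops-commute far)

  φ-hom : IsAlgHom φ
  φ-hom = record
    { well-def = φ-well-defined
    ; into-NC = into-NC
    ; hom-+ = φ-+
    ; hom-· = φ-·
    ; hom-* = φ-*
    ; hom-1 = single-congD (*-identityˡ _) refl }
    where
    into-NC : ∀ x → AllNC (φ x)
    into-NC [] = []
    into-NC ((r , u) ∷ x) = acts-NC u ∷ into-NC x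

  φ-gen : ∀ i → φ (gen i) ≈D Egen i
  φ-gen i = single-congD (≈-trans (*-identityˡ _) (reflexive (cong (λ k → pow (k + 0)) (loops-id i)))) (sym (E-act i))

  φ-eMon : ∀ {ws} → Canonical n ws → φ (eMon ws) ≈D single (𝒟 n ws)
  φ-eMon {ws} c with canonical-spell c
  ... | u , U = subst (λ v → φ (mono v) ≈D single (𝒟 n ws)) (trans (sym (mapMaybe-label u)) (cong (mapMaybe (toLetter n)) (Spells.spelling U)))
                  (single-congD (≈-trans (*-identityˡ _) (reflexive (cong pow (Spells.reduced U)))) (sym (𝒟-acts U)))

  -- Injectivity: distinct canonical words have distinct diagrams, so on
  -- combinations of canonical words φ preserves coefficients.

  private
    Normal : TLE → Set c
    Normal = All (CanonicalWord ∘ proj₂)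

    diagram-injective : ∀ {u v} → CanonicalWord u → CanonicalWord v → diagram u ≡ diagram v → u ≡ v
    diagram-injective {u} {v} (ws , cu , U) (ws' , cv , V) e = Listₚ.map-injective (toℕ-injective ∘ ℕₚ.suc-injective)
      (trans (Spells.spelling U) (trans (cong cword (𝒟-injective cu cv (trans (𝒟-acts U) (trans e (sym (𝒟-acts V)))))) (sym (Spells.spelling V))))

    coeff-φ : ∀ {u} → CanonicalWord u → ∀ {x} → Normal x → coeff _≟D_ (diagram u) (φ x) ≈ coeff _≟ᵂ_ u x
    coeff-φ {u} U [] = ≈-refl
    coeff-φ {u} U {(r , v) ∷ x} (V@(_ , _ , V′) ∷ X) = +-cong entry (coeff-φ U X)
      where
      entry : (if does (diagram u ≟D diagram v) then r ⊗ weight v else 0#) ≈ (if does (u ≟ᵂ v) then r else 0#)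
      entry with diagram u ≟D diagram v | u ≟ᵂ v
      ... | yes _ | yes _ = ≈-trans (*-congˡ (reflexive (cong pow (Spells.reduced V′)))) (*-identityʳ r)
      ... | yes e | no c = ⊥-elim (c (diagram-injective U V e))
      ... | no c | yes refl = ⊥-elim (c refl)
      ... | no _ | no _ = ≈-refl

    -- Equality in `R` need not be decidable, so the distinction is by occurrence in the list: a
    -- word that occurs in a normal combination is canonical, any other has coefficient zero.
    occurs? : ∀ u x → (∃ λ r → (r , u) ∈ x) ⊎ coeff _≟ᵂ_ u x ≈ 0#
    occurs? u [] = inj₂ ≈-refl
    occurs? u ((r , v) ∷ x) with u ≟ᵂ v
    ... | yes refl = inj₁ (r , here refl)
    ... | no _ with occurs? u x
    ...   | inj₁ (s , p) = inj₁ (s , there p)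
    ...   | inj₂ e = inj₂ (≈-trans (+-identityˡ _) e)

    Normal-injective : ∀ {x y} → Normal x → Normal y → φ x ≈D φ y → x ≈T y
    Normal-injective {x} {y} X Y e = coeff-eq coefficients
      where
      canonical : ∀ {u} → CanonicalWord u → coeff _≟ᵂ_ u x ≈ coeff _≟ᵂ_ u y
      canonical {u} U = ≈-trans (≈-sym (coeff-φ U X)) (≈-trans (e (diagram u)) (coeff-φ U Y))
      coefficients : ∀ u → coeff _≟ᵂ_ u x ≈ coeff _≟ᵂ_ u y
      coefficients u with occurs? u x | occurs? u y
      ... | inj₁ (_ , p) | _ = canonical (All.lookup X p)
      ... | inj₂ _ | inj₁ (_ , p) = canonical (All.lookup Y p)
      ... | inj₂ a | inj₂ b = ≈-trans a (≈-sym b)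

  φ-injective : ∀ x y → φ x ≈D φ y → x ≈T y
  φ-injective x y e with normalise x | normalise y
  ... | x' , ex , X | y' , ey , Y = trans-T ex (trans-T (Normal-injective X Y
          λ d → ≈-trans (≈-sym (φ-well-defined ex d)) (≈-trans (e d) (φ-well-defined ey d))) (sym-T ey))

  φ-surjective : ∀ y → AllNC y → Σ TLE λ x → φ x ≈D y
  φ-surjective [] [] = [] , λ _ → ≈-refl
  φ-surjective ((r , D) ∷ y) (N ∷ Ns) = extend (𝒟-surjective N) (φ-surjective y Ns)
    where
    term : ∀ {ws u} → Spells ws u → 𝒟 n ws ≡ D → φ ((r , u) ∷ []) ≈D ((r , D) ∷ [])
    term U e = single-congD (≈-trans (*-congˡ (reflexive (cong pow (Spells.reduced U)))) (*-identityʳ r)) (trans (sym (𝒟-acts U)) e)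
    append-term : ∀ {ws} → ∃ (Spells ws) → 𝒟 n ws ≡ D → (Σ TLE λ x → φ x ≈D y) → Σ TLE λ x → φ x ≈D ((r , D) ∷ y)
    append-term (u , U) e (x , ex) = (r , u) ∷ x , ++-congD {φ ((r , u) ∷ [])} {(r , D) ∷ []} {φ x} {y} (term U e) ex
    extend : (∃ λ ws → Canonical n ws × 𝒟 n ws ≡ D) → (Σ TLE λ x → φ x ≈D y) → Σ TLE λ x → φ x ≈D ((r , D) ∷ y)
    extend (ws , c , e) = append-term (canonical-spell c) e

  φ-unique : ∀ ψ → IsAlgHom ψ → (∀ i → ψ (gen i) ≈D Egen i) → ∀ x → ψ x ≈D φ x
  φ-unique ψ H ψ-gen = go
    where
    open IsAlgHom H

    -- Additivity on `[] ++ []` makes each coefficient equal to its own double, and one copy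
    -- cancels.
    ψ-zero : ψ [] ≈D []
    ψ-zero d = cancel (≈-trans (hom-+ [] [] d) (coeff-++ (ψ []) (ψ [])))
      where
      coeff-++ : ∀ x y → coeff _≟D_ d (x ++ y) ≈ coeff _≟D_ d x ⊕ coeff _≟D_ d y
      coeff-++ [] y = ≈-sym (+-identityˡ _)
      coeff-++ (p ∷ x) y = ≈-trans (+-congˡ (coeff-++ x y)) (≈-sym (+-assoc _ _ _))
      cancel : ∀ {a} → a ≈ a ⊕ a → a ≈ 0#
      cancel {a} e = begin
        a              ≈⟨ +-identityˡ a ⟨
        0# ⊕ a         ≈⟨ +-congʳ (-‿inverseˡ a) ⟨
        (- a ⊕ a) ⊕ a  ≈⟨ +-assoc _ _ _ ⟩
        - a ⊕ (a ⊕ a)  ≈⟨ +-congˡ e ⟨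
        - a ⊕ a        ≈⟨ -‿inverseˡ a ⟩
        0#             ∎

    split : ∀ i u → mono (i ∷ u) ≈T (gen i *T mono u)
    split i u = sym-T (trans-T (mono-++ 1# 1# (i ∷ []) u) (single-cong (*-identityʳ 1#) refl))

    on-mono : ∀ u → ψ (mono u) ≈D φ (mono u)
    on-mono [] d = ≈-trans (hom-1 d) (≈-sym (IsAlgHom.hom-1 φ-hom d))
    on-mono (i ∷ u) d = begin
      coeff _≟D_ d (ψ (mono (i ∷ u)))         ≈⟨ well-def (split i u) d ⟩
      coeff _≟D_ d (ψ (gen i *T mono u))      ≈⟨ hom-* (gen i) (mono u) d ⟩
      coeff _≟D_ d (ψ (gen i) *D ψ (mono u))  ≈⟨ *-congD {ψ (gen i)} {φ (gen i)} {ψ (mono u)} {φ (mono u)}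
                                                    (λ d′ → ≈-trans (ψ-gen i d′) (≈-sym (φ-gen i d′))) (on-mono u) d ⟩
      coeff _≟D_ d (φ (gen i) *D φ (mono u))  ≈⟨ φ-* (gen i) (mono u) d ⟨
      coeff _≟D_ d (φ (gen i *T mono u))      ≈⟨ φ-well-defined (split i u) d ⟨
      coeff _≟D_ d (φ (mono (i ∷ u)))         ∎

    on-term : ∀ r u → ψ ((r , u) ∷ []) ≈D φ ((r , u) ∷ [])
    on-term r u d = begin
      coeff _≟D_ d (ψ ((r , u) ∷ []))     ≈⟨ well-def unscale d ⟩
      coeff _≟D_ d (ψ (scale r (mono u))) ≈⟨ hom-· r (mono u) d ⟩
      coeff _≟D_ d (scale r (ψ (mono u))) ≈⟨ scale-congD r {ψ (mono u)} {φ (mono u)} (on-mono u) d ⟩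
      coeff _≟D_ d (scale r (φ (mono u))) ≈⟨ φ-· r (mono u) d ⟨
      coeff _≟D_ d (φ (scale r (mono u))) ≈⟨ φ-well-defined unscale d ⟨
      coeff _≟D_ d (φ ((r , u) ∷ []))     ∎
      where
      unscale : ((r , u) ∷ []) ≈T scale r (mono u)
      unscale = single-cong (≈-sym (*-identityʳ r)) refl

    go : ∀ x → ψ x ≈D φ x
    go [] = ψ-zero
    go ((r , u) ∷ x) d = ≈-trans (hom-+ ((r , u) ∷ []) x d)
      (++-congD {ψ ((r , u) ∷ [])} {φ ((r , u) ∷ [])} {ψ x} {φ x} (on-term r u) (go x) d)

mainTheorem1 : {c ℓ : Level} (n : ℕ) → 1 ≤ n →
    ((ws : List (ℕ × ℕ)) → Canonical n ws →
    NCDiagram (𝒟 n ws)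
    × ((k : ℕ) → InI (𝒟 n ws) k ⇔ k ∈ map proj₁ ws)
    × ((k : ℕ) → InJ (𝒟 n ws) k ⇔ k ∈ map proj₂ ws)
    × ((D : Diag n) → NCDiagram D
    → ((k : ℕ) → InI D k ⇔ k ∈ map proj₁ ws)
    → ((k : ℕ) → InJ D k ⇔ k ∈ map proj₂ ws)
    → D ≡ 𝒟 n ws))
    × ((ws ws' : List (ℕ × ℕ)) → Canonical n ws → Canonical n ws'
    → 𝒟 n ws ≡ 𝒟 n ws' → ws ≡ ws')
    × ((D : Diag n) → NCDiagram D → Σ (List (ℕ × ℕ)) λ ws → Canonical n ws × 𝒟 n ws ≡ D)
    × ((R : CommutativeRing c ℓ) (δ : CommutativeRing.Carrier R) →
    let open Alg R δ n in
    Σ (TLE → DE) λ φ →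
    IsAlgIso φ
    × ((i : _) → φ (gen i) ≈D Egen i)
    × ((ws : List (ℕ × ℕ)) → Canonical n ws → φ (eMon ws) ≈D single (𝒟 n ws))
    × ((ψ : TLE → DE) → IsAlgHom ψ → ((i : _) → ψ (gen i) ≈D Egen i)
    → (x : TLE) → ψ x ≈D φ x))
mainTheorem1 (suc m) _ =
  (λ ws c → 𝒟-NC c , 𝒟-InI c , 𝒟-InJ c , λ D → 𝒟-unique c) ,
  (λ ws ws' → 𝒟-injective) ,
  (λ D → 𝒟-surjective) ,
  (λ R δ → φ R δ ,
    record { isHom = φ-hom R δ ; injective = φ-injective R δ ; surjective = φ-surjective R δ } ,
    φ-gen R δ ,
    (λ ws → φ-eMon R δ {ws = ws}) ,
    φ-unique R δ)
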